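{- For every integer $g\ge 2$, let $M(g)$ denote the maximal order of a group acting harmonically on some graph of genus $g$, i.e. the maximum of $|\Gamma|$ over all pairs $(G,\Gamma)$ where $G$ is a graph of genus $g$ and $\Gamma\le \mathrm{Aut}(G)$ acts harmonically on $G$. Then for every $g\ge 2$ we have $4(g-1)\le M(g)\le 6(g-1)$. In fact, for every $g\ge 2$, $M(g)\in\{4(g-1),\,6(g-1)\}$; moreover $M(g)=4(g-1)$ for infinitely many $g\geq 2$ and $M(g)=6(g-1)$ for infinitely many $g\geq 2$.
   Context: A graph is a finite, connected multigraph without loop edges (multiple edges between two vertices are allowed); $V(G)$, $E(G)$ are its vertex and edge sets. The genus of $G$ is $g(G)=|E(G)|-|V(G)|+1$. A morphism $\phi:G\to G'$ is a function $V(G)\cup E(G)\to V(G')\cup E(G')$ mapping vertices to vertices such that for each edge $e$ of $G$ with endpoints $x,y$, either $\phi(e)$ is an edge of $G'$ with endpoints $\phi(x),\phi(y)$, or $\phi(e)=\phi(x)=\phi(y)$ (then $e$ is called $\phi$-vertical). $\mathrm{Aut}(G)$ is the group of automorphisms of $G$ (compatible permutations of $V(G)$ and $E(G)$). For $x\in V(G)$, $x(1)$ is the subgraph consisting of $x$, the vertices adjacent to $x$, and the edges incident to $x$. A morphism $\phi$ is non-degenerate if $\phi(x(1))\ne\{\phi(x)\}$ for every $x\in V(G)$. A morphism $\phi:G\to G'$ is harmonic if for every $x\in V(G)$ the number $|\phi^{ -1}(e')\cap x(1)|$ of edges incident to $x$ mapping to $e'$ is independent of the choice of edge $e'$ of $G'$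 incident to $\phi(x)$. For a subgroup $\Delta\le\mathrm{Aut}(G)$, the quotient graph $G/\Delta$ has vertex set $V(G)/\Delta$ (the $\Delta$-orbits of vertices), and its edges are the $\Delta$-orbits $\Delta e$ of those edges $e$ of $G$ whose endpoints lie in distinct $\Delta$-orbits (the edge $\Delta e$ joins the orbits of the endpoints of $e$). The quotient morphism $\phi_\Delta:G\to G/\Delta$ sends a vertex $x$ to $\Delta x$, an edge $e$ whose endpoints lie in distinct orbits to $\Delta e$, and an edge $e$ with both endpoints in the same orbit to that orbit (a vertex). A subgroup $\Gamma\le\mathrm{Aut}(G)$ acts harmonically on $G$ if for every subgroup $\Delta\le\Gamma$ the quotient morphism $\phi_\Delta:G\to G/\Delta$ is harmonic and non-degenerate. -}

module Defs where

open import Algebra.Bundles using (Group)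
open import Data.Fin.Base using (Fin; fromℕ<)
open import Data.Fin.Permutation as Perm
  using (Permutation′; _⟨$⟩ʳ_; _⟨$⟩ˡ_; _∘ₚ_)
open import Data.Fin.Properties using (_≟_)
open import Data.Integer.Base as ℤ using (ℤ; +_)
open import Data.List.Base
  using (List; _∷_; length; filter; lookup; deduplicate; allFin)
open import Data.List.Membership.Propositional.Properties
  using (∈-allFin; ∈-filter⁺; ∈-filter⁻; ∈-lookup)
import Data.List.Membership.Propositional as Propositional
import Data.List.Membership.Setoid as Membership
import Data.List.Membership.Setoid.Properties as Membershipₚ
open import Data.List.Relation.Unary.All as All using ()
open import Data.List.Relation.Unary.AllPairs using (_∷_)
open import Data.List.Relation.Unary.Any as Any using (Any; here; there)
import Data.List.Relation.Unary.Any.Properties as Anyₚ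
import Data.List.Relation.Unary.Unique.Setoid as UniqueS
import Data.List.Relation.Unary.Unique.DecSetoid.Properties as UniqueDS
open import Data.Nat.Base as ℕ using (ℕ)
open import Data.Product.Base using (_×_; _,_; proj₁; proj₂; ∃-syntax)
open import Data.Sum.Base as Sum using (_⊎_; inj₁; inj₂; [_,_]′)
import Data.Sum.Properties as Sumₚ
open import Function.Base using (_∘_)
open import Level using (0ℓ; _⊔_)
open import Relation.Binary.Bundles using (DecSetoid)
open import Relation.Binary.Construct.Closure.ReflexiveTransitive
  as Star using (Star; _◅_; _◅◅_)
open import Relation.Binary.PropositionalEquality
  using (_≡_; _≢_; refl; sym; trans; cong; subst; subst₂)
  renaming (setoid to ≡-setoid)
open import Relation.Nullary using (¬_; Dec; yes; no; contradiction; ¬?; _×-dec_; _⊎-dec_)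
open import Relation.Unary using (Pred; _≐_; ｛_｝)

-- Each edge e carries the pair `ends e` in an arbitrary order; everything
-- below depends only on the underlying unordered pair, through `HasEnds`.

module _ {v m : ℕ} (ends : Fin m → Fin v × Fin v) where

  HasEnds′ : Fin m → Fin v → Fin v → Set
  HasEnds′ e x y = (proj₁ (ends e) ≡ x × proj₂ (ends e) ≡ y)
                 ⊎ (proj₁ (ends e) ≡ y × proj₂ (ends e) ≡ x)

  Adjacent′ : Fin v → Fin v → Set
  Adjacent′ x y = ∃[ e ] HasEnds′ e x y

record Graph : Set where
  field
    #V        : ℕ
    #E        : ℕ
    ends      : Fin #E → Fin #V × Fin #V
    loopless  : ∀ e → proj₁ (ends e) ≢ proj₂ (ends e)
    nonempty  : 0 ℕ.< #V
    connected : ∀ x y → Star (Adjacent′ ends) x y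

  Vertex : Set
  Vertex = Fin #V

  Edge : Set
  Edge = Fin #E

  Cell : Set
  Cell = Vertex ⊎ Edge

  HasEnds : Edge → Vertex → Vertex → Set
  HasEnds = HasEnds′ ends

  Adjacent : Vertex → Vertex → Set
  Adjacent = Adjacent′ ends

  Incident : Edge → Vertex → Set
  Incident e x = proj₁ (ends e) ≡ x ⊎ proj₂ (ends e) ≡ x

  incident? : ∀ e x → Dec (Incident e x)
  incident? e x = (proj₁ (ends e) ≟ x) ⊎-dec (proj₂ (ends e) ≟ x)

  -- The subgraph x(1), as a set of vertices and edges.
  star : Vertex → Pred Cell 0ℓ
  star x (inj₁ y) = x ≡ y ⊎ Adjacent x y
  star x (inj₂ e) = Incident e x

  genus : ℤ
  genus = + #E ℤ.- + #V ℤ.+ + 1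

open Graph

HasEnds-ends : ∀ G e → HasEnds G e (proj₁ (ends G e)) (proj₂ (ends G e))
HasEnds-ends G e = inj₁ (refl , refl)

record Morphism (G G′ : Graph) : Set where
  field
    onVertex : Vertex G → Vertex G′
    onEdge   : Edge G → Cell G′
    compat   : ∀ e x y → HasEnds G e x y →
               (∃[ e′ ] onEdge e ≡ inj₂ e′ × HasEnds G′ e′ (onVertex x) (onVertex y))
               ⊎ (onEdge e ≡ inj₁ (onVertex x) × onVertex x ≡ onVertex y)

  apply : Cell G → Cell G′
  apply = [ inj₁ ∘ onVertex , onEdge ]′

module _ {G G′ : Graph} (φ : Morphism G G′) where
  open Morphism φ

  Image : Pred (Cell G) 0ℓ → Pred (Cell G′) 0ℓ
  Image S w = ∃[ z ] S z × apply z ≡ w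

  NonDegenerate : Set
  NonDegenerate = ∀ x → ¬ (Image (star G x) ≐ ｛ inj₁ (onVertex x) ｝)

  mapsTo? : ∀ e e′ → Dec (onEdge e ≡ inj₂ e′)
  mapsTo? e e′ = Sumₚ.≡-dec _≟_ _≟_ (onEdge e) (inj₂ e′)

  -- |φ⁻¹(e′) ∩ x(1)|; the preimage of an edge contains only edges.
  multiplicity : Vertex G → Edge G′ → ℕ
  multiplicity x e′ =
    length (filter (λ e → incident? G e x ×-dec mapsTo? e e′) (allFin (#E G)))

  Harmonic : Set
  Harmonic = ∀ x e′ e″ → Incident G′ e′ (onVertex x) → Incident G′ e″ (onVertex x) →
             multiplicity x e′ ≡ multiplicity x e″

record Automorphism (G : Graph) : Set where
  field
    permV  : Permutation′ (#V G)
    permE  : Permutation′ (#E G)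
    compat : ∀ e x y → HasEnds G e x y →
             HasEnds G (permE ⟨$⟩ʳ e) (permV ⟨$⟩ʳ x) (permV ⟨$⟩ʳ y)

  infixr 8 _·ᵛ_ _·ᵉ_

  _·ᵛ_ : Vertex G → Vertex G
  _·ᵛ_ = permV ⟨$⟩ʳ_

  _·ᵉ_ : Edge G → Edge G
  _·ᵉ_ = permE ⟨$⟩ʳ_

open Automorphism using (permV; permE; compat; _·ᵛ_; _·ᵉ_)

module _ (G : Graph) where

  private
    inverse-compat : (α : Automorphism G) → ∀ e x y → HasEnds G e x y →
                     HasEnds G (permE α ⟨$⟩ˡ e) (permV α ⟨$⟩ˡ x) (permV α ⟨$⟩ˡ y)
    inverse-compat α e x y h = Sum.map back back (rename h′ h)
      where
      d = permE α ⟨$⟩ˡ e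
      u = proj₁ (ends G d)
      w = proj₂ (ends G d)

      h′ : HasEnds G e (α ·ᵛ u) (α ·ᵛ w)
      h′ = subst (λ c → HasEnds G c (α ·ᵛ u) (α ·ᵛ w)) (Perm.inverseʳ (permE α))
                 (compat α d u w (HasEnds-ends G d))

      rename : ∀ {a b c d} → HasEnds G e a b → HasEnds G e c d →
               (a ≡ c × b ≡ d) ⊎ (a ≡ d × b ≡ c)
      rename (inj₁ (refl , refl)) k = k
      rename (inj₂ (refl , refl)) (inj₁ (p , q)) = inj₂ (q , p)
      rename (inj₂ (refl , refl)) (inj₂ (p , q)) = inj₁ (q , p)

      back : ∀ {a b} → (α ·ᵛ u ≡ a) × (α ·ᵛ w ≡ b) →
             (u ≡ permV α ⟨$⟩ˡ a) × (w ≡ permV α ⟨$⟩ˡ b)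
      back (refl , refl) = sym (Perm.inverseˡ (permV α)) , sym (Perm.inverseˡ (permV α))

  Aut : Group 0ℓ 0ℓ
  Aut = record
    { Carrier = Automorphism G
    ; _≈_ = λ α β → permV α Perm.≈ permV β × permE α Perm.≈ permE β
    ; _∙_ = λ α β → record
        { permV  = permV β ∘ₚ permV α
        ; permE  = permE β ∘ₚ permE α
        ; compat = λ e x y h → compat α _ _ _ (compat β e x y h)
        }
    ; ε = record { permV = Perm.id ; permE = Perm.id ; compat = λ _ _ _ h → h }
    ; _⁻¹ = λ α → record
        { permV  = Perm.flip (permV α)
        ; permE  = Perm.flip (permE α)
        ; compat = inverse-compat α
        }
    ; isGroup = record
      { isMonoid = record
        { isSemigroup = record
          { isMagma = record
            { isEquivalence = record
              { refl  = (λ _ → refl) , (λ _ → refl)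
              ; sym   = λ (p , q) → (λ i → sym (p i)) , (λ i → sym (q i))
              ; trans = λ (p , q) (r , s) →
                  (λ i → trans (p i) (r i)) , (λ i → trans (q i) (s i))
              }
            ; ∙-cong = λ {α} (p , q) (r , s) →
                  (λ i → trans (cong (α ·ᵛ_) (r i)) (p _))
                , (λ i → trans (cong (α ·ᵉ_) (s i)) (q _))
            }
          ; assoc = λ _ _ _ → (λ _ → refl) , (λ _ → refl)
          }
        ; identity = (λ _ → (λ _ → refl) , (λ _ → refl))
                   , (λ _ → (λ _ → refl) , (λ _ → refl))
        }
      ; inverse = (λ α → (λ _ → Perm.inverseˡ (permV α)) , (λ _ → Perm.inverseˡ (permE α)))
                , (λ α → (λ _ → Perm.inverseʳ (permV α)) , (λ _ → Perm.inverseʳ (permE α)))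
      ; ⁻¹-cong = λ {α} {β} (p , q) → inv-cong (permV α) (permV β) p
                                    , inv-cong (permE α) (permE β) q
      }
    }
    where
    inv-cong : ∀ {n} (π ρ : Permutation′ n) → π Perm.≈ ρ → Perm.flip π Perm.≈ Perm.flip ρ
    inv-cong π ρ p i =
      trans (cong (π ⟨$⟩ˡ_) (sym (trans (p _) (Perm.inverseʳ ρ)))) (Perm.inverseˡ π)

-- A finite subgroup, given by the repetition-free list of its elements (so
-- that its orbits are decidable). As Aut(G) is finite, classically every
-- subgroup of Aut(G) is of this form.
record FiniteSubgroup {c ℓ} (𝔾 : Group c ℓ) : Set (c ⊔ ℓ) where
  open Group 𝔾
  open Membership setoid using (_∈_)
  field
    elements  : List Carrier
    unique    : UniqueS.Unique setoid elements
    ε-closed  : ε ∈ elements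
    ∙-closed  : ∀ {x y} → x ∈ elements → y ∈ elements → (x ∙ y) ∈ elements
    ⁻¹-closed : ∀ {x} → x ∈ elements → (x ⁻¹) ∈ elements

  order : ℕ
  order = length elements

open FiniteSubgroup using (elements; order)

_≤ᴳ_ : ∀ {c ℓ} {𝔾 : Group c ℓ} → FiniteSubgroup 𝔾 → FiniteSubgroup 𝔾 → Set (c ⊔ ℓ)
_≤ᴳ_ {𝔾 = 𝔾} Δ Γ = ∀ {x} → x ∈ elements Δ → x ∈ elements Γ
  where open Membership (Group.setoid 𝔾) using (_∈_)

-- Classes of the members of a list under a decidable equivalence, numbered
-- by the position of their representative.

module Classes (D : DecSetoid 0ℓ 0ℓ) (xs : List (DecSetoid.Carrier D)) where
  open DecSetoid D using (Carrier; setoid; _≈_)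
    renaming (_≟_ to _≈?_; refl to ≈-refl; sym to ≈-sym; trans to ≈-trans)
  open Membership setoid using (_∈_)
  open Propositional using () renaming (_∈_ to _∈≡_)

  reps : List Carrier
  reps = deduplicate _≈?_ xs

  #classes : ℕ
  #classes = length reps

  rep : Fin #classes → Carrier
  rep = lookup reps

  rep-∈ : ∀ i → rep i ∈≡ xs
  rep-∈ i = Membershipₚ.∈-deduplicate⁻ (≡-setoid Carrier) _≈?_ xs (∈-lookup i)

  private
    index-unique : ∀ {ys x y} → UniqueS.Unique setoid ys →
                   (p : x ∈ ys) (q : y ∈ ys) → x ≈ y → Any.index p ≡ Any.index q
    index-unique _        (here _)  (here _)  _   = refl
    index-unique (u ∷ us) (there p) (there q) x≈y = cong Fin.suc (index-unique us p q x≈y)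
    index-unique (u ∷ us) (here x≈) (there q) x≈y =
      contradiction (≈-trans (≈-sym x≈) (≈-trans x≈y (proj₂ (All.lookupAny u q))))
                    (proj₁ (All.lookupAny u q))
    index-unique (u ∷ us) (there p) (here y≈) x≈y =
      contradiction (≈-trans (≈-sym y≈) (≈-trans (≈-sym x≈y) (proj₂ (All.lookupAny u p))))
                    (proj₁ (All.lookupAny u p))

    ∈-reps : ∀ {x} → x ∈≡ xs → x ∈ reps
    ∈-reps p = Membershipₚ.∈-deduplicate⁺ setoid _≈?_ (λ y≈z y≈w → ≈-trans y≈w (≈-sym y≈z))
                 (Any.map (λ { refl → ≈-refl }) p)

  -- Opaque only to keep terms small: the lemmas below determine `class`.
  opaque
    class : ∀ {x} → x ∈≡ xs → Fin #classes
    class p = Any.index (∈-reps p)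

    rep-class : ∀ {x} (p : x ∈≡ xs) → x ≈ rep (class p)
    rep-class p = Anyₚ.lookup-index (∈-reps p)

    class-cong : ∀ {x y} (p : x ∈≡ xs) (q : y ∈≡ xs) → x ≈ y → class p ≡ class q
    class-cong p q =
      index-unique (UniqueDS.deduplicate-! D xs) (∈-reps p) (∈-reps q)

    class-injective : ∀ {x y} (p : x ∈≡ xs) (q : y ∈≡ xs) → class p ≡ class q → x ≈ y
    class-injective p q = Membershipₚ.index-injective setoid (∈-reps p) (∈-reps q)

    class-surjective : ∀ i (p : rep i ∈≡ xs) → class p ≡ i
    class-surjective i p =
      trans (index-unique (UniqueDS.deduplicate-! D xs) (∈-reps p) at-i ≈-refl)
            (index-at reps i)
      where
      at : ∀ ys i → lookup ys i ∈ ys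
      at (y ∷ ys) Fin.zero    = here ≈-refl
      at (y ∷ ys) (Fin.suc i) = there (at ys i)

      index-at : ∀ ys i → Any.index (at ys i) ≡ i
      index-at (y ∷ ys) Fin.zero    = refl
      index-at (y ∷ ys) (Fin.suc i) = cong Fin.suc (index-at ys i)

      at-i : rep i ∈ reps
      at-i = at reps i

module _ {G : Graph} (Δ : FiniteSubgroup (Aut G)) where
  private
    open module 𝔸 = Group (Aut G) using (_⁻¹; _∙_)
    open Membership 𝔸.setoid using (_∈_; find)
    open FiniteSubgroup Δ using (ε-closed; ∙-closed; ⁻¹-closed)

  SameOrbitᵛ : Vertex G → Vertex G → Set
  SameOrbitᵛ x y = Any (λ γ → γ ·ᵛ x ≡ y) (elements Δ)

  SameOrbitᵉ : Edge G → Edge G → Set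
  SameOrbitᵉ e f = Any (λ γ → γ ·ᵉ e ≡ f) (elements Δ)

  private
    moveᵛ : ∀ γ {x y} → γ ∈ elements Δ → γ ·ᵛ x ≡ y → SameOrbitᵛ x y
    moveᵛ _ {x} γ∈ refl = Any.map (λ (p , _) → sym (p x)) γ∈

    moveᵉ : ∀ γ {e f} → γ ∈ elements Δ → γ ·ᵉ e ≡ f → SameOrbitᵉ e f
    moveᵉ _ {e} γ∈ refl = Any.map (λ (_ , p) → sym (p e)) γ∈

  vertexOrbits : DecSetoid 0ℓ 0ℓ
  vertexOrbits = record
    { Carrier = Vertex G
    ; _≈_ = SameOrbitᵛ
    ; isDecEquivalence = record
      { isEquivalence = record
        { refl  = moveᵛ 𝔸.ε ε-closed refl
        ; sym   = λ {x} {y} h → let γ , γ∈ , p = find h in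
            moveᵛ (γ ⁻¹) (⁻¹-closed {γ} γ∈)
              (trans (cong (permV γ ⟨$⟩ˡ_) (sym p)) (Perm.inverseˡ (permV γ)))
        ; trans = λ {x} {y} {z} h k → let γ , γ∈ , p = find h ; δ , δ∈ , q = find k in
            moveᵛ (δ ∙ γ) (∙-closed {δ} {γ} δ∈ γ∈)
              (trans (cong (δ ·ᵛ_) p) q)
        }
      ; _≟_ = λ x y → Any.any? (λ γ → γ ·ᵛ x ≟ y) (elements Δ)
      }
    }

  edgeOrbits : DecSetoid 0ℓ 0ℓ
  edgeOrbits = record
    { Carrier = Edge G
    ; _≈_ = SameOrbitᵉ
    ; isDecEquivalence = record
      { isEquivalence = record
        { refl  = moveᵉ 𝔸.ε ε-closed refl
        ; sym   = λ {e} {f} h → let γ , γ∈ , p = find h in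
            moveᵉ (γ ⁻¹) (⁻¹-closed {γ} γ∈)
              (trans (cong (permE γ ⟨$⟩ˡ_) (sym p)) (Perm.inverseˡ (permE γ)))
        ; trans = λ {e} {f} {g} h k → let γ , γ∈ , p = find h ; δ , δ∈ , q = find k in
            moveᵉ (δ ∙ γ) (∙-closed {δ} {γ} δ∈ γ∈)
              (trans (cong (δ ·ᵉ_) p) q)
        }
      ; _≟_ = λ e f → Any.any? (λ γ → γ ·ᵉ e ≟ f) (elements Δ)
      }
    }

  private
    module 𝕍 = DecSetoid vertexOrbits

  Vertical : Edge G → Set
  Vertical e = SameOrbitᵛ (proj₁ (ends G e)) (proj₂ (ends G e))

  vertical? : ∀ e → Dec (Vertical e)
  vertical? e = proj₁ (ends G e) 𝕍.≟ proj₂ (ends G e)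

  nonVertical : List (Edge G)
  nonVertical = filter (¬? ∘ vertical?) (allFin (#E G))

  module VertexClasses = Classes vertexOrbits (allFin (#V G))
  module EdgeClasses = Classes edgeOrbits nonVertical

  orbitᵛ : Vertex G → Fin VertexClasses.#classes
  orbitᵛ x = VertexClasses.class (∈-allFin x)

  orbitᵉ : ∀ e → ¬ Vertical e → Fin EdgeClasses.#classes
  orbitᵉ e ¬v = EdgeClasses.class (∈-filter⁺ (¬? ∘ vertical?) (∈-allFin e) ¬v)

  quotientEnds : Fin EdgeClasses.#classes → Fin VertexClasses.#classes × Fin VertexClasses.#classes
  quotientEnds i = let x , y = ends G (EdgeClasses.rep i) in orbitᵛ x , orbitᵛ y

  orbitᵛ-cong : ∀ x y → SameOrbitᵛ x y → orbitᵛ x ≡ orbitᵛ y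
  orbitᵛ-cong x y = VertexClasses.class-cong (∈-allFin x) (∈-allFin y)

  orbitᵛ-injective : ∀ x y → orbitᵛ x ≡ orbitᵛ y → SameOrbitᵛ x y
  orbitᵛ-injective x y = VertexClasses.class-injective (∈-allFin x) (∈-allFin y)

  orbit-ends : ∀ e x y (¬v : ¬ Vertical e) → HasEnds G e x y →
               HasEnds′ quotientEnds (orbitᵉ e ¬v) (orbitᵛ x) (orbitᵛ y)
  orbit-ends e x y ¬v h =
    let γ , γ∈ , p = find (EdgeClasses.rep-class (∈-filter⁺ (¬? ∘ vertical?) (∈-allFin e) ¬v))
        move : ∀ {z w} → w ≡ γ ·ᵛ z → orbitᵛ w ≡ orbitᵛ z
        move {z} {w} q = sym (orbitᵛ-cong z w (moveᵛ γ γ∈ (sym q)))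
        h′ = subst (λ f → HasEnds G f (γ ·ᵛ x) (γ ·ᵛ y)) p (compat γ e x y h)
    in Sum.map (λ (q , r) → move q , move r) (λ (q , r) → move q , move r) h′

  vertical-ends : ∀ {e x y} → HasEnds G e x y → Vertical e → SameOrbitᵛ x y
  vertical-ends (inj₁ (refl , refl)) v = v
  vertical-ends (inj₂ (refl , refl)) v = 𝕍.sym v

  QuotientPath : Fin VertexClasses.#classes → Fin VertexClasses.#classes → Set
  QuotientPath = Star (Adjacent′ quotientEnds)

  project-step : ∀ e x y → HasEnds G e x y → Dec (Vertical e) → QuotientPath (orbitᵛ x) (orbitᵛ y)
  project-step e x y h (yes v) =
    subst (QuotientPath (orbitᵛ x)) (orbitᵛ-cong x y (vertical-ends h v)) Star.ε
  project-step e x y h (no ¬v) = (orbitᵉ e ¬v , orbit-ends e x y ¬v h) ◅ Star.ε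

  project : ∀ {x y} → Star (Adjacent G) x y → QuotientPath (orbitᵛ x) (orbitᵛ y)
  project Star.ε = Star.ε
  project {x} (_◅_ {j = z} (e , h) s) = project-step e x z h (vertical? e) ◅◅ project s

  quotient : Graph
  quotient = record
    { #V        = VertexClasses.#classes
    ; #E        = EdgeClasses.#classes
    ; ends      = quotientEnds
    ; loopless  = λ i p → proj₂ (∈-filter⁻ (¬? ∘ vertical?) {xs = allFin (#E G)} (EdgeClasses.rep-∈ i))
                                (orbitᵛ-injective _ _ p)
    ; nonempty  = inhabited (orbitᵛ (fromℕ< (nonempty G)))
    ; connected = λ i j → subst₂ (Star (Adjacent′ quotientEnds))
                            (VertexClasses.class-surjective i (∈-allFin _))
                            (VertexClasses.class-surjective j (∈-allFin _))
                            (project (connected G (VertexClasses.rep i) (VertexClasses.rep j)))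
    }
    where
    inhabited : ∀ {n} → Fin n → 0 ℕ.< n
    inhabited Fin.zero    = ℕ.z<s
    inhabited (Fin.suc _) = ℕ.z<s

  edgeImage : ∀ e → Dec (Vertical e) → Cell quotient
  edgeImage e (yes _) = inj₁ (orbitᵛ (proj₁ (ends G e)))
  edgeImage e (no ¬v) = inj₂ (orbitᵉ e ¬v)

  quotientMap : Morphism G quotient
  quotientMap = record
    { onVertex = orbitᵛ
    ; onEdge   = λ e → edgeImage e (vertical? e)
    ; compat   = λ e x y h → quotient-compat e x y h (vertical? e)
    }
    where
    first : ∀ e x y → HasEnds G e x y → Vertical e → orbitᵛ (proj₁ (ends G e)) ≡ orbitᵛ x
    first e x y (inj₁ (p , _)) v = cong orbitᵛ p
    first e x y (inj₂ (_ , q)) v =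
      trans (orbitᵛ-cong (proj₁ (ends G e)) (proj₂ (ends G e)) v) (cong orbitᵛ q)

    quotient-compat : ∀ e x y → HasEnds G e x y → (d : Dec (Vertical e)) →
      (∃[ e′ ] edgeImage e d ≡ inj₂ e′ × HasEnds quotient e′ (orbitᵛ x) (orbitᵛ y))
      ⊎ (edgeImage e d ≡ inj₁ (orbitᵛ x) × orbitᵛ x ≡ orbitᵛ y)
    quotient-compat e x y h (yes v) =
      inj₂ (cong inj₁ (first e x y h v) , orbitᵛ-cong x y (vertical-ends h v))
    quotient-compat e x y h (no ¬v) = inj₁ (orbitᵉ e ¬v , refl , orbit-ends e x y ¬v h)

ActsHarmonically : (G : Graph) → FiniteSubgroup (Aut G) → Set
ActsHarmonically G Γ = ∀ Δ → Δ ≤ᴳ Γ →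
  Harmonic (quotientMap Δ) × NonDegenerate (quotientMap Δ)

HarmonicGroupOrder : ℕ → ℕ → Set
HarmonicGroupOrder g n =
  ∃[ G ] genus G ≡ + g × (∃[ Γ ] ActsHarmonically G Γ × order Γ ≡ n)

IsMaxHarmonicGroupOrder : ℕ → ℕ → Set
IsMaxHarmonicGroupOrder g m =
  HarmonicGroupOrder g m × (∀ n → HarmonicGroupOrder g n → n ℕ.≤ m)

InfinitelyMany : (ℕ → Set) → Set
InfinitelyMany P = ∀ n → ∃[ g ] n ℕ.≤ g × P g

{-# OPTIONS --safe #-}
-- Harmonicity forces Γ to act freely on flags (x, e). Put n = |Γ| and lift a
-- spanning tree of G/Γ to G, with vertex set T. Counting orbits,
--   (g - 1) + n = Σ (n - |Γt|) + Σ |Γe|,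
-- over t ∈ T and over the edge orbits not in the tree. A vertex stabilizer of
-- order r contributes n - n/r; an edge contributes n, or n/2 if it is flipped.
-- So each summand is 0, n/2, 2n/3 or at least 3n/4, and as the sum exceeds n it
-- is at least 5n/4 or else n/2 + 2n/3. In the first case n ≤ 4(g - 1). In the
-- second n = 6(g - 1), and connectedness shows that Γ is generated by an element
-- of order 2 and one of order 3. Conversely a group so generated acts
-- harmonically on the graph of cosets of these two subgroups. Hence M(g) is
-- 6(g - 1) if some group of order 6(g - 1) is (2,3)-generated, which a finite
-- search decides, and otherwise 4(g - 1), attained by a dihedral group.
--
-- The group ℤ/N ⋊ ℤ/6 is (2,3)-generated for N = 9j² + 3j + 1. For a prime
-- p > 6 with p ≡ 2 mod 3 no group of order 6p is: its subgroup of order p is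
-- normal and commutes with the element σ of order 3 and with w = τστ, whence
-- w ∈ ⟨σ⟩ and the group generated by σ and τ has at most 6 elements.

module Submission where

open import Defs
open import Algebra.Bundles using (Group; RawGroup)
import Algebra.Morphism.GroupMonomorphism as GroupMonomorphism
open import Algebra.Morphism.Structures using (IsGroupMonomorphism)
import Algebra.Properties.Group as GroupProperties
import Algebra.Properties.Monoid.Mult as MonoidMult
open import Algebra.Structures using (IsGroup)
open import Data.Bool.Base using (Bool; true; false; not)
open import Data.Empty using (⊥)
open import Data.Fin.Base as Fin using (Fin; zero; suc; toℕ; fromℕ<; combine; remQuot; splitAt; join; _↑ˡ_; _↑ʳ_)
open import Data.Fin.Permutation as Perm using (permutation; _⟨$⟩ˡ_)
import Data.Fin.Properties as Finₚ
open import Data.Fin.Properties using (any?; all?)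
open import Data.Integer.Base as ℤ using (ℤ)
import Data.Integer.DivMod as ℤDivMod
import Data.Integer.Properties as ℤₚ
open import Data.Integer.Tactic.RingSolver using (solve-∀)
open import Data.List.Base using (List; []; _∷_; _++_; _∷ʳ_; length; filter; lookup; map; allFin; foldr)
open import Data.List.Membership.Propositional using (_∈_; find; lose)
open import Data.List.Membership.Propositional.Properties using (∈-allFin; ∈-filter⁺; ∈-filter⁻; ∈-lookup; ∈-++⁺ˡ; ∈-++⁺ʳ; ∈-++⁻; ∈-map⁺)
import Data.List.Membership.Setoid as SetoidMembership
import Data.List.Membership.Setoid.Properties as SetoidMembershipₚ
import Data.List.Properties as Listₚ
open import Data.List.Relation.Unary.All as All using (All; []; _∷_)
open import Data.List.Relation.Unary.AllPairs using ([]; _∷_)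
open import Data.List.Relation.Unary.Any as Any using (Any; here; there)
import Data.List.Relation.Unary.Any.Properties as Anyₚ
import Data.List.Relation.Unary.Unique.Propositional.Properties as Uniqueₚ
import Data.List.Relation.Unary.Unique.Setoid as UniqueSetoid
import Data.List.Relation.Unary.Unique.Setoid.Properties as UniqueSetoidₚ
open import Data.Nat using (ℕ; zero; suc; _+_; _*_; _∸_; _≤_; _<_; z≤n; s≤s; NonZero)
import Data.Nat as ℕ
open import Data.Nat.Coprimality using (prime⇒coprime; coprime-Bézout)
open import Data.Nat.DivMod using (_%_; _/_)
import Data.Nat.DivMod as DivMod
open import Data.Nat.Divisibility using (_∣_; divides)
import Data.Nat.Divisibility as Div
open import Data.Nat.GCD using (module Bézout)
open import Data.Nat.ListAction using (product)
open import Data.Nat.Primality using (Prime; prime?)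
import Data.Nat.Primality as Primality
open import Data.Nat.Primality.Factorisation using (factorise; PrimeFactorisation)
import Data.Nat.Properties as ℕₚ
open import Data.Product using (Σ-syntax; ∃; ∃-syntax; _×_; _,_; proj₁; proj₂)
open import Data.Sum using (_⊎_; inj₁; inj₂; [_,_]′)
import Data.Sum as Sum
import Data.Sum.Properties as Sumₚ
open import Data.Unit.Base using (tt)
open import Data.Vec.Base as Vec using (Vec)
import Data.Vec.Properties as Vecₚ
open import Function.Base using (_∘_; id; case_of_)
open import Level using (0ℓ)
open import Relation.Binary.Bundles using (DecSetoid; Setoid)
import Relation.Binary.Construct.Closure.ReflexiveTransitive as Star
open import Relation.Binary.Construct.Closure.ReflexiveTransitive using (Star; _◅_; _◅◅_)
open import Relation.Binary.Definitions using (tri<; tri≈; tri>)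
open import Relation.Binary.PropositionalEquality using (_≡_; _≢_; refl; sym; trans; cong; cong₂; subst; subst₂; isEquivalence; module ≡-Reasoning) renaming (setoid to ≡-setoid)
open import Relation.Nullary using (¬_; Dec; yes; no; contradiction; ¬?; _×-dec_; _⊎-dec_)
open import Relation.Nullary.Decidable using (map′; from-yes)
open import Relation.Unary using (Pred; Decidable)

open Graph
open Automorphism using (permV; permE; compat; _·ᵛ_; _·ᵉ_)
open FiniteSubgroup using (elements; order)

-- Counting in Fin n

-- The constants are Euler characteristics. A coset graph of a group of order n for two subgroups of
-- orders a and b that generate it has g - 1 = n(1 - 1/a - 1/b); the pair (2, 3) gives n = 6(g - 1)
-- and the next best pair (2, 4) gives 4(g - 1). The latter is always available: a dihedral group of
-- order 4(g - 1) is generated by a Klein four-group and a reflection. A summand n/2 has two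
-- sources, a vertex with stabilizer of order 2 and an edge flipped by an involution. The bound
-- therefore weighs a `Cell`, while the converse realizes only the first source, the second being
-- its unsubdivided form. As M is to be a function, the case distinction has to be decided: hence
-- the search through Cayley tables. The nonexistence for order 6p avoids Sylow theory. One count of
-- the fixed points of a permutation of prime order yields both Cauchy's theorem and the fact that σ
-- centralizes the subgroup of order p; two pigeonhole arguments yield the normality of that
-- subgroup (6p < p²) and w ∈ ⟨σ⟩ (6p < 9p).

module _ {c ℓ} (S : Setoid c ℓ) where
  open Setoid S using (_≈_) renaming (Carrier to A; sym to ≈-sym)
  open SetoidMembership S using () renaming (_∈_ to _∈ₛ_)

  Unique⇒lookup-injective : ∀ {xs : List A} → UniqueSetoid.Unique S xs →
                            ∀ i j → lookup xs i ≈ lookup xs j → i ≡ j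
  Unique⇒lookup-injective {x ∷ xs} (u ∷ us) zero    zero    _ = refl
  Unique⇒lookup-injective {x ∷ xs} (u ∷ us) zero    (suc j) p =
    contradiction p (All.lookup u (∈-lookup {xs = xs} j))
  Unique⇒lookup-injective {x ∷ xs} (u ∷ us) (suc i) zero    p =
    contradiction (≈-sym p) (All.lookup u (∈-lookup {xs = xs} i))
  Unique⇒lookup-injective {x ∷ xs} (u ∷ us) (suc i) (suc j) p =
    cong suc (Unique⇒lookup-injective us i j p)

-- It has the same shape as `multiplicity`, so that facts about `count` apply to multiplicities
-- without conversion.
count : ∀ {n} {P : Pred (Fin n) 0ℓ} → Decidable P → ℕ
count {n} P? = length (filter P? (allFin n))

module Members {n} {P : Pred (Fin n) 0ℓ} (P? : Decidable P) where

  member : Fin (count P?) → Fin n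
  member = lookup (filter P? (allFin n))

  member-∈ : ∀ k → P (member k)
  member-∈ k = proj₂ (∈-filter⁻ P? {xs = allFin n} (∈-lookup k))

  member-injective : ∀ k l → member k ≡ member l → k ≡ l
  member-injective =
    Unique⇒lookup-injective (≡-setoid (Fin n)) (Uniqueₚ.filter⁺ P? (Uniqueₚ.allFin⁺ n))

  index : ∀ {i} → P i → Fin (count P?)
  index {i} p = Any.index (∈-filter⁺ P? (∈-allFin i) p)

  member-index : ∀ {i} (p : P i) → member (index p) ≡ i
  member-index {i} p = sym (Anyₚ.lookup-index (∈-filter⁺ P? (∈-allFin i) p))

  index-injective : ∀ {i j} (p : P i) (q : P j) → index p ≡ index q → i ≡ j
  index-injective p q eq =
    trans (sym (member-index p)) (trans (cong member eq) (member-index q))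

count-injection : ∀ {m n} {P : Pred (Fin m) 0ℓ} {Q : Pred (Fin n) 0ℓ}
                  (P? : Decidable P) (Q? : Decidable Q) (f : Fin m → Fin n) →
                  (∀ {i j} → f i ≡ f j → i ≡ j) → (∀ {i} → P i → Q (f i)) →
                  count P? ≤ count Q?
count-injection P? Q? f inj P⇒Q =
  Finₚ.injective⇒≤ {f = λ k → Qₘ.index (P⇒Q (Pₘ.member-∈ k))}
    λ {k} {l} eq → Pₘ.member-injective k l (inj (Qₘ.index-injective _ _ eq))
  where
  module Pₘ = Members P?
  module Qₘ = Members Q?

count-all : ∀ {n} {P : Pred (Fin n) 0ℓ} (P? : Decidable P) → (∀ i → P i) → count P? ≡ n
count-all {n} P? all =
  trans (cong length (Listₚ.filter-all P? {xs = allFin n} (All.tabulate (λ {i} _ → all i))))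
        (Listₚ.length-tabulate id)

length-filter-⊎ : ∀ {A : Set} {P Q R : Pred A 0ℓ}
                  (P? : Decidable P) (Q? : Decidable Q) (R? : Decidable R) →
                  (∀ {x} → R x → P x ⊎ Q x) → (∀ {x} → P x → R x) → (∀ {x} → Q x → R x) →
                  (∀ {x} → P x → ¬ Q x) → ∀ xs →
                  length (filter R? xs) ≡ length (filter P? xs) + length (filter Q? xs)
length-filter-⊎ P? Q? R? split inl inr disj [] = refl
length-filter-⊎ P? Q? R? split inl inr disj (x ∷ xs)
  with ih ← length-filter-⊎ P? Q? R? split inl inr disj xs | R? x | P? x | Q? x
... | yes r | yes p | yes q = contradiction q (disj p)
... | yes r | yes p | no ¬q = cong suc ih
... | yes r | no ¬p | yes q = trans (cong suc ih) (sym (ℕₚ.+-suc _ _))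
... | yes r | no ¬p | no ¬q = contradiction (split r) [ ¬p , ¬q ]′
... | no ¬r | yes p | _     = contradiction (inl p) ¬r
... | no ¬r | no ¬p | yes q = contradiction (inr q) ¬r
... | no ¬r | no ¬p | no ¬q = ih

count-none : ∀ {n} {P : Pred (Fin n) 0ℓ} (P? : Decidable P) → (∀ i → ¬ P i) → count P? ≡ 0
count-none {n} P? none =
  cong length (Listₚ.filter-none P? {xs = allFin n} (All.tabulate (λ {i} _ → none i)))

-- The common core of the orbit-stabilizer theorem, of Lagrange's theorem and of the count of the
-- orbits of a permutation of prime order.
×-bijection⇒count : ∀ {m k n} {P : Pred (Fin n) 0ℓ} (P? : Decidable P) (f : Fin m → Fin k → Fin n) →
                    (∀ i j → P (f i j)) → (∀ {i j i′ j′} → f i j ≡ f i′ j′ → i ≡ i′ × j ≡ j′) →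
                    (∀ {x} → P x → ∃[ i ] ∃[ j ] f i j ≡ x) → m * k ≡ count P?
×-bijection⇒count {m} {k} P? f P-f inj surj = ℕₚ.≤-antisym
  (Finₚ.injective⇒≤ {f = λ c → let i , j = remQuot {m} k c in index (P-f i j)}
    λ {c} {d} eq → let p , q = inj (index-injective _ _ eq) in
      trans (sym (Finₚ.combine-remQuot {m} k c))
        (trans (cong₂ combine p q) (Finₚ.combine-remQuot {m} k d)))
  (Finₚ.injective⇒≤ {f = λ x → let i , j , _ = surj (member-∈ x) in combine i j}
    λ {x} {y} eq → let i , j , p = surj (member-∈ x) ; i′ , j′ , q = surj (member-∈ y)
                       r , s = Finₚ.combine-injective i j i′ j′ eq in
      member-injective x y (trans (sym p) (trans (cong₂ f r s) q)))
  where open Members P?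

×-bijection⇒≡ : ∀ {m k n} (f : Fin m → Fin k → Fin n) →
                (∀ {i j i′ j′} → f i j ≡ f i′ j′ → i ≡ i′ × j ≡ j′) →
                (∀ x → ∃[ i ] ∃[ j ] f i j ≡ x) → m * k ≡ n
×-bijection⇒≡ f inj surj =
  trans (×-bijection⇒count (λ _ → yes tt) f (λ _ _ → tt) inj (λ {x} _ → surj x))
        (count-all (λ _ → yes tt) (λ _ → tt))

-- Reachability for a decidable relation on Fin n

module Reachability {n} {R : Fin n → Fin n → Set} (R? : ∀ i j → Dec (R i j)) where

  -- Paths whose interior vertices lie in the given list (Floyd–Warshall).
  Via : List (Fin n) → Fin n → Fin n → Set
  Via []       x y = x ≡ y ⊎ R x y
  Via (k ∷ ks) x y = Via ks x y ⊎ (Via ks x k × Via ks k y)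

  via? : ∀ ks x y → Dec (Via ks x y)
  via? []       x y = (x Finₚ.≟ y) ⊎-dec R? x y
  via? (k ∷ ks) x y = via? ks x y ⊎-dec (via? ks x k ×-dec via? ks k y)

  via-base : ∀ ks {x y} → Via [] x y → Via ks x y
  via-base []       v = v
  via-base (k ∷ ks) v = inj₁ (via-base ks v)

  via-sound : ∀ ks {x y} → Via ks x y → Star R x y
  via-sound []       (inj₁ refl)    = Star.ε
  via-sound []       (inj₂ r)       = r ◅ Star.ε
  via-sound (k ∷ ks) (inj₁ v)       = via-sound ks v
  via-sound (k ∷ ks) (inj₂ (v , w)) = via-sound ks v ◅◅ via-sound ks w

  -- Closed walks at the newest interior vertex are cut out: only the piece leading to it and the
  -- piece leaving it survive.
  via-trans : ∀ ks {x k y} → k ∈ ks → Via ks x k → Via ks k y → Via ks x y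
  via-trans (h ∷ ks) (here refl) (inj₁ a)       (inj₁ b)       = inj₂ (a , b)
  via-trans (h ∷ ks) (here refl) (inj₁ a)       (inj₂ (_ , b)) = inj₂ (a , b)
  via-trans (h ∷ ks) (here refl) (inj₂ (a , _)) (inj₁ b)       = inj₂ (a , b)
  via-trans (h ∷ ks) (here refl) (inj₂ (a , _)) (inj₂ (_ , b)) = inj₂ (a , b)
  via-trans (h ∷ ks) (there p) (inj₁ a) (inj₁ b)               = inj₁ (via-trans ks p a b)
  via-trans (h ∷ ks) (there p) (inj₁ a) (inj₂ (b , c))         = inj₂ (via-trans ks p a b , c)
  via-trans (h ∷ ks) (there p) (inj₂ (a , b)) (inj₁ c)         = inj₂ (a , via-trans ks p b c)
  via-trans (h ∷ ks) (there p) (inj₂ (a , _)) (inj₂ (_ , d))   = inj₂ (a , d)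

  via-complete : ∀ {x y} → Star R x y → Via (allFin n) x y
  via-complete Star.ε = via-base (allFin n) (inj₁ refl)
  via-complete (_◅_ {j = z} r s) =
    via-trans (allFin n) (∈-allFin z) (via-base (allFin n) (inj₂ r)) (via-complete s)

  star? : ∀ x y → Dec (Star R x y)
  star? x y = map′ (via-sound (allFin n)) via-complete (via? (allFin n) x y)

Star-invariant : ∀ {A : Set} {R : A → A → Set} {P : A → Set} →
                 (∀ {x y} → R x y → P x → P y) → ∀ {x y} → Star R x y → P x → P y
Star-invariant step Star.ε  p = p
Star-invariant step (r ◅ s) p = Star-invariant step s (step r p)

-- Groups with underlying set Fin n

record FinGroup (n : ℕ) : Set where
  infixl 7 _∙_
  infix 8 _⁻¹
  field
    _∙_     : Fin n → Fin n → Fin n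
    ε       : Fin n
    _⁻¹     : Fin n → Fin n
    isGroup : IsGroup _≡_ _∙_ ε _⁻¹

  group : Group 0ℓ 0ℓ
  group = record { isGroup = isGroup }

  open IsGroup isGroup public using (assoc; identityˡ; identityʳ; inverseˡ; inverseʳ)
  open GroupProperties group public
    using (∙-cancelˡ; ∙-cancelʳ; ⁻¹-involutive; ⁻¹-anti-homo-∙; inverseˡ-unique; inverseʳ-unique;
           ε⁻¹≈ε; \\-leftDividesˡ; \\-leftDividesʳ;
           identityʳ-unique; identityˡ-unique)

module _ {c ℓ} (𝔾 : Group c ℓ) where
  open Group 𝔾

  module _ {n : ℕ} (to : Fin n → Carrier) (injective : ∀ {i j} → to i ≈ to j → i ≡ j)
           (mul : ∀ i j → ∃[ k ] to k ≈ to i ∙ to j)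
           (one : ∃[ k ] to k ≈ ε) (inv : ∀ i → ∃[ k ] to k ≈ to i ⁻¹) where

    -- The laws are pulled back along an injection whose image is closed. This serves both for the
    -- elements of a `FiniteSubgroup` and for the normal forms in ℤ/N ⋊ ℤ/K.
    finGroup : FinGroup n
    finGroup = record
      { _∙_ = λ i j → proj₁ (mul i j)
      ; ε = proj₁ one
      ; _⁻¹ = λ i → proj₁ (inv i)
      ; isGroup = GroupMonomorphism.isGroup mono isGroup
      }
      where
      raw : RawGroup 0ℓ 0ℓ
      raw = record { _≈_ = _≡_ ; _∙_ = λ i j → proj₁ (mul i j)
                   ; ε = proj₁ one ; _⁻¹ = λ i → proj₁ (inv i) }

      mono : IsGroupMonomorphism raw rawGroup to
      mono = record
        { isGroupHomomorphism = record
          { isMonoidHomomorphism = record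
            { isMagmaHomomorphism = record
              { isRelHomomorphism = record { cong = λ { refl → Group.refl 𝔾 } }
              ; homo = λ i j → proj₂ (mul i j) }
            ; ε-homo = proj₂ one }
          ; ⁻¹-homo = λ i → proj₂ (inv i) }
        ; injective = injective }

-- Group actions: orbits, stabilizers and transversals

record Action {n} (Γ : FinGroup n) (v : ℕ) : Set where
  open FinGroup Γ
  infixr 6 _▹_
  field
    _▹_ : Fin n → Fin v → Fin v
    ▹-ε : ∀ x → ε ▹ x ≡ x
    ▹-∙ : ∀ γ δ x → (γ ∙ δ) ▹ x ≡ γ ▹ δ ▹ x

  ▹-⁻¹ˡ : ∀ γ x → γ ⁻¹ ▹ γ ▹ x ≡ x
  ▹-⁻¹ˡ γ x = trans (sym (▹-∙ (γ ⁻¹) γ x)) (trans (cong (_▹ x) (inverseˡ γ)) (▹-ε x))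

  ▹-⁻¹ʳ : ∀ γ x → γ ▹ γ ⁻¹ ▹ x ≡ x
  ▹-⁻¹ʳ γ x = trans (sym (▹-∙ γ (γ ⁻¹) x)) (trans (cong (_▹ x) (inverseʳ γ)) (▹-ε x))

  ▹-move : ∀ {γ x y} → γ ▹ x ≡ y → γ ⁻¹ ▹ y ≡ x
  ▹-move {γ} {x} refl = ▹-⁻¹ˡ γ x

  Orbit : Fin v → Fin v → Set
  Orbit x y = ∃[ γ ] γ ▹ x ≡ y

  orbit? : ∀ x → Decidable (Orbit x)
  orbit? x y = any? (λ γ → (γ ▹ x) Finₚ.≟ y)

  orbit-refl : ∀ {x} → Orbit x x
  orbit-refl {x} = ε , ▹-ε x

  orbit-sym : ∀ {x y} → Orbit x y → Orbit y x
  orbit-sym (γ , p) = γ ⁻¹ , ▹-move p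

  orbit-trans : ∀ {x y z} → Orbit x y → Orbit y z → Orbit x z
  orbit-trans {x} (γ , p) (δ , q) = δ ∙ γ , trans (▹-∙ δ γ x) (trans (cong (δ ▹_) p) q)

  Stabilizer : Fin v → Fin n → Set
  Stabilizer x γ = γ ▹ x ≡ x

  stabilizer? : ∀ x → Decidable (Stabilizer x)
  stabilizer? x γ = (γ ▹ x) Finₚ.≟ x

  stabilizer-ε : ∀ x → Stabilizer x ε
  stabilizer-ε = ▹-ε

  stabilizer-∙ : ∀ {x γ δ} → Stabilizer x γ → Stabilizer x δ → Stabilizer x (γ ∙ δ)
  stabilizer-∙ {x} {γ} {δ} p q = trans (▹-∙ γ δ x) (trans (cong (γ ▹_) q) p)

  orbitSize : Fin v → ℕ
  orbitSize x = count (orbit? x)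

  stabilizerSize : Fin v → ℕ
  stabilizerSize x = count (stabilizer? x)

  -- Each point of the orbit comes with a chosen element moving x to it; its products with the
  -- stabilizer make up one coset, and every group element lies in exactly one of these.
  orbit-stabilizer : ∀ x → orbitSize x * stabilizerSize x ≡ n
  orbit-stabilizer x = ×-bijection⇒≡ f f-injective f-surjective
    where
    module O = Members (orbit? x)
    module S = Members (stabilizer? x)

    f : Fin (orbitSize x) → Fin (stabilizerSize x) → Fin n
    f i j = proj₁ (O.member-∈ i) ∙ S.member j

    f-▹ : ∀ i j → f i j ▹ x ≡ O.member i
    f-▹ i j = let δ , p = O.member-∈ i in
      trans (▹-∙ δ (S.member j) x) (trans (cong (δ ▹_) (S.member-∈ j)) p)

    f-injective : ∀ {i j i′ j′} → f i j ≡ f i′ j′ → i ≡ i′ × j ≡ j′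
    f-injective {i} {j} {i′} {j′} eq
      with O.member-injective i i′ (trans (sym (f-▹ i j)) (trans (cong (_▹ x) eq) (f-▹ i′ j′)))
    ... | refl = refl , S.member-injective j j′ (∙-cancelˡ _ _ _ eq)

    f-surjective : ∀ γ → ∃[ i ] ∃[ j ] f i j ≡ γ
    f-surjective γ = i , S.index s , trans (cong (δ ∙_) (S.member-index s)) (\\-leftDividesˡ δ γ)
      where
      i = O.index (γ , refl)
      δ = proj₁ (O.member-∈ i)
      δ▹x : δ ▹ x ≡ γ ▹ x
      δ▹x = trans (proj₂ (O.member-∈ i)) (O.member-index (γ , refl))
      s : Stabilizer x (δ ⁻¹ ∙ γ)
      s = trans (▹-∙ (δ ⁻¹) γ x) (▹-move δ▹x)

  Covered : List (Fin v) → Fin v → Set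
  Covered T y = Any (λ t → Orbit t y) T

  covered? : ∀ T → Decidable (Covered T)
  covered? T y = Any.any? (λ t → orbit? t y) T

  covered-orbit : ∀ {T x y} → Orbit x y → Covered T x → Covered T y
  covered-orbit o = Any.map (λ p → orbit-trans p o)

  covered-∈ : ∀ {T t} → t ∈ T → Covered T t
  covered-∈ = Any.map (λ { refl → orbit-refl })

  data Independent : List (Fin v) → Set where
    []  : Independent []
    _∷_ : ∀ {t T} → ¬ Covered T t → Independent T → Independent (t ∷ T)

  totalSize : List (Fin v) → ℕ
  totalSize []      = 0
  totalSize (t ∷ T) = orbitSize t + totalSize T

  count-covered : ∀ {T} → Independent T → count (covered? T) ≡ totalSize T
  count-covered [] = count-none (covered? []) (λ _ ())
  count-covered {t ∷ T} (¬c ∷ I) = trans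
    (length-filter-⊎ (orbit? t) (covered? T) (covered? (t ∷ T))
      (λ { (here p) → inj₁ p ; (there q) → inj₂ q }) here there
      (λ p q → ¬c (covered-orbit (orbit-sym p) q)) (allFin v))
    (cong (orbitSize t +_) (count-covered I))

  totalSize-transversal : ∀ {T} → Independent T → (∀ y → Covered T y) → totalSize T ≡ v
  totalSize-transversal I c = trans (sym (count-covered I)) (count-all (covered? _) c)

-- Quotients by subgroups of Aut(G)

incident-· : ∀ {G} (γ : Automorphism G) {e x} → Incident G e x → Incident G (γ ·ᵉ e) (γ ·ᵛ x)
incident-· {G} γ {e} (inj₁ refl) =
  Sum.map proj₁ proj₂ (compat γ e _ _ (HasEnds-ends G e))
incident-· {G} γ {e} (inj₂ refl) =
  [ inj₂ ∘ proj₂ , inj₁ ∘ proj₁ ]′ (compat γ e _ _ (HasEnds-ends G e))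

module _ {G : Graph} (Δ : FiniteSubgroup (Aut G)) where

  sameOrbitᵛ-· : ∀ {γ} x → γ ∈ elements Δ → SameOrbitᵛ Δ x (γ ·ᵛ x)
  sameOrbitᵛ-· x γ∈ = lose γ∈ refl

  vertical-resp : ∀ {e f} → SameOrbitᵉ Δ e f → Vertical Δ f → Vertical Δ e
  vertical-resp {e} o v with find o
  ... | γ , γ∈ , refl = 𝕍.trans (sameOrbitᵛ-· _ γ∈)
      (𝕍.trans (vertical-ends Δ (compat γ e _ _ (HasEnds-ends G e)) v) (𝕍.sym (sameOrbitᵛ-· _ γ∈)))
    where module 𝕍 = DecSetoid (vertexOrbits Δ)

  onEdge-orbit : ∀ {e f} (¬v : ¬ Vertical Δ e) → SameOrbitᵉ Δ e f →
                 Morphism.onEdge (quotientMap Δ) f ≡ inj₂ (orbitᵉ Δ e ¬v)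
  onEdge-orbit {e} {f} ¬v o with vertical? Δ f
  ... | yes v  = contradiction (vertical-resp o v) ¬v
  ... | no ¬v′ = cong inj₂ (EdgeClasses.class-cong Δ _ _ (DecSetoid.sym (edgeOrbits Δ) o))

  onEdge-orbit⁻ : ∀ {e f} (¬v : ¬ Vertical Δ e) →
                  Morphism.onEdge (quotientMap Δ) f ≡ inj₂ (orbitᵉ Δ e ¬v) → SameOrbitᵉ Δ e f
  onEdge-orbit⁻ {e} {f} ¬v eq with vertical? Δ f
  onEdge-orbit⁻ {e} {f} ¬v () | yes v
  onEdge-orbit⁻ {e} {f} ¬v eq | no ¬v′ = DecSetoid.sym (edgeOrbits Δ)
    (EdgeClasses.class-injective Δ _ _ (Sumₚ.inj₂-injective eq))

  -- The representative of an edge orbit need not touch x itself; a group element carrying one of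
  -- its ends to x moves it there.
  incident-lift : ∀ e′ x → Incident (quotient Δ) e′ (orbitᵛ Δ x) →
                  ∃[ e ] Incident G e x × Σ[ ¬v ∈ ¬ Vertical Δ e ] orbitᵉ Δ e ¬v ≡ e′
  incident-lift e′ x i = γ ·ᵉ r , proj₁ (proj₂ moved) , ¬v ,
      trans (EdgeClasses.class-cong Δ _ (EdgeClasses.rep-∈ Δ e′) (DecSetoid.sym (edgeOrbits Δ) orb))
            (EdgeClasses.class-surjective Δ e′ _)
    where
    r = EdgeClasses.rep Δ e′

    ¬vertical : ¬ Vertical Δ r
    ¬vertical = proj₂ (∈-filter⁻ (¬? ∘ vertical? Δ) {xs = allFin (#E G)} (EdgeClasses.rep-∈ Δ e′))

    move : Incident (quotient Δ) e′ (orbitᵛ Δ x) → ∃[ γ ] Incident G (γ ·ᵉ r) x × γ ∈ elements Δ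
    move (inj₁ p) with find (orbitᵛ-injective Δ _ _ p)
    ... | γ , γ∈ , refl = γ , incident-· γ (inj₁ refl) , γ∈
    move (inj₂ p) with find (orbitᵛ-injective Δ _ _ p)
    ... | γ , γ∈ , refl = γ , incident-· γ (inj₂ refl) , γ∈

    moved = move i

    γ = proj₁ moved

    orb : SameOrbitᵉ Δ r (γ ·ᵉ r)
    orb = lose (proj₂ (proj₂ moved)) refl

    ¬v : ¬ Vertical Δ (γ ·ᵉ r)
    ¬v v = ¬vertical (vertical-resp orb v)

-- A group Γ acting by left multiplication on the edges of a bipartite graph
-- whose edge set is Γ itself.

record BipartiteModel (n v : ℕ) : Set where
  field
    Γ : FinGroup n
  open FinGroup Γ public
  field
    end            : Bool → Fin n → Fin v
    end-disjoint   : ∀ i j → end false i ≢ end true j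
    end-surjective : ∀ x → ∃[ c ] ∃[ i ] end c i ≡ x
    end-∙          : ∀ c {i j} k → end c i ≡ end c j → end c (k ∙ i) ≡ end c (k ∙ j)
    connected′     : ∀ i j → Star (λ i j → ∃[ c ] end c i ≡ end c j) i j

module ModelGraph {n v} (M : BipartiteModel n v) where
  open BipartiteModel M

  end-colour : ∀ c d {i j} → end c i ≡ end d j → c ≡ d
  end-colour false false _  = refl
  end-colour false true  eq = contradiction eq (end-disjoint _ _)
  end-colour true  false eq = contradiction (sym eq) (end-disjoint _ _)
  end-colour true  true  _  = refl

  ends′ : Fin n → Fin v × Fin v
  ends′ i = end false i , end true i

  across : ∀ c i → Adjacent′ ends′ (end c i) (end (not c) i)
  across false i = i , inj₁ (refl , refl)
  across true  i = i , inj₂ (refl , refl)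

  edge-path : ∀ c d i → Star (Adjacent′ ends′) (end c i) (end d i)
  edge-path false false i = Star.ε
  edge-path false true  i = across false i ◅ Star.ε
  edge-path true  false i = across true i ◅ Star.ε
  edge-path true  true  i = Star.ε

  path : ∀ c d {i j} → Star (λ i j → ∃[ c ] end c i ≡ end c j) i j →
         Star (Adjacent′ ends′) (end c i) (end d j)
  path c d {i} Star.ε = edge-path c d i
  path c d {i} {j} ((b , p) ◅ s) =
    edge-path c b i ◅◅ subst (λ x → Star (Adjacent′ ends′) x (end d j)) (sym p) (path b d s)

  graph : Graph
  graph = record
    { #V = v ; #E = n ; ends = ends′
    ; loopless = λ i → end-disjoint i i
    ; nonempty = ℕₚ.≤-trans (s≤s z≤n) (Finₚ.toℕ<n (end false ε))
    ; connected = connect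
    }
    where
    connect : ∀ x y → Star (Adjacent′ ends′) x y
    connect x y with end-surjective x | end-surjective y
    ... | c , i , refl | d , j , refl = path c d (connected′ i j)

  infixr 6 _▹_
  _▹_ : Fin n → Fin v → Fin v
  k ▹ x = let c , i , _ = end-surjective x in end c (k ∙ i)

  -- The action on vertices goes through an edge chosen by `end-surjective`. The choice is
  -- immaterial: disjointness forces its colour, and `end-∙` does the rest.
  ▹-end : ∀ k c i → k ▹ end c i ≡ end c (k ∙ i)
  ▹-end k c i with end-surjective (end c i)
  ... | d , j , p with end-colour d c p
  ...   | refl = end-∙ c k p

  ▹-∙ : ∀ k l x → (k ∙ l) ▹ x ≡ k ▹ l ▹ x
  ▹-∙ k l x with end-surjective x
  ... | c , i , _ = sym (trans (▹-end k c (l ∙ i)) (cong (end c) (sym (assoc k l i))))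

  ▹-ε : ∀ x → ε ▹ x ≡ x
  ▹-ε x with end-surjective x
  ... | c , i , refl = cong (end c) (identityˡ i)

  actionV : Action Γ v
  actionV = record { _▹_ = _▹_ ; ▹-ε = ▹-ε ; ▹-∙ = ▹-∙ }

  automorphism : Fin n → Automorphism graph
  automorphism k = record
    { permV = permutation (k ▹_) (k ⁻¹ ▹_) (Action.▹-⁻¹ʳ actionV k) (Action.▹-⁻¹ˡ actionV k)
    ; permE = permutation (k ∙_) (k ⁻¹ ∙_) (\\-leftDividesˡ k) (\\-leftDividesʳ k)
    ; compat = λ e x y → Sum.map (λ { (refl , refl) → sym (▹-end k _ e) , sym (▹-end k _ e) })
                                 (λ { (refl , refl) → sym (▹-end k _ e) , sym (▹-end k _ e) })
    }

  private
    module 𝔸 = Group (Aut graph)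
    open SetoidMembership 𝔸.setoid using () renaming (_∈_ to _∈ₐ_)

  automorphisms : List (Automorphism graph)
  automorphisms = map automorphism (allFin n)

  ∈-automorphisms⁻ : ∀ {α} → α ∈ₐ automorphisms → ∃[ k ] α 𝔸.≈ automorphism k
  ∈-automorphisms⁻ α∈ = let k , _ , p = find (Anyₚ.map⁻ α∈) in k , p

  ∈-automorphisms⁺ : ∀ {α} k → α 𝔸.≈ automorphism k → α ∈ₐ automorphisms
  ∈-automorphisms⁺ k p = Anyₚ.map⁺ (lose (∈-allFin k) p)

  Γ′ : FiniteSubgroup (Aut graph)
  Γ′ = record
    { elements  = automorphisms
    ; unique    = UniqueSetoidₚ.map⁺ (≡-setoid (Fin n)) 𝔸.setoid
                    (λ {k} {l} p → trans (sym (identityʳ k)) (trans (proj₂ p ε) (identityʳ l)))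
                    (Uniqueₚ.allFin⁺ n)
    ; ε-closed  = ∈-automorphisms⁺ {𝔸.ε} ε ((λ x → sym (▹-ε x)) , (λ i → sym (identityˡ i)))
    ; ∙-closed  = λ {α} {β} a b → let k , p = ∈-automorphisms⁻ {α} a ; l , q = ∈-automorphisms⁻ {β} b in
        ∈-automorphisms⁺ {α 𝔸.∙ β} (k ∙ l)
          (𝔸.trans {α 𝔸.∙ β} {automorphism k 𝔸.∙ automorphism l} {automorphism (k ∙ l)}
            (𝔸.∙-cong {α} {automorphism k} {β} {automorphism l} p q)
            ((λ x → sym (▹-∙ k l x)) , (λ i → sym (assoc k l i))))
    ; ⁻¹-closed = λ {α} a → let k , p = ∈-automorphisms⁻ {α} a in
        ∈-automorphisms⁺ {α 𝔸.⁻¹} (k ⁻¹)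
          (𝔸.trans {α 𝔸.⁻¹} {automorphism k 𝔸.⁻¹} {automorphism (k ⁻¹)}
            (𝔸.⁻¹-cong {α} {automorphism k} p) ((λ _ → refl) , (λ _ → refl)))
    }

  module _ (Δ : FiniteSubgroup (Aut graph)) (Δ≤Γ : Δ ≤ᴳ Γ′) where

    member : ∀ {α} → α ∈ elements Δ → ∃[ k ] α 𝔸.≈ automorphism k
    member {α} α∈ =
      ∈-automorphisms⁻ {α} (Δ≤Γ {α} (Any.map (λ { refl → 𝔸.refl {α} }) α∈))

    -- The action preserves the two colour classes, so it never carries one end of an edge to the
    -- other. Hence every edge survives in each quotient, which also gives non-degeneracy.
    ¬vertical : ∀ i → ¬ Vertical Δ i
    ¬vertical i v with find v
    ... | α , α∈ , p = let k , q , _ = member α∈ in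
      end-disjoint _ _ (trans (sym (▹-end k false i)) (trans (sym (q _)) p))

    -- The edges of Δi at a common end of i and j are translated by i⁻¹j to edges of Δj there.
    multiplicity-≤ : ∀ x i j → Incident graph i x → Incident graph j x →
                     multiplicity (quotientMap Δ) x (orbitᵉ Δ i (¬vertical i)) ≤
                     multiplicity (quotientMap Δ) x (orbitᵉ Δ j (¬vertical j))
    multiplicity-≤ x i j inc-i inc-j =
      count-injection
        (λ e → incident? graph e x ×-dec mapsTo? (quotientMap Δ) e (orbitᵉ Δ i (¬vertical i)))
        (λ e → incident? graph e x ×-dec mapsTo? (quotientMap Δ) e (orbitᵉ Δ j (¬vertical j)))
        (_∙ (i ⁻¹ ∙ j)) (∙-cancelʳ _ _ _) translate
      where
      colour : ∀ {e} → Incident graph e x → ∃[ c ] end c e ≡ x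
      colour (inj₁ p) = false , p
      colour (inj₂ p) = true , p

      uncolour : ∀ c {e} → end c e ≡ x → Incident graph e x
      uncolour false p = inj₁ p
      uncolour true  p = inj₂ p

      translate : ∀ {e} → Incident graph e x ×
                          Morphism.onEdge (quotientMap Δ) e ≡ inj₂ (orbitᵉ Δ i (¬vertical i)) →
                  Incident graph (e ∙ (i ⁻¹ ∙ j)) x ×
                  Morphism.onEdge (quotientMap Δ) (e ∙ (i ⁻¹ ∙ j)) ≡ inj₂ (orbitᵉ Δ j (¬vertical j))
      translate {e} (inc , p) with find (onEdge-orbit⁻ Δ (¬vertical i) p)
      ... | α , α∈ , α·i≡e with member α∈
      ... | k , (_ , k-E) with colour inc | colour inc-i | colour inc-j
      ... | c , e-x | c₁ , i-x | c₂ , j-x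
        with end-colour c c₁ (trans e-x (sym i-x)) | end-colour c c₂ (trans e-x (sym j-x))
      ... | refl | refl =
        uncolour c
          (trans (cong (end c) e′) (trans (end-∙ c k (trans j-x (sym i-x)))
            (trans (cong (end c) (trans (sym (k-E i)) α·i≡e)) e-x))) ,
        onEdge-orbit Δ (¬vertical j) (lose α∈ (trans (k-E j) (sym e′)))
        where
        e′ : e ∙ (i ⁻¹ ∙ j) ≡ k ∙ j
        e′ = trans (cong (_∙ (i ⁻¹ ∙ j)) (trans (sym α·i≡e) (k-E i)))
               (trans (assoc k i _) (cong (k ∙_) (\\-leftDividesˡ i j)))

    harmonic : Harmonic (quotientMap Δ)
    harmonic x e′ e″ h h′ with incident-lift Δ e′ x h | incident-lift Δ e″ x h′
    ... | i , inc-i , ¬v , refl | j , inc-j , ¬w , refl =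
      trans (cong m (irr i ¬v (¬vertical i))) (trans (ℕₚ.≤-antisym (multiplicity-≤ x i j inc-i inc-j)
        (multiplicity-≤ x j i inc-j inc-i)) (cong m (irr j (¬vertical j) ¬w)))
      where
      m = multiplicity (quotientMap Δ) x
      irr : ∀ i (¬v ¬w : ¬ Vertical Δ i) → orbitᵉ Δ i ¬v ≡ orbitᵉ Δ i ¬w
      irr i ¬v ¬w = EdgeClasses.class-cong Δ {i} {i} _ _ (DecSetoid.refl (edgeOrbits Δ) {i})

    nonDegenerate : NonDegenerate (quotientMap Δ)
    nonDegenerate x deg with end-surjective x
    ... | c , i , refl = case trans (sym (onEdge-orbit Δ (¬vertical i) (DecSetoid.refl (edgeOrbits Δ) {i})))
                              (sym (proj₁ deg (inj₂ i , incident c , refl))) of λ ()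
      where
      incident : ∀ c → Incident graph i (end c i)
      incident false = inj₁ refl
      incident true  = inj₂ refl

  -- The hypothesis is g = n - v + 1 without subtraction, n being both the number of edges and the
  -- order of the group.
  harmonicGroupOrder : ∀ g → suc n ≡ v + g → HarmonicGroupOrder g n
  harmonicGroupOrder g eq =
    graph , genus≡ , Γ′ , (λ Δ Δ≤Γ → harmonic Δ (λ {α} → Δ≤Γ {α}) , nonDegenerate Δ (λ {α} → Δ≤Γ {α})) ,
    trans (Listₚ.length-map automorphism (allFin n)) (Listₚ.length-tabulate id)
    where
    open ≡-Reasoning
    genus≡ : genus graph ≡ ℤ.+ g
    genus≡ = begin
      ℤ.+ n ℤ.- ℤ.+ v ℤ.+ ℤ.+ 1     ≡⟨ ℤₚ.+-assoc (ℤ.+ n) (ℤ.- ℤ.+ v) (ℤ.+ 1) ⟩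
      ℤ.+ n ℤ.+ (ℤ.- ℤ.+ v ℤ.+ ℤ.+ 1) ≡⟨ cong (ℤ._+_ (ℤ.+ n)) (ℤₚ.+-comm (ℤ.- ℤ.+ v) (ℤ.+ 1)) ⟩
      ℤ.+ n ℤ.+ (ℤ.+ 1 ℤ.- ℤ.+ v)   ≡⟨ sym (ℤₚ.+-assoc (ℤ.+ n) (ℤ.+ 1) (ℤ.- ℤ.+ v)) ⟩
      ℤ.+ (n + 1) ℤ.- ℤ.+ v         ≡⟨ cong (λ k → ℤ.+ k ℤ.- ℤ.+ v) (trans (ℕₚ.+-comm n 1) eq) ⟩
      ℤ.+ (v + g) ℤ.- ℤ.+ v         ≡⟨ cong (ℤ._- ℤ.+ v) (ℤₚ.+-comm (ℤ.+ v) (ℤ.+ g)) ⟩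
      ℤ.+ g ℤ.+ ℤ.+ v ℤ.- ℤ.+ v     ≡⟨ ℤₚ.+-assoc (ℤ.+ g) (ℤ.+ v) (ℤ.- ℤ.+ v) ⟩
      ℤ.+ g ℤ.+ (ℤ.+ v ℤ.- ℤ.+ v)   ≡⟨ cong (ℤ._+_ (ℤ.+ g)) (ℤₚ.+-inverseʳ (ℤ.+ v)) ⟩
      ℤ.+ g ℤ.+ ℤ.+ 0               ≡⟨ ℤₚ.+-identityʳ (ℤ.+ g) ⟩
      ℤ.+ g ∎

-- Harmonic actions are free on flags

count≤1 : ∀ {n} {P : Pred (Fin n) 0ℓ} (P? : Decidable P) a → (∀ {i} → P i → i ≡ a) → count P? ≤ 1
count≤1 P? a only = Finₚ.injective⇒≤ {n = 1} {f = λ _ → zero}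
  λ {k} {l} _ → member-injective k l (trans (only (member-∈ k)) (sym (only (member-∈ l))))
  where open Members P?

count≤1⇒≡ : ∀ {n} {P : Pred (Fin n) 0ℓ} (P? : Decidable P) → count P? ≤ 1 →
            ∀ {i j} → P i → P j → i ≡ j
count≤1⇒≡ P? le p q = index-injective p q (single le (index p) (index q))
  where
  open Members P?
  single : ∀ {k} → k ≤ 1 → (a b : Fin k) → a ≡ b
  single (s≤s z≤n) zero zero = refl

-- All that the bound uses of a harmonic action. The group elements are renumbered by `Fin n`, so
-- that orbits and stabilizers become counts.
record FlagFreeAction (G : Graph) (n : ℕ) : Set where
  field
    Γ       : FinGroup n
    actionV : Action Γ (#V G)
    actionE : Action Γ (#E G)
  open FinGroup Γ public
  module 𝐕 = Action actionV
  module 𝐄 = Action actionE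
  field
    ▹-ends    : ∀ γ {e x y} → HasEnds G e x y → HasEnds G (γ 𝐄.▹ e) (γ 𝐕.▹ x) (γ 𝐕.▹ y)
    flag-free : ∀ {γ e x} → Incident G e x → γ 𝐕.▹ x ≡ x → γ 𝐄.▹ e ≡ e → γ ≡ ε

other-end : ∀ {G e x} → Incident G e x → ∃[ y ] HasEnds G e x y
other-end (inj₁ p) = _ , inj₁ (p , refl)
other-end (inj₂ p) = _ , inj₂ (refl , p)

HasEnds⇒Incidentˡ : ∀ {G e x y} → HasEnds G e x y → Incident G e x
HasEnds⇒Incidentˡ (inj₁ (p , _)) = inj₁ p
HasEnds⇒Incidentˡ (inj₂ (_ , q)) = inj₂ q

HasEnds-sym : ∀ {G e x y} → HasEnds G e x y → HasEnds G e y x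
HasEnds-sym = Sum.swap

HasEnds⇒Incidentʳ : ∀ {G e x y} → HasEnds G e x y → Incident G e y
HasEnds⇒Incidentʳ {G} {e} {x} {y} h =
  HasEnds⇒Incidentˡ {G} {e} {y} {x} (HasEnds-sym {G} {e} {x} {y} h)

HasEnds-unique : ∀ {G e x y z} → HasEnds G e x y → HasEnds G e x z → y ≡ z
HasEnds-unique {G} {e} (inj₁ (p , q)) (inj₁ (r , s)) = trans (sym q) s
HasEnds-unique {G} {e} (inj₁ (p , q)) (inj₂ (r , s)) = contradiction (trans p (sym s)) (loopless G e)
HasEnds-unique {G} {e} (inj₂ (p , q)) (inj₁ (r , s)) = contradiction (trans r (sym q)) (loopless G e)
HasEnds-unique {G} {e} (inj₂ (p , q)) (inj₂ (r , s)) = trans (sym p) r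

Incident-cases : ∀ {G e x y z} → HasEnds G e x y → Incident G e z → z ≡ x ⊎ z ≡ y
Incident-cases (inj₁ (p , q)) = Sum.map (λ r → trans (sym r) p) (λ r → trans (sym r) q)
Incident-cases (inj₂ (p , q)) = [ (λ r → inj₂ (trans (sym r) p)) , (λ r → inj₁ (trans (sym r) q)) ]′

module _ (G : Graph) (Γ : FiniteSubgroup (Aut G)) where
  private
    module 𝔸 = Group (Aut G)
    open SetoidMembership 𝔸.setoid using () renaming (_∈_ to _∈ₐ_)

  ∈⇒∈ₐ : ∀ {α} {xs : List (Automorphism G)} → α ∈ xs → α ∈ₐ xs
  ∈⇒∈ₐ {α} = Any.map (λ { refl → 𝔸.refl {α} })

  FixesFlag : Vertex G → Edge G → Automorphism G → Set
  FixesFlag x e α = α ·ᵛ x ≡ x × α ·ᵉ e ≡ e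

  fixesFlag? : ∀ x e → Decidable (FixesFlag x e)
  fixesFlag? x e α = ((α ·ᵛ x) Finₚ.≟ x) ×-dec ((α ·ᵉ e) Finₚ.≟ e)

  fixesFlag-resp : ∀ x e {α β} → α 𝔸.≈ β → FixesFlag x e α → FixesFlag x e β
  fixesFlag-resp x e (p , q) (r , s) = trans (sym (p x)) r , trans (sym (q e)) s

  flagStabilizer : Vertex G → Edge G → FiniteSubgroup (Aut G)
  flagStabilizer x e = record
    { elements  = filter F? (elements Γ)
    ; unique    = UniqueSetoidₚ.filter⁺ 𝔸.setoid F? (FiniteSubgroup.unique Γ)
    ; ε-closed  = into {𝔸.ε} (FiniteSubgroup.ε-closed Γ) (refl , refl)
    ; ∙-closed  = λ {α} {β} a b →
        let a∈ , a-x , a-e = out {α} a ; b∈ , b-x , b-e = out {β} b in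
        into {α 𝔸.∙ β} (FiniteSubgroup.∙-closed Γ {α} {β} a∈ b∈)
             (trans (cong (α ·ᵛ_) b-x) a-x , trans (cong (α ·ᵉ_) b-e) a-e)
    ; ⁻¹-closed = λ {α} a → let a∈ , a-x , a-e = out {α} a in
        into {α 𝔸.⁻¹} (FiniteSubgroup.⁻¹-closed Γ {α} a∈)
             (trans (cong (permV α ⟨$⟩ˡ_) (sym a-x)) (Perm.inverseˡ (permV α)) ,
              trans (cong (permE α ⟨$⟩ˡ_) (sym a-e)) (Perm.inverseˡ (permE α)))
    }
    where
    F? = fixesFlag? x e

    resp : ∀ {α β} → α 𝔸.≈ β → FixesFlag x e α → FixesFlag x e β
    resp {α} {β} = fixesFlag-resp x e {α} {β}

    into : ∀ {α} → α ∈ₐ elements Γ → FixesFlag x e α → α ∈ₐ filter F? (elements Γ)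
    into {α} = SetoidMembershipₚ.∈-filter⁺ 𝔸.setoid F? (λ {α} {β} → resp {α} {β}) {α}

    out : ∀ {α} → α ∈ₐ filter F? (elements Γ) → α ∈ₐ elements Γ × FixesFlag x e α
    out {α} = SetoidMembershipₚ.∈-filter⁻ 𝔸.setoid F? (λ {α} {β} → resp {α} {β}) {α}

  flagStabilizer-≤ : ∀ x e → flagStabilizer x e ≤ᴳ Γ
  flagStabilizer-≤ x e {α} a = proj₁
    (SetoidMembershipₚ.∈-filter⁻ 𝔸.setoid (fixesFlag? x e)
      (λ {α} {β} → fixesFlag-resp x e {α} {β}) {α} {elements Γ} a)

  module _ (harmonically : ActsHarmonically G Γ) where

    -- Over the edge Δe of G/Δ, Δ the stabilizer of the flag (x, e), the
    -- multiplicity at x is 1, so by harmonicity Δ fixes every edge at x.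
    fixesFlag⇒fixesStar : ∀ {x e α} → Incident G e x → α ∈ₐ elements Γ → FixesFlag x e α →
                          ∀ f → Incident G f x → α ·ᵉ f ≡ f
    fixesFlag⇒fixesStar {x} {e} {α} inc α∈Γ fix f inc-f =
      sym (count≤1⇒≡ (mult? f inc-f)
        (ℕₚ.≤-trans (ℕₚ.≤-reflexive equal) (count≤1 (mult? e inc) e only-e))
        (inc-f , onEdge-orbit Δ (¬vertical f inc-f) (DecSetoid.refl (edgeOrbits Δ) {f}))
        (subst (Incident G (α ·ᵉ f)) (proj₁ fix) (incident-· α inc-f) ,
         onEdge-orbit Δ (¬vertical f inc-f) (Any.map (λ (_ , p) → sym (p f)) α∈Δ)))
      where
      Δ = flagStabilizer x e

      α∈Δ : α ∈ₐ elements Δ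
      α∈Δ = SetoidMembershipₚ.∈-filter⁺ 𝔸.setoid (fixesFlag? x e)
              (λ {α} {β} → fixesFlag-resp x e {α} {β}) {α} {elements Γ} α∈Γ fix

      fixes : ∀ {δ} → δ ∈ elements Δ → FixesFlag x e δ
      fixes δ∈ = proj₂ (∈-filter⁻ (fixesFlag? x e) {xs = elements Γ} δ∈)

      ¬vertical : ∀ f → Incident G f x → ¬ Vertical Δ f
      ¬vertical f inc v with find v
      ¬vertical f (inj₁ refl) v | δ , δ∈ , p =
        loopless G f (trans (sym (proj₁ (fixes δ∈))) p)
      ¬vertical f (inj₂ refl) v | δ , δ∈ , p = loopless G f
        (trans (sym (Perm.inverseˡ (permV δ)))
          (trans (cong (permV δ ⟨$⟩ˡ_) (trans p (sym (proj₁ (fixes δ∈))))) (Perm.inverseˡ (permV δ))))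

      mult? : ∀ f (inc : Incident G f x) → Decidable (λ d → Incident G d x ×
                Morphism.onEdge (quotientMap Δ) d ≡ inj₂ (orbitᵉ Δ f (¬vertical f inc)))
      mult? f inc d = incident? G d x ×-dec mapsTo? (quotientMap Δ) d (orbitᵉ Δ f (¬vertical f inc))

      at-x : ∀ f (inc : Incident G f x) →
             Incident (quotient Δ) (orbitᵉ Δ f (¬vertical f inc)) (orbitᵛ Δ x)
      at-x f inc = let y , h = other-end {G} inc in
        HasEnds⇒Incidentˡ {quotient Δ} {y = orbitᵛ Δ y} (orbit-ends Δ f x y (¬vertical f inc) h)

      equal : count (mult? f inc-f) ≡ count (mult? e inc)
      equal = proj₁ (harmonically Δ (λ {α} → flagStabilizer-≤ x e {α})) x _ _ (at-x f inc-f) (at-x e inc)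

      only-e : ∀ {d} → Incident G d x ×
               Morphism.onEdge (quotientMap Δ) d ≡ inj₂ (orbitᵉ Δ e (¬vertical e inc)) → d ≡ e
      only-e (_ , p) with find (onEdge-orbit⁻ Δ (¬vertical e inc) p)
      ... | δ , δ∈ , q = trans (sym q) (proj₂ (fixes δ∈))

    -- If a vertex and all edges at it are fixed, so is every neighbour, as the other end of a fixed
    -- edge; this produces a fixed flag there, and connectedness carries the argument through the
    -- graph.
    fixesFlag⇒≈ε : ∀ {x e α} → Incident G e x → α ∈ₐ elements Γ → FixesFlag x e α → α 𝔸.≈ 𝔸.ε
    fixesFlag⇒≈ε {x} {e} {α} inc α∈ fix =
      (λ y → proj₁ (everywhere y)) , (λ f → proj₂ (everywhere (proj₁ (ends G f))) f (inj₁ refl))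
      where
      FixesStar : Vertex G → Set
      FixesStar y = α ·ᵛ y ≡ y × (∀ f → Incident G f y → α ·ᵉ f ≡ f)

      step : ∀ {y z} → Adjacent G y z → FixesStar y → FixesStar z
      step {y} {z} (f , h) (p , q) = αz≡z , fixesFlag⇒fixesStar {α = α} inc-z α∈ (αz≡z , αf≡f)
        where
        αf≡f = q f (HasEnds⇒Incidentˡ {G} {y = z} h)
        inc-z = HasEnds⇒Incidentʳ {G} {x = y} h
        αz≡z = HasEnds-unique {G} {f} {y}
          (subst₂ (λ d w → HasEnds G d w (α ·ᵛ z)) αf≡f p (compat α f y z h)) h

      everywhere : ∀ y → FixesStar y
      everywhere y = Star-invariant step (connected G x y)
        (proj₁ fix , fixesFlag⇒fixesStar {α = α} inc α∈ fix)

    private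
      to : Fin (order Γ) → Automorphism G
      to = lookup (elements Γ)

      to-∈ : ∀ i → to i ∈ₐ elements Γ
      to-∈ i = ∈⇒∈ₐ (∈-lookup i)

      to-injective : ∀ {i j} → to i 𝔸.≈ to j → i ≡ j
      to-injective {i} {j} = Unique⇒lookup-injective 𝔸.setoid (FiniteSubgroup.unique Γ) i j

      locate : ∀ {α} → α ∈ₐ elements Γ → ∃[ k ] to k 𝔸.≈ α
      locate {α} p = Any.index p , 𝔸.sym {α} {to (Any.index p)} (Anyₚ.lookup-index p)

      mul : ∀ i j → ∃[ k ] to k 𝔸.≈ to i 𝔸.∙ to j
      mul i j = locate {to i 𝔸.∙ to j}
        (FiniteSubgroup.∙-closed Γ {to i} {to j} (to-∈ i) (to-∈ j))

      one : ∃[ k ] to k 𝔸.≈ 𝔸.ε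
      one = locate {𝔸.ε} (FiniteSubgroup.ε-closed Γ)

      inv : ∀ i → ∃[ k ] to k 𝔸.≈ to i 𝔸.⁻¹
      inv i = locate {to i 𝔸.⁻¹} (FiniteSubgroup.⁻¹-closed Γ {to i} (to-∈ i))

    flagFreeAction : FlagFreeAction G (order Γ)
    flagFreeAction = record
      { Γ = finGroup (Aut G) to to-injective mul one inv
      ; actionV = record
        { _▹_ = λ i x → to i ·ᵛ x
        ; ▹-ε = λ x → proj₁ (proj₂ one) x
        ; ▹-∙ = λ i j x → proj₁ (proj₂ (mul i j)) x }
      ; actionE = record
        { _▹_ = λ i e → to i ·ᵉ e
        ; ▹-ε = λ e → proj₂ (proj₂ one) e
        ; ▹-∙ = λ i j e → proj₂ (proj₂ (mul i j)) e }
      ; ▹-ends = λ i {e} {x} {y} h → compat (to i) e x y h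
      ; flag-free = λ {i} inc p q → to-injective
          (𝔸.trans {to i} {𝔸.ε} {to (proj₁ one)} (fixesFlag⇒≈ε {α = to i} inc (to-∈ i) (p , q))
            (𝔸.sym {to (proj₁ one)} {𝔸.ε} (proj₂ one)))
      }

-- Subgroups of order two and three

-- A finite quotient of ℤ/2 ∗ ℤ/3 ≅ PSL₂(ℤ) in which both factors survive. Right multiplication by σ
-- and τ reaches all that inverses would, as σ⁻¹ = σσ and τ⁻¹ = τ.
record TwoThreeGenerated (n : ℕ) : Set where
  field
    Γ : FinGroup n
  open FinGroup Γ public
  field
    σ τ  : Fin n
    σ≢ε  : σ ≢ ε
    τ≢ε  : τ ≢ ε
    σ³≡ε : σ ∙ σ ∙ σ ≡ ε
    τ²≡ε : τ ∙ τ ≡ ε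

  Step : Fin n → Fin n → Set
  Step γ δ = δ ≡ γ ∙ σ ⊎ δ ≡ γ ∙ τ

  field
    generated : ∀ γ → Star Step ε γ

module _ {n} (Γ : FinGroup n) {P : Pred (Fin n) 0ℓ} (P? : Decidable P) (P-ε : P (FinGroup.ε Γ))
         (P-∙ : ∀ {γ δ} → P γ → P δ → P (FinGroup._∙_ Γ γ δ)) where
  open FinGroup Γ
  open Members P?

  order-two : count P? ≡ 2 → ∃[ τ ] P τ × τ ≢ ε × τ ∙ τ ≡ ε × (∀ {γ} → P γ → γ ≡ ε ⊎ γ ≡ τ)
  order-two size with other size (index P-ε)
    where
    other : ∀ {k} → k ≡ 2 → (i : Fin k) → ∃[ j ] j ≢ i × (∀ l → l ≡ i ⊎ l ≡ j)
    other refl zero       = suc zero , (λ ()) , λ { zero → inj₁ refl ; (suc zero) → inj₂ refl }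
    other refl (suc zero) = zero , (λ ()) , λ { zero → inj₂ refl ; (suc zero) → inj₁ refl }
  ... | j , j≢ , cover = τ , member-∈ j , τ≢ε , square (classify (P-∙ (member-∈ j) (member-∈ j))) , classify
    where
    τ = member j

    τ≢ε : τ ≢ ε
    τ≢ε eq = j≢ (member-injective j _ (trans eq (sym (member-index P-ε))))

    classify : ∀ {γ} → P γ → γ ≡ ε ⊎ γ ≡ τ
    classify p = Sum.map (index-injective p P-ε)
      (λ eq → trans (sym (member-index p)) (cong member eq)) (cover (index p))

    square : τ ∙ τ ≡ ε ⊎ τ ∙ τ ≡ τ → τ ∙ τ ≡ ε
    square (inj₁ eq) = eq
    square (inj₂ eq) = contradiction (identityʳ-unique τ τ eq) τ≢ε

  -- With elements ε, σ, ρ the cancellation laws leave only ε for σρ, and then only ρ for σσ.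
  order-three : count P? ≡ 3 →
    ∃[ σ ] P σ × σ ≢ ε × σ ∙ σ ∙ σ ≡ ε × (∀ {γ} → P γ → γ ≡ ε ⊎ γ ≡ σ ⊎ γ ≡ σ ∙ σ)
  order-three size with others size (index P-ε)
    where
    others : ∀ {k} → k ≡ 3 → (i : Fin k) →
             ∃[ j ] ∃[ l ] j ≢ i × l ≢ i × j ≢ l × (∀ m → m ≡ i ⊎ m ≡ j ⊎ m ≡ l)
    others refl zero = suc zero , suc (suc zero) , (λ ()) , (λ ()) , (λ ()) ,
      λ { zero → inj₁ refl ; (suc zero) → inj₂ (inj₁ refl) ; (suc (suc zero)) → inj₂ (inj₂ refl) }
    others refl (suc zero) = zero , suc (suc zero) , (λ ()) , (λ ()) , (λ ()) ,
      λ { (suc zero) → inj₁ refl ; zero → inj₂ (inj₁ refl) ; (suc (suc zero)) → inj₂ (inj₂ refl) }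
    others refl (suc (suc zero)) = zero , suc zero , (λ ()) , (λ ()) , (λ ()) ,
      λ { (suc (suc zero)) → inj₁ refl ; zero → inj₂ (inj₁ refl) ; (suc zero) → inj₂ (inj₂ refl) }
  ... | j , l , j≢ , l≢ , j≢l , cover =
      σ , Pσ , σ≢ε , trans (assoc σ σ σ) (trans (cong (σ ∙_) σσ≡ρ) σρ≡ε) ,
      λ p → Sum.map₂ (Sum.map₂ (λ eq → trans eq (sym σσ≡ρ))) (classify p)
    where
    σ = member j
    ρ = member l

    Pσ = member-∈ j
    Pρ = member-∈ l

    σ≢ε : σ ≢ ε
    σ≢ε eq = j≢ (member-injective j _ (trans eq (sym (member-index P-ε))))

    ρ≢ε : ρ ≢ ε
    ρ≢ε eq = l≢ (member-injective l _ (trans eq (sym (member-index P-ε))))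

    σ≢ρ : σ ≢ ρ
    σ≢ρ eq = j≢l (member-injective j l eq)

    classify : ∀ {γ} → P γ → γ ≡ ε ⊎ γ ≡ σ ⊎ γ ≡ ρ
    classify p = Sum.map (index-injective p P-ε)
      (Sum.map (λ eq → trans (sym (member-index p)) (cong member eq))
               (λ eq → trans (sym (member-index p)) (cong member eq))) (cover (index p))

    σρ≡ε : σ ∙ ρ ≡ ε
    σρ≡ε with classify (P-∙ Pσ Pρ)
    ... | inj₁ eq        = eq
    ... | inj₂ (inj₁ eq) = contradiction (identityʳ-unique σ ρ eq) ρ≢ε
    ... | inj₂ (inj₂ eq) = contradiction (identityˡ-unique σ ρ eq) σ≢ε

    σσ≡ρ : σ ∙ σ ≡ ρ
    σσ≡ρ with classify (P-∙ Pσ Pσ)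
    ... | inj₁ eq        = contradiction (∙-cancelˡ σ σ ρ (trans eq (sym σρ≡ε))) σ≢ρ
    ... | inj₂ (inj₁ eq) = contradiction (identityʳ-unique σ σ eq) σ≢ε
    ... | inj₂ (inj₂ eq) = eq

-- Sums of weights in {0, n/2, 2n/3} ∪ [3n/4, n]

-- All conditions on weights are multiplied by 12.
module Weights {A : Set} (w : A → ℕ) (n : ℕ) (P₀ P₂ P₃ : A → Set) where

  data Kind (a : A) : Set where
    trivial : P₀ a → w a ≡ 0 → Kind a
    double  : P₂ a → 12 * w a ≡ 6 * n → Kind a
    triple  : P₃ a → 12 * w a ≡ 8 * n → Kind a
    large   : 9 * n ≤ 12 * w a → w a ≤ n → Kind a

  weight : List A → ℕ
  weight []       = 0
  weight (x ∷ xs) = w x + weight xs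

  -- The combinations of nonzero weights whose total can stay below 5n/4, and `enough` for the rest.
  -- Only `two-three`, with total 14n/12, lies strictly between n and 5n/4, so its two cells are
  -- remembered in full.
  data Summary (xs : List A) : Set where
    none      : All P₀ xs → weight xs ≡ 0 → Summary xs
    one-two   : ∀ s → P₂ s → All (λ x → P₀ x ⊎ x ≡ s) xs → 12 * weight xs ≡ 6 * n → Summary xs
    one-three : ∀ t → P₃ t → All (λ x → P₀ x ⊎ x ≡ t) xs → 12 * weight xs ≡ 8 * n → Summary xs
    one-large : 9 * n ≤ 12 * weight xs → weight xs ≤ n → Summary xs
    two-twos  : 12 * weight xs ≡ 12 * n → Summary xs
    two-three : ∀ s t → P₂ s → P₃ t → All (λ x → P₀ x ⊎ x ≡ s ⊎ x ≡ t) xs →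
                12 * weight xs ≡ 14 * n → Summary xs
    enough    : 15 * n ≤ 12 * weight xs → Summary xs

  private
    sum≡ : ∀ x xs a b → 12 * w x ≡ a * n → 12 * weight xs ≡ b * n →
           12 * weight (x ∷ xs) ≡ (a + b) * n
    sum≡ x xs a b p q =
      trans (ℕₚ.*-distribˡ-+ 12 (w x) (weight xs)) (trans (cong₂ _+_ p q) (sym (ℕₚ.*-distribʳ-+ n a b)))

    sum≥ : ∀ x xs a b → a * n ≤ 12 * w x → b * n ≤ 12 * weight xs → 15 ≤ a + b →
           15 * n ≤ 12 * weight (x ∷ xs)
    sum≥ x xs a b p q le = begin
      15 * n          ≤⟨ ℕₚ.*-monoˡ-≤ n le ⟩
      (a + b) * n     ≡⟨ ℕₚ.*-distribʳ-+ n a b ⟩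
      a * n + b * n   ≤⟨ ℕₚ.+-mono-≤ p q ⟩
      12 * w x + 12 * weight xs ≡⟨ sym (ℕₚ.*-distribˡ-+ 12 (w x) (weight xs)) ⟩
      12 * weight (x ∷ xs) ∎
      where open ℕₚ.≤-Reasoning

    above : ∀ {a b} → a ≡ b → b ≤ a
    above eq = ℕₚ.≤-reflexive (sym eq)

    none+ : ∀ x xs → weight xs ≡ 0 → weight (x ∷ xs) ≡ w x
    none+ x xs eq = trans (cong (w x +_) eq) (ℕₚ.+-identityʳ (w x))

    15≤+ : ∀ {m} → 15 ≤ 15 + m
    15≤+ {m} = ℕₚ.m≤m+n 15 m

  summary-∷ : ∀ x {xs} → Kind x → Summary xs → Summary (x ∷ xs)
  summary-∷ x {xs} (trivial p eq) S = add S
    where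
    same : weight (x ∷ xs) ≡ weight xs
    same = cong (_+ weight xs) eq
    add : Summary xs → Summary (x ∷ xs)
    add (none a e)              = none (p ∷ a) (trans same e)
    add (one-two s q a e)       = one-two s q (inj₁ p ∷ a) (trans (cong (12 *_) same) e)
    add (one-three t q a e)     = one-three t q (inj₁ p ∷ a) (trans (cong (12 *_) same) e)
    add (one-large l u)         = one-large (subst (λ k → 9 * n ≤ 12 * k) (sym same) l)
                                            (subst (_≤ n) (sym same) u)
    add (two-twos e)            = two-twos (trans (cong (12 *_) same) e)
    add (two-three s t q r a e) = two-three s t q r (inj₁ p ∷ a) (trans (cong (12 *_) same) e)
    add (enough l)              = enough (subst (λ k → 15 * n ≤ 12 * k) (sym same) l)
  summary-∷ x {xs} (double p eq) (none a e) =
    one-two x p (inj₂ refl ∷ All.map inj₁ a) (trans (cong (12 *_) (none+ x xs e)) eq)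
  summary-∷ x {xs} (double p eq) (one-two s q a e) = two-twos (sum≡ x xs 6 6 eq e)
  summary-∷ x {xs} (double p eq) (one-three t q a e) =
    two-three x t p q (inj₂ (inj₁ refl) ∷ All.map (Sum.map₂ inj₂) a) (sum≡ x xs 6 8 eq e)
  summary-∷ x {xs} (double p eq) (one-large l u)         = enough (sum≥ x xs 6 9 (above eq) l 15≤+)
  summary-∷ x {xs} (double p eq) (two-twos e)            = enough (sum≥ x xs 6 12 (above eq) (above e) 15≤+)
  summary-∷ x {xs} (double p eq) (two-three s t q r a e) = enough (sum≥ x xs 6 14 (above eq) (above e) 15≤+)
  summary-∷ x {xs} (triple p eq) (none a e) =
    one-three x p (inj₂ refl ∷ All.map inj₁ a) (trans (cong (12 *_) (none+ x xs e)) eq)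
  summary-∷ x {xs} (triple p eq) (one-two s q a e) =
    two-three s x q p (inj₂ (inj₂ refl) ∷ All.map (Sum.map₂ inj₁) a) (sum≡ x xs 8 6 eq e)
  summary-∷ x {xs} (triple p eq) (one-three t q a e)     = enough (sum≥ x xs 8 8 (above eq) (above e) 15≤+)
  summary-∷ x {xs} (triple p eq) (one-large l u)         = enough (sum≥ x xs 8 9 (above eq) l 15≤+)
  summary-∷ x {xs} (triple p eq) (two-twos e)            = enough (sum≥ x xs 8 12 (above eq) (above e) 15≤+)
  summary-∷ x {xs} (triple p eq) (two-three s t q r a e) = enough (sum≥ x xs 8 14 (above eq) (above e) 15≤+)
  summary-∷ x {xs} (large l u) (none a e) =
    one-large (subst (λ k → 9 * n ≤ 12 * k) (sym (none+ x xs e)) l) (subst (_≤ n) (sym (none+ x xs e)) u)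
  summary-∷ x {xs} (large l u) (one-two s q a e)       = enough (sum≥ x xs 9 6 l (above e) 15≤+)
  summary-∷ x {xs} (large l u) (one-three t q a e)     = enough (sum≥ x xs 9 8 l (above e) 15≤+)
  summary-∷ x {xs} (large l u) (one-large l′ u′)       = enough (sum≥ x xs 9 9 l l′ 15≤+)
  summary-∷ x {xs} (large l u) (two-twos e)            = enough (sum≥ x xs 9 12 l (above e) 15≤+)
  summary-∷ x {xs} (large l u) (two-three s t q r a e) = enough (sum≥ x xs 9 14 l (above e) 15≤+)
  summary-∷ x k (enough l) = enough (ℕₚ.≤-trans l (ℕₚ.*-monoʳ-≤ 12 (ℕₚ.m≤n+m _ (w x))))

  summary : (∀ x → Kind x) → ∀ xs → Summary xs
  summary kind []       = none [] refl
  summary kind (x ∷ xs) = summary-∷ x (kind x) (summary kind xs)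

  -- Taking 12n away from 12(n + h) leaves 2n = 12h in the exceptional case and 3n ≤ 12h for
  -- `enough`. The other summaries total at most n and are excluded by the positivity of n and h.
  excess : (∀ x → Kind x) → ∀ xs {h} → 1 ≤ n → 1 ≤ h → weight xs ≡ n + h →
           n ≤ 4 * h ⊎
           (n ≡ 6 * h × ∃[ s ] ∃[ t ] P₂ s × P₃ t × All (λ x → P₀ x ⊎ x ≡ s ⊎ x ≡ t) xs)
  excess kind xs {h} 1≤n 1≤h eq = conclude (summary kind xs)
    where
    open ℕₚ.≤-Reasoning

    ¬small : ∀ a → a ≤ 12 → ¬ (12 * weight xs ≤ a * n)
    ¬small a le p = ℕₚ.<⇒≱ (ℕₚ.*-monoʳ-< 12 (ℕₚ.m<m+n n 1≤h))
      (ℕₚ.≤-trans (subst (λ k → 12 * k ≤ a * n) eq p) (ℕₚ.*-monoˡ-≤ n le))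

    expand : 12 * weight xs ≡ 12 * n + 12 * h
    expand = trans (cong (12 *_) eq) (ℕₚ.*-distribˡ-+ 12 n h)

    split : ∀ a → (12 + a) * n ≡ 12 * n + a * n
    split a = ℕₚ.*-distribʳ-+ n 12 a

    conclude : Summary xs → n ≤ 4 * h ⊎
      (n ≡ 6 * h × ∃[ s ] ∃[ t ] P₂ s × P₃ t × All (λ x → P₀ x ⊎ x ≡ s ⊎ x ≡ t) xs)
    conclude (none _ e) =
      contradiction (trans (sym eq) e) (ℕₚ.m<n⇒n≢0 (ℕₚ.≤-trans 1≤n (ℕₚ.m≤m+n n h)))
    conclude (one-two _ _ _ e)   = contradiction (ℕₚ.≤-reflexive e) (¬small 6 (ℕₚ.m≤m+n 6 6))
    conclude (one-three _ _ _ e) = contradiction (ℕₚ.≤-reflexive e) (¬small 8 (ℕₚ.m≤m+n 8 4))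
    conclude (one-large _ u)     = contradiction (ℕₚ.*-monoʳ-≤ 12 u) (¬small 12 ℕₚ.≤-refl)
    conclude (two-twos e)        = contradiction (ℕₚ.≤-reflexive e) (¬small 12 ℕₚ.≤-refl)
    conclude (two-three s t p q a e) = inj₂ (n≡6h , s , t , p , q , a)
      where
      n≡6h : n ≡ 6 * h
      n≡6h = ℕₚ.*-cancelˡ-≡ n (6 * h) 2
        (trans (ℕₚ.+-cancelˡ-≡ (12 * n) (2 * n) (12 * h) (trans (sym (split 2)) (trans (sym e) expand)))
               (ℕₚ.*-assoc 2 6 h))
    conclude (enough l) = inj₁ (ℕₚ.*-cancelˡ-≤ 3
      (subst (3 * n ≤_) (ℕₚ.*-assoc 3 4 h) (ℕₚ.+-cancelˡ-≤ (12 * n) (3 * n) (12 * h)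
        (begin
          12 * n + 3 * n  ≡⟨ sym (split 3) ⟩
          15 * n          ≤⟨ l ⟩
          12 * weight xs  ≡⟨ expand ⟩
          12 * n + 12 * h ∎))))

-- The bound for flag-free actions

additive-++ : ∀ {A : Set} (w : A → ℕ) (f : List A → ℕ) → f [] ≡ 0 → (∀ x xs → f (x ∷ xs) ≡ w x + f xs) →
                   ∀ xs ys → f (xs ++ ys) ≡ f xs + f ys
additive-++ w f f[] f∷ []       ys = cong (_+ f ys) (sym f[])
additive-++ w f f[] f∷ (x ∷ xs) ys =
  trans (f∷ x (xs ++ ys)) (trans (cong (w x +_) (additive-++ w f f[] f∷ xs ys))
    (trans (sym (ℕₚ.+-assoc (w x) (f xs) (f ys))) (cong (_+ f ys) (sym (f∷ x xs)))))

module FlagFree {G : Graph} {n : ℕ} (A : FlagFreeAction G n) where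
  open FlagFreeAction A

  flag-determines : ∀ {γ δ e x} → Incident G e x → γ 𝐕.▹ x ≡ δ 𝐕.▹ x → γ 𝐄.▹ e ≡ δ 𝐄.▹ e → γ ≡ δ
  flag-determines {γ} {δ} {e} {x} inc p q =
    ∙-cancelˡ (δ ⁻¹) γ δ (trans (flag-free inc fix-x fix-e) (sym (inverseˡ δ)))
    where
    fix-x : (δ ⁻¹ ∙ γ) 𝐕.▹ x ≡ x
    fix-x = trans (𝐕.▹-∙ (δ ⁻¹) γ x) (𝐕.▹-move (sym p))
    fix-e : (δ ⁻¹ ∙ γ) 𝐄.▹ e ≡ e
    fix-e = trans (𝐄.▹-∙ (δ ⁻¹) γ e) (𝐄.▹-move (sym q))

  HasEnds-move : ∀ {γ e d x y} → γ 𝐄.▹ e ≡ d → HasEnds G e x y → HasEnds G d (γ 𝐕.▹ x) (γ 𝐕.▹ y)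
  HasEnds-move {γ} refl h = ▹-ends γ h

  stabilized-end : ∀ {γ e x y} → HasEnds G e x y → γ 𝐄.▹ e ≡ e → γ 𝐕.▹ x ≡ x ⊎ γ 𝐕.▹ x ≡ y
  stabilized-end {γ} {e} {x} {y} h s =
    Incident-cases {G} {e} h (HasEnds⇒Incidentˡ {G} {y = γ 𝐕.▹ y} (HasEnds-move s h))

  -- An element fixing e either fixes its first end or sends it to the second; two elements that
  -- behave alike agree on a flag and are equal.
  edge-stabilizer≤2 : ∀ e → 𝐄.stabilizerSize e ≤ 2
  edge-stabilizer≤2 e = Finₚ.injective⇒≤ {f = λ k → side (S.member k)} injective
    where
    module S = Members (𝐄.stabilizer? e)
    x = proj₁ (ends G e)
    y = proj₂ (ends G e)

    side : Fin n → Fin 2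
    side γ with (γ 𝐕.▹ x) Finₚ.≟ x
    ... | yes _ = zero
    ... | no  _ = suc zero

    same-end : ∀ γ δ → γ 𝐄.▹ e ≡ e → δ 𝐄.▹ e ≡ e → side γ ≡ side δ → γ 𝐕.▹ x ≡ δ 𝐕.▹ x
    same-end γ δ s t eq with (γ 𝐕.▹ x) Finₚ.≟ x | (δ 𝐕.▹ x) Finₚ.≟ x
    ... | yes p | yes q = trans p (sym q)
    ... | no ¬p | no ¬q with stabilized-end (HasEnds-ends G e) s | stabilized-end (HasEnds-ends G e) t
    ... | inj₁ p | _      = contradiction p ¬p
    ... | inj₂ _ | inj₁ q = contradiction q ¬q
    ... | inj₂ p | inj₂ q = trans p (sym q)
    same-end γ δ s t () | yes p | no ¬q
    same-end γ δ s t () | no ¬p | yes q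

    injective : ∀ {k l} → side (S.member k) ≡ side (S.member l) → k ≡ l
    injective {k} {l} eq = S.member-injective k l (flag-determines (inj₁ refl)
      (same-end _ _ (S.member-∈ k) (S.member-∈ l) eq) (trans (S.member-∈ k) (sym (S.member-∈ l))))

  -- Lifts to G of subtrees of the quotient graph.
  data Tree : List (Vertex G) → List (Edge G) → Set where
    root : ∀ t → Tree (t ∷ []) []
    grow : ∀ {T L t e z} → Tree T L → t ∈ T → HasEnds G e t z → ¬ 𝐕.Covered T z →
           Tree (z ∷ T) (e ∷ L)

  tree-independent : ∀ {T L} → Tree T L → 𝐕.Independent T
  tree-independent (root t)        = (λ ()) 𝐕.Independent.∷ 𝐕.Independent.[]
  tree-independent (grow T _ _ ¬c) = ¬c 𝐕.Independent.∷ tree-independent T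

  tree-length : ∀ {T L} → Tree T L → length T ≡ suc (length L)
  tree-length (root t)       = refl
  tree-length (grow T _ _ _) = cong suc (tree-length T)

  tree-ends : ∀ {T L e} → Tree T L → e ∈ L →
              ∃[ t ] ∃[ t′ ] t ∈ T × t′ ∈ T × HasEnds G e t t′
  tree-ends (grow T t∈ h ¬c) (here refl) = _ , _ , there t∈ , here refl , h
  tree-ends (grow T t∈ h ¬c) (there e∈) =
    let t , t′ , t∈ , t′∈ , h = tree-ends T e∈ in t , t′ , there t∈ , there t′∈ , h

  -- The new edge ends in a vertex orbit not yet covered, whereas all translates of earlier edges
  -- have both ends in covered orbits.
  tree-edges-independent : ∀ {T L} → Tree T L → 𝐄.Independent L
  tree-edges-independent (root t) = 𝐄.Independent.[]
  tree-edges-independent (grow {T} {L} {t} {e} {z} tree t∈ h ¬c) = new 𝐄.Independent.∷ tree-edges-independent tree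
    where
    new : ¬ 𝐄.Covered L e
    new c with find c
    ... | f , f∈ , γ , refl with tree-ends tree f∈
    ... | a , b , a∈ , b∈ , k
      with Incident-cases {G} (▹-ends γ k) (HasEnds⇒Incidentʳ {G} {x = t} h)
    ... | inj₁ refl = ¬c (𝐕.covered-orbit (γ , refl) (𝐕.covered-∈ a∈))
    ... | inj₂ refl = ¬c (𝐕.covered-orbit (γ , refl) (𝐕.covered-∈ b∈))

  -- An element stabilizing e fixes the flag (x, e), hence is trivial, or else it moves x to y.
  orbitSize-free : ∀ {e x y} → HasEnds G e x y → ¬ 𝐕.Orbit x y → 𝐄.orbitSize e ≡ n
  orbitSize-free {e} {x} {y} h ¬o = trans (sym (ℕₚ.*-identityʳ _))
    (trans (cong (𝐄.orbitSize e *_) (sym size)) (𝐄.orbit-stabilizer e))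
    where
    only-ε : ∀ {γ} → γ 𝐄.▹ e ≡ e → γ ≡ ε
    only-ε {γ} s with stabilized-end h s
    ... | inj₁ p = flag-free (HasEnds⇒Incidentˡ {G} {y = y} h) p s
    ... | inj₂ p = contradiction (γ , p) ¬o

    size : 𝐄.stabilizerSize e ≡ 1
    size = ℕₚ.≤-antisym (count≤1 (𝐄.stabilizer? e) ε only-ε)
      (ℕₚ.≤-trans (s≤s z≤n) (Finₚ.toℕ<n (Members.index (𝐄.stabilizer? e) (𝐄.stabilizer-ε e))))

  tree-totalSize : ∀ {T L} → Tree T L → 𝐄.totalSize L ≡ length L * n
  tree-totalSize (root t) = refl
  tree-totalSize (grow T t∈ h ¬c) = cong₂ _+_
    (orbitSize-free h (λ o → ¬c (𝐕.covered-orbit o (𝐕.covered-∈ t∈)))) (tree-totalSize T)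

  Extends : List (Vertex G) → (List (Vertex G) → Set) → Set
  Extends T P = ∃[ T′ ] ∃[ L′ ] Tree T′ L′ × (∀ {y} → 𝐕.Covered T y → 𝐕.Covered T′ y) × P T′

  -- When the path leaves the covered part, it does so along an edge e at a translate γt with t in
  -- T. The edge γ⁻¹e starts at t itself, so that it can be attached to the tree.
  absorb : ∀ {T L x y} → Tree T L → 𝐕.Covered T x → Star (Adjacent G) x y →
           Extends T (λ T′ → 𝐕.Covered T′ y)
  absorb tree c Star.ε = _ , _ , tree , id , c
  absorb {T} tree c (_◅_ {j = z} (e , h) s) with 𝐕.covered? T z | find c
  ... | yes c′ | _ = absorb tree c′ s
  ... | no ¬c′ | t , t∈ , γ , refl =
    let T′ , L′ , tree′ , T⊆T′ , c″ = absorb bigger (here (γ , 𝐕.▹-⁻¹ʳ γ z)) s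
    in T′ , L′ , tree′ , T⊆T′ ∘ there , c″
    where
    bigger : Tree (γ ⁻¹ 𝐕.▹ z ∷ T) (γ ⁻¹ 𝐄.▹ e ∷ _)
    bigger = grow tree t∈
      (subst (λ w → HasEnds G (γ ⁻¹ 𝐄.▹ e) w (γ ⁻¹ 𝐕.▹ z)) (𝐕.▹-⁻¹ˡ γ t) (▹-ends (γ ⁻¹) h))
      (λ c → ¬c′ (𝐕.covered-orbit (γ , 𝐕.▹-⁻¹ʳ γ z) c))

  absorb-all : ∀ {T L x} → Tree T L → 𝐕.Covered T x → ∀ ys →
               Extends T (λ T′ → ∀ {y} → y ∈ ys → 𝐕.Covered T′ y)
  absorb-all tree c [] = _ , _ , tree , id , λ ()
  absorb-all {x = x} tree c (y ∷ ys) =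
    let T₁ , L₁ , tree₁ , ⊆₁ , c₁ = absorb tree c (connected G x y)
        T₂ , L₂ , tree₂ , ⊆₂ , c₂ = absorb-all tree₁ (⊆₁ c) ys
    in T₂ , L₂ , tree₂ , ⊆₂ ∘ ⊆₁ , λ { (here refl) → ⊆₂ c₁ ; (there y∈) → c₂ y∈ }

  spanningTree : ∃[ T ] ∃[ L ] Tree T L × (∀ y → 𝐕.Covered T y)
  spanningTree =
    let T , L , tree , _ , c = absorb-all (root x₀) (here 𝐕.orbit-refl) (allFin (#V G))
    in T , L , tree , λ y → c (∈-allFin y)
    where x₀ = fromℕ< (nonempty G)

  module _ {T L} (tree : Tree T L) (covers : ∀ y → 𝐕.Covered T y) where

    -- Representatives of the edge orbits outside the tree, translated so that one end lies in T;
    -- that end is the starting point for the extra edges in `neighbour`.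
    record Extra (es : List (Edge G)) : Set where
      field
        extra       : List (Edge G)
        independent : 𝐄.Independent (extra ++ L)
        attached    : ∀ {e} → e ∈ extra → ∃[ t ] t ∈ T × Incident G e t
        complete    : ∀ {e} → e ∈ es → 𝐄.Covered (extra ++ L) e

    extras : ∀ es → Extra es
    extras [] = record { extra = [] ; independent = tree-edges-independent tree
                       ; attached = λ () ; complete = λ () }
    extras (e ∷ es) with extras es
    ... | X with 𝐄.covered? (Extra.extra X ++ L) e | find (covers (proj₁ (ends G e)))
    ... | yes c | _ = record { Extra X
      ; complete = λ { (here refl) → c ; (there e∈) → Extra.complete X e∈ } }
    ... | no ¬c | t , t∈ , γ , p = record
      { extra       = γ ⁻¹ 𝐄.▹ e ∷ Extra.extra X
      ; independent = (λ c → ¬c (𝐄.covered-orbit (γ , 𝐄.▹-⁻¹ʳ γ e) c)) 𝐄.Independent.∷ Extra.independent X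
      ; attached    = λ { (here refl) → t , t∈ , moved ; (there e∈) → Extra.attached X e∈ }
      ; complete    = λ { (here refl) → here (γ , 𝐄.▹-⁻¹ʳ γ e) ; (there e∈) → there (Extra.complete X e∈) }
      }
      where
      moved : Incident G (γ ⁻¹ 𝐄.▹ e) t
      moved = subst (Incident G (γ ⁻¹ 𝐄.▹ e)) (𝐕.▹-move p)
        (HasEnds⇒Incidentˡ {G} {y = γ ⁻¹ 𝐕.▹ proj₂ (ends G e)} (▹-ends (γ ⁻¹) (HasEnds-ends G e)))

  -- Weights: with T and L from a spanning tree of the quotient and X the extra
  -- edges, |E| - |V| + n is the sum of n - |Γt| over T and of |Γe| over X.

  stabilizes : Cell G → Fin n → Set
  stabilizes (inj₁ x) = 𝐕.Stabilizer x
  stabilizes (inj₂ e) = 𝐄.Stabilizer e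

  stabilizes? : ∀ c → Decidable (stabilizes c)
  stabilizes? (inj₁ x) = 𝐕.stabilizer? x
  stabilizes? (inj₂ e) = 𝐄.stabilizer? e

  cellWeight : Cell G → ℕ
  cellWeight (inj₁ x) = n ∸ 𝐕.orbitSize x
  cellWeight (inj₂ e) = 𝐄.orbitSize e

  -- `Stab₂` leaves open whether the cell is a vertex or a flipped edge. The other two concern
  -- vertices only: an edge with trivial stabilizer has the full weight n, and no edge has a
  -- stabilizer of order 3.
  Stab₀ Stab₂ Stab₃ : Cell G → Set
  Stab₀ c = ∃[ x ] c ≡ inj₁ x × 𝐕.stabilizerSize x ≡ 1
  Stab₂ c = count (stabilizes? c) ≡ 2
  Stab₃ c = ∃[ x ] c ≡ inj₁ x × 𝐕.stabilizerSize x ≡ 3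

  module W = Weights cellWeight n Stab₀ Stab₂ Stab₃

  kind : ∀ c → W.Kind c
  kind (inj₁ x) = by-size (𝐕.stabilizerSize x) refl
    where
    o = 𝐕.orbitSize x

    n≡o*r : ∀ {r} → 𝐕.stabilizerSize x ≡ r → n ≡ o * r
    n≡o*r eq = trans (sym (𝐕.orbit-stabilizer x)) (cong (o *_) eq)

    w≡ : ∀ {r} → 𝐕.stabilizerSize x ≡ suc r → n ∸ o ≡ o * r
    w≡ {r} eq = trans (cong (_∸ o) (trans (n≡o*r eq) (ℕₚ.*-suc o r))) (ℕₚ.m+n∸m≡n o (o * r))

    scaled : ∀ {r} a b → 𝐕.stabilizerSize x ≡ suc r → a * r ≡ b * suc r → a * (n ∸ o) ≡ b * n
    scaled {r} a b eq ab = begin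
      a * (n ∸ o)     ≡⟨ cong (a *_) (w≡ eq) ⟩
      a * (o * r)     ≡⟨ cong (a *_) (ℕₚ.*-comm o r) ⟩
      a * (r * o)     ≡⟨ sym (ℕₚ.*-assoc a r o) ⟩
      a * r * o       ≡⟨ cong (_* o) ab ⟩
      b * suc r * o   ≡⟨ ℕₚ.*-assoc b (suc r) o ⟩
      b * (suc r * o) ≡⟨ cong (b *_) (ℕₚ.*-comm (suc r) o) ⟩
      b * (o * suc r) ≡⟨ cong (b *_) (sym (n≡o*r eq)) ⟩
      b * n           ∎
      where open ≡-Reasoning

    -- This is (r - 1)/r ≥ 3/4 for a stabilizer of order r = 4 + k.
    9*[4+k]≤12*[3+k] : ∀ k → 9 * (4 + k) ≤ 12 * (3 + k)
    9*[4+k]≤12*[3+k] k = begin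
      9 * (4 + k)    ≡⟨ ℕₚ.*-distribˡ-+ 9 4 k ⟩
      36 + 9 * k     ≤⟨ ℕₚ.+-monoʳ-≤ 36 (ℕₚ.*-monoˡ-≤ k (ℕₚ.m≤m+n 9 3)) ⟩
      36 + 12 * k    ≡⟨ sym (ℕₚ.*-distribˡ-+ 12 3 k) ⟩
      12 * (3 + k)   ∎
      where open ℕₚ.≤-Reasoning

    by-size : ∀ r → 𝐕.stabilizerSize x ≡ r → W.Kind (inj₁ x)
    by-size 0 eq = contradiction
      (subst Fin eq (Members.index (𝐕.stabilizer? x) (𝐕.stabilizer-ε x))) Finₚ.¬Fin0
    by-size 1 eq = W.trivial (x , refl , eq) (trans (w≡ eq) (ℕₚ.*-zeroʳ o))
    by-size 2 eq = W.double eq (scaled 12 6 eq refl)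
    by-size 3 eq = W.triple (x , refl , eq) (scaled 12 8 eq refl)
    by-size (suc (suc (suc (suc k)))) eq = W.large (begin
        9 * n              ≡⟨ cong (9 *_) (trans (n≡o*r eq) (ℕₚ.*-comm o (4 + k))) ⟩
        9 * ((4 + k) * o)  ≡⟨ sym (ℕₚ.*-assoc 9 (4 + k) o) ⟩
        9 * (4 + k) * o    ≤⟨ ℕₚ.*-monoˡ-≤ o (9*[4+k]≤12*[3+k] k) ⟩
        12 * (3 + k) * o   ≡⟨ ℕₚ.*-assoc 12 (3 + k) o ⟩
        12 * ((3 + k) * o) ≡⟨ cong (12 *_) (ℕₚ.*-comm (3 + k) o) ⟩
        12 * (o * (3 + k)) ≡⟨ cong (12 *_) (sym (w≡ eq)) ⟩
        12 * (n ∸ o)       ∎) (ℕₚ.m∸n≤m n o)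
      where open ℕₚ.≤-Reasoning
  kind (inj₂ e) = by-size (𝐄.stabilizerSize e) refl (edge-stabilizer≤2 e)
    where
    o = 𝐄.orbitSize e

    n≡o*r : ∀ {r} → 𝐄.stabilizerSize e ≡ r → n ≡ o * r
    n≡o*r eq = trans (sym (𝐄.orbit-stabilizer e)) (cong (o *_) eq)

    by-size : ∀ r → 𝐄.stabilizerSize e ≡ r → 𝐄.stabilizerSize e ≤ 2 → W.Kind (inj₂ e)
    by-size 0 eq _ = contradiction
      (subst Fin eq (Members.index (𝐄.stabilizer? e) (𝐄.stabilizer-ε e))) Finₚ.¬Fin0
    by-size 1 eq _ = W.large
      (ℕₚ.≤-trans (ℕₚ.*-monoˡ-≤ n (ℕₚ.m≤m+n 9 3)) (ℕₚ.≤-reflexive (cong (12 *_) n≡o)))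
      (ℕₚ.≤-reflexive (sym n≡o))
      where
      n≡o : n ≡ o
      n≡o = trans (n≡o*r eq) (ℕₚ.*-identityʳ o)
    by-size 2 eq _ = W.double eq
      (trans (ℕₚ.*-assoc 6 2 o) (cong (6 *_) (trans (ℕₚ.*-comm 2 o) (sym (n≡o*r eq)))))
    by-size (suc (suc (suc _))) eq le with subst (_≤ 2) eq le
    ... | s≤s (s≤s ())

module FlagFreeBound {G : Graph} {n : ℕ} (A : FlagFreeAction G n) where
  open FlagFreeAction A
  open FlagFree A

  positive : 1 ≤ n
  positive = ℕₚ.≤-trans (s≤s z≤n) (Finₚ.toℕ<n ε)

  orbitSize≤ : ∀ x → 𝐕.orbitSize x ≤ n
  orbitSize≤ x = ℕₚ.≤-trans (ℕₚ.≤-reflexive (sym (ℕₚ.*-identityʳ (𝐕.orbitSize x))))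
    (ℕₚ.≤-trans (ℕₚ.*-monoʳ-≤ (𝐕.orbitSize x) stabilizer≥1) (ℕₚ.≤-reflexive (𝐕.orbit-stabilizer x)))
    where
    stabilizer≥1 : 1 ≤ 𝐕.stabilizerSize x
    stabilizer≥1 = ℕₚ.≤-trans (s≤s z≤n)
      (Finₚ.toℕ<n (Members.index (𝐕.stabilizer? x) (𝐕.stabilizer-ε x)))

  vertex-weights : ∀ T → W.weight (map inj₁ T) + 𝐕.totalSize T ≡ length T * n
  vertex-weights []      = refl
  vertex-weights (t ∷ T) = begin
    (n ∸ o) + w + (o + s) ≡⟨ ℕₚ.+-assoc (n ∸ o) w (o + s) ⟩
    (n ∸ o) + (w + (o + s)) ≡⟨ cong ((n ∸ o) +_) (trans (sym (ℕₚ.+-assoc w o s))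
                                (trans (cong (_+ s) (ℕₚ.+-comm w o)) (ℕₚ.+-assoc o w s))) ⟩
    (n ∸ o) + (o + (w + s)) ≡⟨ sym (ℕₚ.+-assoc (n ∸ o) o (w + s)) ⟩
    (n ∸ o) + o + (w + s) ≡⟨ cong₂ _+_ (ℕₚ.m∸n+n≡m (orbitSize≤ t)) (vertex-weights T) ⟩
    n + length T * n      ∎
    where
    open ≡-Reasoning
    o = 𝐕.orbitSize t
    w = W.weight (map inj₁ T)
    s = 𝐕.totalSize T

  edge-weights : ∀ X → W.weight (map inj₂ X) ≡ 𝐄.totalSize X
  edge-weights []      = refl
  edge-weights (e ∷ X) = cong (𝐄.orbitSize e +_) (edge-weights X)

  independent-injective : ∀ {T t t′} → 𝐕.Independent T → t ∈ T → t′ ∈ T → 𝐕.Orbit t t′ → t ≡ t′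
  independent-injective (¬c 𝐕.Independent.∷ I) (here refl) (here refl) o = refl
  independent-injective (¬c 𝐕.Independent.∷ I) (here refl) (there q) o =
    contradiction (𝐕.covered-orbit (𝐕.orbit-sym o) (𝐕.covered-∈ q)) ¬c
  independent-injective (¬c 𝐕.Independent.∷ I) (there p) (here refl) o =
    contradiction (𝐕.covered-orbit o (𝐕.covered-∈ p)) ¬c
  independent-injective (¬c 𝐕.Independent.∷ I) (there p) (there q) o = independent-injective I p q o

  module Spanned {T L} (tree : Tree T L) (covers : ∀ y → 𝐕.Covered T y) where
    open Extra (extras tree covers (allFin (#E G)))

    cells : List (Cell G)
    cells = map inj₁ T ++ map inj₂ extra

    -- Adding |V|, the sum of the orbit sizes over T, turns the truncated differences into |T|n. One
    -- of these |T| copies of n remains; the other |T| - 1 are the sizes of the free orbits of the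
    -- tree edges, which complete the orbits of the extra edges to |E|.
    cells-weight : ∀ {h} → #E G ≡ #V G + h → W.weight cells ≡ n + h
    cells-weight {h} euler = ℕₚ.+-cancelʳ-≡ (#V G) (W.weight cells) (n + h) (begin
      W.weight cells + #V G
        ≡⟨ cong₂ _+_ (trans (additive-++ cellWeight W.weight refl (λ _ _ → refl) (map inj₁ T) (map inj₂ extra))
                            (cong (wT +_) (edge-weights extra)))
                     (sym (𝐕.totalSize-transversal (tree-independent tree) covers)) ⟩
      wT + sX + sT            ≡⟨ ℕₚ.+-assoc wT sX sT ⟩
      wT + (sX + sT)          ≡⟨ cong (wT +_) (ℕₚ.+-comm sX sT) ⟩
      wT + (sT + sX)          ≡⟨ sym (ℕₚ.+-assoc wT sT sX) ⟩
      wT + sT + sX            ≡⟨ cong (_+ sX) (trans (vertex-weights T) (cong (_* n) (tree-length tree))) ⟩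
      n + length L * n + sX   ≡⟨ ℕₚ.+-assoc n (length L * n) sX ⟩
      n + (length L * n + sX) ≡⟨ cong (n +_) (ℕₚ.+-comm (length L * n) sX) ⟩
      n + (sX + length L * n) ≡⟨ cong (λ k → n + (sX + k)) (sym (tree-totalSize tree)) ⟩
      n + (sX + 𝐄.totalSize L)
        ≡⟨ cong (n +_) (sym (additive-++ 𝐄.orbitSize 𝐄.totalSize refl (λ _ _ → refl) extra L)) ⟩
      n + 𝐄.totalSize (extra ++ L)
        ≡⟨ cong (n +_) (𝐄.totalSize-transversal independent (λ e → complete (∈-allFin e))) ⟩
      n + #E G                ≡⟨ cong (n +_) (trans euler (ℕₚ.+-comm (#V G) h)) ⟩
      n + (h + #V G)          ≡⟨ sym (ℕₚ.+-assoc n h (#V G)) ⟩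
      n + h + #V G            ∎)
      where
      open ≡-Reasoning
      wT = W.weight (map inj₁ T)
      sT = 𝐕.totalSize T
      sX = 𝐄.totalSize extra

    module Generation (s : Cell G) (x : Vertex G) (stab-s : Stab₂ s) (stab-x : 𝐕.stabilizerSize x ≡ 3)
                      (classified : All (λ c → Stab₀ c ⊎ c ≡ s ⊎ c ≡ inj₁ x) cells) where

      stabilizes-ε : ∀ c → stabilizes c ε
      stabilizes-ε (inj₁ y) = 𝐕.stabilizer-ε y
      stabilizes-ε (inj₂ e) = 𝐄.stabilizer-ε e

      stabilizes-∙ : ∀ c {γ δ} → stabilizes c γ → stabilizes c δ → stabilizes c (γ ∙ δ)
      stabilizes-∙ (inj₁ y) = 𝐕.stabilizer-∙
      stabilizes-∙ (inj₂ e) = 𝐄.stabilizer-∙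

      two = order-two Γ (stabilizes? s) (stabilizes-ε s) (stabilizes-∙ s) stab-s
      three = order-three Γ (𝐕.stabilizer? x) (𝐕.stabilizer-ε x) 𝐕.stabilizer-∙ stab-x

      τ σ : Fin n
      τ = proj₁ two
      σ = proj₁ three

      Step : Fin n → Fin n → Set
      Step γ δ = δ ≡ γ ∙ σ ⊎ δ ≡ γ ∙ τ

      Reached : Fin n → Set
      Reached = Star Step ε

      -- Quantifying over the starting point makes products immediate, whereas composing two paths
      -- from ε would require translating one of them.
      Generated : Fin n → Set
      Generated δ = ∀ {γ} → Reached γ → Reached (γ ∙ δ)

      generated-ε : Generated ε
      generated-ε r = subst Reached (sym (identityʳ _)) r

      generated-σ : Generated σ
      generated-σ r = r ◅◅ (inj₁ refl ◅ Star.ε)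

      generated-τ : Generated τ
      generated-τ r = r ◅◅ (inj₂ refl ◅ Star.ε)

      generated-∙ : ∀ {γ δ} → Generated γ → Generated δ → Generated (γ ∙ δ)
      generated-∙ {γ} {δ} g h {β} r = subst Reached (assoc β γ δ) (h (g r))

      generated-two : ∀ {γ} → stabilizes s γ → Generated γ
      generated-two st with proj₂ (proj₂ (proj₂ (proj₂ two))) st
      ... | inj₁ refl = generated-ε
      ... | inj₂ refl = generated-τ

      generated-three : ∀ {γ} → γ 𝐕.▹ x ≡ x → Generated γ
      generated-three st with proj₂ (proj₂ (proj₂ (proj₂ three))) st
      ... | inj₁ refl        = generated-ε
      ... | inj₂ (inj₁ refl) = generated-σ
      ... | inj₂ (inj₂ refl) = generated-∙ generated-σ generated-σ

      stabilizer-generated : ∀ {t γ} → t ∈ T → γ 𝐕.▹ t ≡ t → Generated γ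
      stabilizer-generated {t} t∈ st
        with All.lookup classified (∈-++⁺ˡ (∈-map⁺ inj₁ t∈))
      ... | inj₁ (_ , refl , size) = subst Generated
        (count≤1⇒≡ (𝐕.stabilizer? t) (ℕₚ.≤-reflexive size) (𝐕.stabilizer-ε t) st) generated-ε
      ... | inj₂ (inj₁ refl)       = generated-two st
      ... | inj₂ (inj₂ refl)       = generated-three st

      -- As T is a transversal, δt ∈ T forces δt = t.
      return-generated : ∀ {t t′ δ} → t ∈ T → t′ ∈ T → δ 𝐕.▹ t′ ≡ t → t ≡ t′ × Generated δ
      return-generated {δ = δ} t∈ t′∈ p
        with independent-injective (tree-independent tree) t′∈ t∈ (δ , p)
      ... | refl = refl , stabilizer-generated t∈ p

      Neighbour : Vertex G → Set
      Neighbour z = ∃[ δ ] ∃[ t′ ] t′ ∈ T × Generated δ × δ 𝐕.▹ t′ ≡ z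

      -- If f is the translate by δ of a tree edge, the tree vertex sent to t equals t, so δ
      -- stabilizes it. Otherwise f is a translate of an extra edge, which by `classified` can only
      -- be `s`; then τ interchanges its ends, which are therefore t₁ and τt₁.
      neighbour : ∀ {f t z} → t ∈ T → HasEnds G f t z → Neighbour z
      neighbour {f} {t} {z} t∈ h with find (complete {f} (∈-allFin f))
      ... | e , e∈ , δ , δe≡f with ∈-++⁻ extra e∈
      ... | inj₂ e∈L with tree-ends tree e∈L
      ... | t₁ , t₂ , t₁∈ , t₂∈ , k
        with Incident-cases {G} (HasEnds-move δe≡f k) (HasEnds⇒Incidentˡ {G} {y = z} h)
      ... | inj₁ t≡ = δ , t₂ , t₂∈ , proj₂ (return-generated t∈ t₁∈ (sym t≡)) ,
        HasEnds-unique {G} {f} {t} (subst (λ u → HasEnds G f u (δ 𝐕.▹ t₂)) (sym t≡) (HasEnds-move δe≡f k)) h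
      ... | inj₂ t≡ = δ , t₁ , t₁∈ , proj₂ (return-generated t∈ t₂∈ (sym t≡)) ,
        HasEnds-unique {G} {f} {t} (subst (λ u → HasEnds G f u (δ 𝐕.▹ t₁)) (sym t≡)
          (HasEnds-sym {G} {f} {δ 𝐕.▹ t₁} (HasEnds-move δe≡f k))) h
      neighbour {f} {t} {z} t∈ h | e , e∈ , δ , δe≡f | inj₁ e∈X
        with All.lookup classified (∈-++⁺ʳ (map inj₁ T) (∈-map⁺ inj₂ e∈X)) | attached e∈X
      ... | inj₂ (inj₁ refl) | t₁ , t₁∈ , inc =
        flip-neighbour (Incident-cases {G} moved (HasEnds⇒Incidentˡ {G} {y = z} h))
        where
        τe≡e : τ 𝐄.▹ e ≡ e
        τe≡e = proj₁ (proj₂ two)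

        τ≢ε : τ ≢ ε
        τ≢ε = proj₁ (proj₂ (proj₂ two))

        ττ≡ε : τ ∙ τ ≡ ε
        ττ≡ε = proj₁ (proj₂ (proj₂ (proj₂ two)))

        far = other-end {G} inc

        h₁ : HasEnds G e t₁ (τ 𝐕.▹ t₁)
        h₁ with stabilized-end (proj₂ far) τe≡e
        ... | inj₁ fixed = contradiction (flag-free inc fixed τe≡e) τ≢ε
        ... | inj₂ eq    = subst (HasEnds G e t₁) (sym eq) (proj₂ far)

        moved : HasEnds G f (δ 𝐕.▹ t₁) ((δ ∙ τ) 𝐕.▹ t₁)
        moved = subst (HasEnds G f (δ 𝐕.▹ t₁)) (sym (𝐕.▹-∙ δ τ t₁)) (HasEnds-move δe≡f h₁)

        flip-neighbour : t ≡ δ 𝐕.▹ t₁ ⊎ t ≡ (δ ∙ τ) 𝐕.▹ t₁ → Neighbour z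
        flip-neighbour (inj₁ t≡) = δ ∙ τ , t₁ , t₁∈ ,
          generated-∙ (proj₂ (return-generated t∈ t₁∈ (sym t≡))) generated-τ ,
          HasEnds-unique {G} {f} {t} (subst (λ u → HasEnds G f u ((δ ∙ τ) 𝐕.▹ t₁)) (sym t≡) moved) h
        -- Here it is δτ that returns into T and so is generated; one more factor τ recovers δ.
        flip-neighbour (inj₂ t≡) = δ , t₁ , t₁∈ ,
          subst Generated (trans (assoc δ τ τ) (trans (cong (δ ∙_) ττ≡ε) (identityʳ δ)))
            (generated-∙ (proj₂ (return-generated t∈ t₁∈ (sym t≡))) generated-τ) ,
          HasEnds-unique {G} {f} {t} (subst (λ u → HasEnds G f u (δ 𝐕.▹ t₁)) (sym t≡)
            (HasEnds-sym {G} {f} {δ 𝐕.▹ t₁} moved)) h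

      Visited : Vertex G → Set
      Visited y = ∃[ γ ] ∃[ t ] t ∈ T × Reached γ × γ 𝐕.▹ t ≡ y

      visited-step : ∀ {y z} → Adjacent G y z → Visited y → Visited z
      visited-step {z = z} (f , h) (γ , t , t∈ , r , refl) =
        γ ∙ δ , t′ , t′∈ , g r , trans (𝐕.▹-∙ γ δ t′) (trans (cong (γ 𝐕.▹_) p) (𝐕.▹-⁻¹ʳ γ z))
        where
        nb = neighbour t∈ (subst (λ w → HasEnds G (γ ⁻¹ 𝐄.▹ f) w (γ ⁻¹ 𝐕.▹ z)) (𝐕.▹-⁻¹ˡ γ t)
                                 (▹-ends (γ ⁻¹) h))
        δ = proj₁ nb
        t′ = proj₁ (proj₂ nb)
        t′∈ = proj₁ (proj₂ (proj₂ nb))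
        g = proj₁ (proj₂ (proj₂ (proj₂ nb)))
        p = proj₂ (proj₂ (proj₂ (proj₂ nb)))

      -- By connectedness δx₀ = γt with γ reached and t in T. Since T meets each orbit once, t = x₀
      -- and γ⁻¹δ lies in a stabilizer, which is generated.
      reached : ∀ {x₀} → x₀ ∈ T → ∀ δ → Reached δ
      reached {x₀} x₀∈ δ with Star-invariant visited-step (connected G x₀ (δ 𝐕.▹ x₀))
                                (ε , x₀ , x₀∈ , Star.ε , 𝐕.▹-ε x₀)
      ... | γ , t , t∈ , r , p =
        subst Reached (\\-leftDividesˡ γ δ) (proj₂ (return-generated t∈ x₀∈ back) r)
        where
        back : (γ ⁻¹ ∙ δ) 𝐕.▹ x₀ ≡ t
        back = trans (𝐕.▹-∙ (γ ⁻¹) δ x₀) (𝐕.▹-move p)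

      twoThreeGenerated : TwoThreeGenerated n
      twoThreeGenerated with find (covers x)
      ... | t , t∈ , _ = record
        { Γ = Γ ; σ = σ ; τ = τ
        ; σ≢ε = proj₁ (proj₂ (proj₂ three))
        ; τ≢ε = proj₁ (proj₂ (proj₂ two))
        ; σ³≡ε = proj₁ (proj₂ (proj₂ (proj₂ three)))
        ; τ²≡ε = proj₁ (proj₂ (proj₂ (proj₂ two)))
        ; generated = reached t∈ }

  flagFree-bound : ∀ {h} → 1 ≤ h → #E G ≡ #V G + h → n ≤ 4 * h ⊎ (n ≡ 6 * h × TwoThreeGenerated n)
  flagFree-bound 1≤h euler with spanningTree
  ... | T , L , tree , covers
    with W.excess kind (Spanned.cells tree covers) positive 1≤h (Spanned.cells-weight tree covers euler)
  ... | inj₁ le = inj₁ le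
  ... | inj₂ (eq , s , _ , stab-s , (x , refl , stab-x) , classified) =
    inj₂ (eq , Spanned.Generation.twoThreeGenerated tree covers s x stab-s stab-x classified)

harmonic-bound : ∀ {h n} → 1 ≤ h → HarmonicGroupOrder (suc h) n →
                 n ≤ 4 * h ⊎ (n ≡ 6 * h × TwoThreeGenerated n)
harmonic-bound {h} 1≤h (G , genus≡ , Γ , harmonically , refl) =
  FlagFreeBound.flagFree-bound (flagFreeAction G Γ harmonically) 1≤h euler
  where
  open ≡-Reasoning
  v = ℤ.+ #V G
  e = ℤ.+ #E G

  euler : #E G ≡ #V G + h
  euler = ℕₚ.suc-injective (ℤₚ.+-injective (begin
    ℤ.+ suc (#E G)              ≡⟨ cong ℤ.+_ (ℕₚ.+-comm 1 (#E G)) ⟩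
    e ℤ.+ ℤ.+ 1                 ≡⟨ cong (ℤ._+ ℤ.+ 1) (sym (ℤₚ.+-identityʳ e)) ⟩
    e ℤ.+ ℤ.+ 0 ℤ.+ ℤ.+ 1       ≡⟨ cong (λ k → e ℤ.+ k ℤ.+ ℤ.+ 1) (sym (ℤₚ.+-inverseˡ v)) ⟩
    e ℤ.+ (ℤ.- v ℤ.+ v) ℤ.+ ℤ.+ 1 ≡⟨ cong (ℤ._+ ℤ.+ 1) (sym (ℤₚ.+-assoc e (ℤ.- v) v)) ⟩
    e ℤ.- v ℤ.+ v ℤ.+ ℤ.+ 1     ≡⟨ ℤₚ.+-assoc (e ℤ.- v) v (ℤ.+ 1) ⟩
    e ℤ.- v ℤ.+ (v ℤ.+ ℤ.+ 1)   ≡⟨ cong (ℤ._+_ (e ℤ.- v)) (ℤₚ.+-comm v (ℤ.+ 1)) ⟩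
    e ℤ.- v ℤ.+ (ℤ.+ 1 ℤ.+ v)   ≡⟨ sym (ℤₚ.+-assoc (e ℤ.- v) (ℤ.+ 1) v) ⟩
    genus G ℤ.+ v               ≡⟨ cong (ℤ._+ v) genus≡ ⟩
    ℤ.+ suc (h + #V G)          ≡⟨ cong (λ k → ℤ.+ suc k) (ℕₚ.+-comm h (#V G)) ⟩
    ℤ.+ suc (#V G + h)          ∎))

-- Coset graphs

record Subgroup {n} (Γ : FinGroup n) (r : ℕ) : Set where
  open FinGroup Γ
  field
    element           : Fin r → Fin n
    element-injective : ∀ {k l} → element k ≡ element l → k ≡ l

  Member : Fin n → Set
  Member γ = ∃[ k ] element k ≡ γ

  field
    ε-member  : Member ε
    ∙-member  : ∀ k l → Member (element k ∙ element l)
    ⁻¹-member : ∀ k → Member (element k ⁻¹)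

module Cosets {n} {Γ : FinGroup n} {r} (H : Subgroup Γ r) where
  open FinGroup Γ
  open Subgroup H

  SameCoset : Fin n → Fin n → Set
  SameCoset i j = Member (i ⁻¹ ∙ j)

  sameCoset-∙ : ∀ i k → SameCoset i (i ∙ element k)
  sameCoset-∙ i k = k , sym (\\-leftDividesʳ i (element k))

  cosets : DecSetoid 0ℓ 0ℓ
  cosets = record
    { Carrier = Fin n
    ; _≈_ = SameCoset
    ; isDecEquivalence = record
      { isEquivalence = record
        { refl  = λ {i} → subst Member (sym (inverseˡ i)) ε-member
        ; sym   = λ {i} {j} (k , p) → subst Member
            (trans (cong _⁻¹ p) (trans (⁻¹-anti-homo-∙ (i ⁻¹) j) (cong (j ⁻¹ ∙_) (⁻¹-involutive i))))
            (⁻¹-member k)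
        ; trans = λ {i} {j} {k} (a , p) (b , q) → subst Member
            (trans (cong₂ _∙_ p q) (trans (assoc (i ⁻¹) j (j ⁻¹ ∙ k)) (cong (i ⁻¹ ∙_) (\\-leftDividesˡ j k))))
            (∙-member a b)
        }
      ; _≟_ = λ i j → any? (λ k → element k Finₚ.≟ i ⁻¹ ∙ j)
      }
    }

  open Classes cosets (allFin n)

  index : ℕ
  index = #classes

  coset : Fin n → Fin index
  coset i = class (∈-allFin i)

  coset-rep : ∀ c → coset (rep c) ≡ c
  coset-rep c = class-surjective c (∈-allFin (rep c))

  coset-cong : ∀ {i j} → SameCoset i j → coset i ≡ coset j
  coset-cong = class-cong (∈-allFin _) (∈-allFin _)

  coset-∙ : ∀ {i j} k → coset i ≡ coset j → coset (k ∙ i) ≡ coset (k ∙ j)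
  coset-∙ {i} {j} k eq = coset-cong (subst Member (sym cancel)
    (class-injective (∈-allFin i) (∈-allFin j) eq))
    where
    cancel : (k ∙ i) ⁻¹ ∙ (k ∙ j) ≡ i ⁻¹ ∙ j
    cancel = trans (cong (_∙ (k ∙ j)) (⁻¹-anti-homo-∙ k i))
      (trans (assoc (i ⁻¹) (k ⁻¹) (k ∙ j)) (cong (i ⁻¹ ∙_) (\\-leftDividesʳ k j)))

  lagrange : index * r ≡ n
  lagrange = ×-bijection⇒≡ (λ c k → rep c ∙ element k) injective surjective
    where
    coset-f : ∀ c k → coset (rep c ∙ element k) ≡ c
    coset-f c k = trans (sym (coset-cong (sameCoset-∙ (rep c) k))) (coset-rep c)

    injective : ∀ {c k d l} → rep c ∙ element k ≡ rep d ∙ element l → c ≡ d × k ≡ l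
    injective {c} {k} {d} {l} eq
      with trans (sym (coset-f c k)) (trans (cong coset eq) (coset-f d l))
    ... | refl = refl , element-injective (∙-cancelˡ (rep c) _ _ eq)

    surjective : ∀ γ → ∃[ c ] ∃[ k ] rep c ∙ element k ≡ γ
    surjective γ with class-injective (∈-allFin (rep (coset γ))) (∈-allFin γ) (coset-rep (coset γ))
    ... | k , p = coset γ , k , trans (cong (rep (coset γ) ∙_) p) (\\-leftDividesˡ (rep (coset γ)) γ)

module _ {n a b} {Γ : FinGroup n} (H : Subgroup Γ a) (K : Subgroup Γ b) where
  open FinGroup Γ
  private
    module H = Cosets H
    module K = Cosets K

  Move : Fin n → Fin n → Set
  Move γ δ = (∃[ k ] δ ≡ γ ∙ Subgroup.element H k) ⊎ (∃[ k ] δ ≡ γ ∙ Subgroup.element K k)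

  -- Edge i joins the cosets iH and iK, so two edges share an end exactly when they differ by an
  -- element of H or of K, and generation becomes connectedness. The graph is the quotient of the
  -- Bass-Serre tree of the free product of H and K by the kernel of its map to Γ.
  cosetModel : (∀ γ → Star Move ε γ) → BipartiteModel n (H.index + K.index)
  cosetModel generated = record
    { Γ = Γ
    ; end = end′
    ; end-disjoint = λ i j eq → case
        trans (sym (Finₚ.splitAt-↑ˡ H.index (H.coset i) K.index))
          (trans (cong (splitAt H.index) eq) (Finₚ.splitAt-↑ʳ H.index K.index (K.coset j))) of λ ()
    ; end-surjective = λ x → surjective x (splitAt H.index x) (Finₚ.join-splitAt H.index K.index x)
    ; end-∙ = λ { false {i} {j} k eq → cong (_↑ˡ K.index) (H.coset-∙ k (Finₚ.↑ˡ-injective K.index _ _ eq))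
                ; true {i} {j} k eq → cong (H.index ↑ʳ_) (K.coset-∙ k (Finₚ.↑ʳ-injective H.index _ _ eq)) }
    ; connected′ = λ i j → subst₂ (Star Share) (identityʳ i) (\\-leftDividesˡ i j)
        (Star.gmap (i ∙_) (λ {γ} {δ} → share i γ δ) (generated (i ⁻¹ ∙ j)))
    }
    where
    end′ : Bool → Fin n → Fin (H.index + K.index)
    end′ false i = H.coset i ↑ˡ K.index
    end′ true  i = H.index ↑ʳ K.coset i

    Share : Fin n → Fin n → Set
    Share i j = ∃[ c ] end′ c i ≡ end′ c j

    surjective : ∀ x s → join H.index K.index s ≡ x → ∃[ c ] ∃[ i ] end′ c i ≡ x
    surjective x (inj₁ y) eq = false , _ , trans (cong (_↑ˡ K.index) (H.coset-rep y)) eq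
    surjective x (inj₂ y) eq = true , _ , trans (cong (H.index ↑ʳ_) (K.coset-rep y)) eq

    share : ∀ i γ δ → Move γ δ → Share (i ∙ γ) (i ∙ δ)
    share i γ δ (inj₁ (k , refl)) = false , cong (_↑ˡ K.index)
      (H.coset-∙ i (H.coset-cong (H.sameCoset-∙ γ k)))
    share i γ δ (inj₂ (k , refl)) = true , cong (H.index ↑ʳ_)
      (K.coset-∙ i (K.coset-cong (K.sameCoset-∙ γ k)))

module _ {n} (Γ : FinGroup n) where
  open FinGroup Γ

  involution-subgroup : ∀ τ → τ ≢ ε → τ ∙ τ ≡ ε → Subgroup Γ 2
  involution-subgroup τ τ≢ε τ²≡ε = record
    { element = element
    ; element-injective = injective _ _
    ; ε-member = zero , refl
    ; ∙-member = mul
    ; ⁻¹-member = λ { zero → zero , sym ε⁻¹≈ε ; (suc zero) → suc zero , inverseˡ-unique τ τ τ²≡ε }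
    }
    where
    element : Fin 2 → Fin n
    element zero       = ε
    element (suc zero) = τ

    injective : ∀ k l → element k ≡ element l → k ≡ l
    injective zero       zero       _  = refl
    injective zero       (suc zero) eq = contradiction (sym eq) τ≢ε
    injective (suc zero) zero       eq = contradiction eq τ≢ε
    injective (suc zero) (suc zero) _  = refl

    mul : ∀ k l → ∃[ m ] element m ≡ element k ∙ element l
    mul zero       l          = l , sym (identityˡ _)
    mul (suc zero) zero       = suc zero , sym (identityʳ τ)
    mul (suc zero) (suc zero) = zero , sym τ²≡ε

  order-three-subgroup : ∀ σ → σ ≢ ε → σ ∙ σ ∙ σ ≡ ε → Subgroup Γ 3
  order-three-subgroup σ σ≢ε σ³≡ε = record
    { element = element
    ; element-injective = injective _ _
    ; ε-member = zero , refl
    ; ∙-member = mul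
    ; ⁻¹-member = λ
        { zero             → zero , sym ε⁻¹≈ε
        ; (suc zero)       → suc (suc zero) , inverseˡ-unique (σ ∙ σ) σ σ³≡ε
        ; (suc (suc zero)) → suc zero , inverseˡ-unique σ (σ ∙ σ) σσσ≡ε }
    }
    where
    σσσ≡ε : σ ∙ (σ ∙ σ) ≡ ε
    σσσ≡ε = trans (sym (assoc σ σ σ)) σ³≡ε

    element : Fin 3 → Fin n
    element zero             = ε
    element (suc zero)       = σ
    element (suc (suc zero)) = σ ∙ σ

    σσ≢ε : σ ∙ σ ≢ ε
    σσ≢ε eq = σ≢ε (trans (sym (identityʳ σ)) (trans (cong (σ ∙_) (sym eq)) σσσ≡ε))

    σ≢σσ : σ ≢ σ ∙ σ
    σ≢σσ eq = σ≢ε (identityʳ-unique σ σ (sym eq))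

    injective : ∀ k l → element k ≡ element l → k ≡ l
    injective zero             zero             _  = refl
    injective zero             (suc zero)       eq = contradiction (sym eq) σ≢ε
    injective zero             (suc (suc zero)) eq = contradiction (sym eq) σσ≢ε
    injective (suc zero)       zero             eq = contradiction eq σ≢ε
    injective (suc zero)       (suc zero)       _  = refl
    injective (suc zero)       (suc (suc zero)) eq = contradiction eq σ≢σσ
    injective (suc (suc zero)) zero             eq = contradiction eq σσ≢ε
    injective (suc (suc zero)) (suc zero)       eq = contradiction (sym eq) σ≢σσ
    injective (suc (suc zero)) (suc (suc zero)) _  = refl

    mul : ∀ k l → ∃[ m ] element m ≡ element k ∙ element l
    mul zero             l                = l , sym (identityˡ _)
    mul k@(suc _)        zero             = k , sym (identityʳ _)
    mul (suc zero)       (suc zero)       = suc (suc zero) , refl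
    mul (suc zero)       (suc (suc zero)) = zero , sym σσσ≡ε
    mul (suc (suc zero)) (suc zero)       = zero , sym σ³≡ε
    mul (suc (suc zero)) (suc (suc zero)) =
      suc zero , sym (trans (assoc σ σ (σ ∙ σ)) (trans (cong (σ ∙_) σσσ≡ε) (identityʳ σ)))

-- There are 2h cosets of ⟨σ⟩, 3h cosets of ⟨τ⟩ and 6h edges, so the genus is 6h - 5h + 1.
twoThreeGenerated⇒harmonic : ∀ {h} → TwoThreeGenerated (6 * h) → HarmonicGroupOrder (suc h) (6 * h)
twoThreeGenerated⇒harmonic {h} X =
  ModelGraph.harmonicGroupOrder (cosetModel H K reach) (suc h) (begin
    suc (6 * h)                               ≡⟨ sym (ℕₚ.+-comm (6 * h) 1) ⟩
    6 * h + 1                                 ≡⟨ cong (_+ 1) (ℕₚ.*-distribʳ-+ h 5 1) ⟩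
    5 * h + 1 * h + 1                         ≡⟨ cong (λ k → 5 * h + k + 1) (ℕₚ.*-identityˡ h) ⟩
    5 * h + h + 1                             ≡⟨ ℕₚ.+-assoc (5 * h) h 1 ⟩
    5 * h + (h + 1)                           ≡⟨ cong₂ _+_ (ℕₚ.*-distribʳ-+ h 2 3) (ℕₚ.+-comm h 1) ⟩
    2 * h + 3 * h + suc h                     ≡⟨ cong (_+ suc h) (sym (cong₂ _+_ index-H index-K)) ⟩
    Cosets.index H + Cosets.index K + suc h   ∎)
  where
  open TwoThreeGenerated X
  open ≡-Reasoning

  H = order-three-subgroup Γ σ σ≢ε σ³≡ε
  K = involution-subgroup Γ τ τ≢ε τ²≡ε

  reach : ∀ γ → Star (Move H K) ε γ
  reach γ = Star.map (Sum.map (suc zero ,_) (suc zero ,_)) (generated γ)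

  index-H : Cosets.index H ≡ 2 * h
  index-H = ℕₚ.*-cancelʳ-≡ (Cosets.index H) (2 * h) 3
    (trans (Cosets.lagrange H) (trans (ℕₚ.*-assoc 3 2 h) (ℕₚ.*-comm 3 (2 * h))))

  index-K : Cosets.index K ≡ 3 * h
  index-K = ℕₚ.*-cancelʳ-≡ (Cosets.index K) (3 * h) 2
    (trans (Cosets.lagrange K) (trans (ℕₚ.*-assoc 2 3 h) (ℕₚ.*-comm 2 (3 * h))))

-- Deciding whether some group of order n is (2,3)-generated

Exhaustible : Set → Set₁
Exhaustible A = ∀ {P : A → Set} → Decidable P → Dec (∃ P)

exhaust-Vec : ∀ {A} → Exhaustible A → ∀ k → Exhaustible (Vec A k)
exhaust-Vec ex zero    P? = map′ (Vec.[] ,_) (λ { (Vec.[] , p) → p }) (P? Vec.[])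
exhaust-Vec ex (suc k) P? = map′ (λ (x , xs , p) → x Vec.∷ xs , p) (λ { (x Vec.∷ xs , p) → x , xs , p })
  (ex (λ x → exhaust-Vec ex k (λ xs → P? (x Vec.∷ xs))))

module _ {n : ℕ} where

  Generators : (op : Fin n → Fin n → Fin n) (e σ τ : Fin n) → Set
  Generators op e σ τ = σ ≢ e × τ ≢ e × op (op σ σ) σ ≡ e × op τ τ ≡ e ×
    (∀ γ → Star (λ i j → j ≡ op i σ ⊎ j ≡ op i τ) e γ)

  GroupLaws : (op : Fin n → Fin n → Fin n) (e : Fin n) (inv : Fin n → Fin n) → Set
  GroupLaws op e inv = (∀ i j k → op (op i j) k ≡ op i (op j k)) ×
    (∀ i → op e i ≡ i) × (∀ i → op i e ≡ i) × (∀ i → op (inv i) i ≡ e) × (∀ i → op i (inv i) ≡ e)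

  generators? : ∀ op e σ τ → Dec (Generators op e σ τ)
  generators? op e σ τ =
    ¬? (σ Finₚ.≟ e) ×-dec ¬? (τ Finₚ.≟ e) ×-dec (op (op σ σ) σ Finₚ.≟ e) ×-dec (op τ τ Finₚ.≟ e) ×-dec
    all? (Reachability.star? (λ i j → (j Finₚ.≟ op i σ) ⊎-dec (j Finₚ.≟ op i τ)) e)

  groupLaws? : ∀ op e inv → Dec (GroupLaws op e inv)
  groupLaws? op e inv =
    all? (λ i → all? λ j → all? λ k → op (op i j) k Finₚ.≟ op i (op j k)) ×-dec
    all? (λ i → op e i Finₚ.≟ i) ×-dec all? (λ i → op i e Finₚ.≟ i) ×-dec
    all? (λ i → op (inv i) i Finₚ.≟ e) ×-dec all? (λ i → op i (inv i) Finₚ.≟ e)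

  -- Cayley tables as vectors can be searched exhaustively, unlike binary functions up to
  -- definitional equality; `⇒tabulated` passes from a group to its table, with which the operation
  -- agrees pointwise.
  Table : Set
  Table = Vec (Vec (Fin n) n) n

  apply-table : Table → Fin n → Fin n → Fin n
  apply-table t i j = Vec.lookup (Vec.lookup t i) j

  Tabulated : Set
  Tabulated = ∃[ t ] ∃[ inv ] ∃[ e ] ∃[ σ ] ∃[ τ ]
    (GroupLaws (apply-table t) e (Vec.lookup {n = n} inv) × Generators (apply-table t) e σ τ)

  tabulated? : Dec Tabulated
  tabulated? = exhaust-Vec (exhaust-Vec any? n) n λ t → exhaust-Vec any? n λ inv →
    any? λ e → any? λ σ → any? λ τ →
    groupLaws? (apply-table t) e (Vec.lookup inv) ×-dec generators? (apply-table t) e σ τ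

  tabulated⇒ : Tabulated → TwoThreeGenerated n
  tabulated⇒ (t , inv , e , σ , τ , (ass , idˡ , idʳ , invˡ , invʳ) , (σ≢ , τ≢ , σ³ , τ² , gen)) = record
    { Γ = record
      { _∙_ = apply-table t ; ε = e ; _⁻¹ = Vec.lookup inv
      ; isGroup = record
        { isMonoid = record
          { isSemigroup = record
            { isMagma = record
              { isEquivalence = isEquivalence
              ; ∙-cong = cong₂ (apply-table t) }
            ; assoc = ass }
          ; identity = idˡ , idʳ }
        ; inverse = invˡ , invʳ
        ; ⁻¹-cong = cong (Vec.lookup inv) } }
    ; σ = σ ; τ = τ ; σ≢ε = σ≢ ; τ≢ε = τ≢ ; σ³≡ε = σ³ ; τ²≡ε = τ² ; generated = gen }

  ⇒tabulated : TwoThreeGenerated n → Tabulated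
  ⇒tabulated X = t , Vec.tabulate _⁻¹ , ε , σ , τ ,
      ( (λ i j k → trans (op≡ _ k) (trans (cong (_∙ k) (op≡ i j)) (trans (assoc i j k)
          (trans (cong (i ∙_) (sym (op≡ j k))) (sym (op≡ i _))))))
      , (λ i → trans (op≡ ε i) (identityˡ i))
      , (λ i → trans (op≡ i ε) (identityʳ i))
      , (λ i → trans (op≡ _ i) (trans (cong (_∙ i) (inv≡ i)) (inverseˡ i)))
      , (λ i → trans (op≡ i _) (trans (cong (i ∙_) (inv≡ i)) (inverseʳ i))) ) ,
      ( σ≢ε , τ≢ε
      , trans (op≡ _ σ) (trans (cong (_∙ σ) (op≡ σ σ)) σ³≡ε)
      , trans (op≡ τ τ) τ²≡ε
      , λ γ → Star.map (λ {i} → Sum.map (λ p → trans p (sym (op≡ i σ))) (λ p → trans p (sym (op≡ i τ))))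
                (generated γ) )
    where
    open TwoThreeGenerated X

    t : Table
    t = Vec.tabulate (λ i → Vec.tabulate (λ j → i ∙ j))

    op≡ : ∀ i j → apply-table t i j ≡ i ∙ j
    op≡ i j = trans (cong (λ v → Vec.lookup v j) (Vecₚ.lookup∘tabulate (λ i → Vec.tabulate (λ j → i ∙ j)) i))
                    (Vecₚ.lookup∘tabulate (λ j → i ∙ j) j)

    inv≡ : ∀ i → Vec.lookup (Vec.tabulate _⁻¹) i ≡ i ⁻¹
    inv≡ = Vecₚ.lookup∘tabulate _⁻¹

twoThreeGenerated? : ∀ n → Dec (TwoThreeGenerated n)
twoThreeGenerated? n = map′ tabulated⇒ ⇒tabulated tabulated?

-- Integers modulo N and the groups ℤ/N ⋊ ℤ/K

module Congruence (N : ℕ) where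
  infix 4 _≋_
  -- Congruence modulo N with the quotient kept as data, so that a congruence is proved by an
  -- identity of integers, usually left to the ring solver.
  record _≋_ (a b : ℤ) : Set where
    constructor mod
    field
      factor   : ℤ
      equation : a ≡ b ℤ.+ factor ℤ.* ℤ.+ N

  ≋-reflexive : ∀ {a b} → a ≡ b → a ≋ b
  ≋-reflexive {a} refl = mod (ℤ.+ 0) (lemma a (ℤ.+ N))
    where
    lemma : ∀ a n → a ≡ a ℤ.+ ℤ.+ 0 ℤ.* n
    lemma = solve-∀

  ≋-refl : ∀ {a} → a ≋ a
  ≋-refl = ≋-reflexive refl

  ≋-sym : ∀ {a b} → a ≋ b → b ≋ a
  ≋-sym {a} {b} (mod q p) =
    mod (ℤ.- q) (trans (lemma b q (ℤ.+ N)) (cong (ℤ._+ (ℤ.- q) ℤ.* ℤ.+ N) (sym p)))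
    where
    lemma : ∀ b q n → b ≡ b ℤ.+ q ℤ.* n ℤ.+ (ℤ.- q) ℤ.* n
    lemma = solve-∀

  ≋-trans : ∀ {a b c} → a ≋ b → b ≋ c → a ≋ c
  ≋-trans {c = c} (mod q refl) (mod r refl) = mod (q ℤ.+ r) (lemma c q r (ℤ.+ N))
    where
    lemma : ∀ c q r n → c ℤ.+ r ℤ.* n ℤ.+ q ℤ.* n ≡ c ℤ.+ (q ℤ.+ r) ℤ.* n
    lemma = solve-∀

  ≋-+ : ∀ {a b c d} → a ≋ b → c ≋ d → a ℤ.+ c ≋ b ℤ.+ d
  ≋-+ {b = b} {d = d} (mod q refl) (mod r refl) = mod (q ℤ.+ r) (lemma b d q r (ℤ.+ N))
    where
    lemma : ∀ b d q r n → (b ℤ.+ q ℤ.* n) ℤ.+ (d ℤ.+ r ℤ.* n) ≡ b ℤ.+ d ℤ.+ (q ℤ.+ r) ℤ.* n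
    lemma = solve-∀

  ≋-* : ∀ {a b c d} → a ≋ b → c ≋ d → a ℤ.* c ≋ b ℤ.* d
  ≋-* {b = b} {d = d} (mod q refl) (mod r refl) =
    mod (b ℤ.* r ℤ.+ q ℤ.* d ℤ.+ q ℤ.* r ℤ.* ℤ.+ N) (lemma b d q r (ℤ.+ N))
    where
    lemma : ∀ b d q r n → (b ℤ.+ q ℤ.* n) ℤ.* (d ℤ.+ r ℤ.* n) ≡
            b ℤ.* d ℤ.+ (b ℤ.* r ℤ.+ q ℤ.* d ℤ.+ q ℤ.* r ℤ.* n) ℤ.* n
    lemma = solve-∀

  ≋-neg : ∀ {a b} → a ≋ b → ℤ.- a ≋ ℤ.- b
  ≋-neg {b = b} (mod q refl) = mod (ℤ.- q) (lemma b q (ℤ.+ N))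
    where
    lemma : ∀ b q n → ℤ.- (b ℤ.+ q ℤ.* n) ≡ ℤ.- b ℤ.+ (ℤ.- q) ℤ.* n
    lemma = solve-∀

  ≋⇒≡ : ∀ {r s} → r < N → s < N → ℤ.+ r ≋ ℤ.+ s → r ≡ s
  ≋⇒≡ {r} {s} r<N s<N eq = by-sign eq
    where
    too-big : ∀ r s q → ℤ.+ r ≡ ℤ.+ s ℤ.+ ℤ.+ suc q ℤ.* ℤ.+ N → N ≤ r
    too-big r s q p = subst (N ≤_)
      (sym (ℤₚ.+-injective (trans p (cong (ℤ._+_ (ℤ.+ s)) (sym (ℤₚ.pos-* (suc q) N))))))
      (ℕₚ.≤-trans (ℕₚ.m≤m+n N (q * N)) (ℕₚ.m≤n+m (suc q * N) s))

    by-sign : ℤ.+ r ≋ ℤ.+ s → r ≡ s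
    by-sign (mod (ℤ.+ zero) p)  = ℤₚ.+-injective (trans p (ℤₚ.+-identityʳ (ℤ.+ s)))
    by-sign (mod (ℤ.+ suc q) p) = contradiction r<N (ℕₚ.≤⇒≯ (too-big r s q p))
    by-sign (mod ℤ.-[1+ q ] p) =
      contradiction s<N (ℕₚ.≤⇒≯ (too-big s r q (_≋_.equation (≋-sym (mod ℤ.-[1+ q ] p)))))

  module _ .{{_ : NonZero N}} where

    residue : ℤ → Fin N
    residue a = fromℕ< (ℤDivMod.n%ℕd<d a N)

    residue-≋ : ∀ a → ℤ.+ toℕ (residue a) ≋ a
    residue-≋ a = ≋-sym (mod (a ℤDivMod./ℕ N) (trans (ℤDivMod.a≡a%ℕn+[a/ℕn]*n a N)
      (cong (λ r → ℤ.+ r ℤ.+ (a ℤDivMod./ℕ N) ℤ.* ℤ.+ N) (sym (Finₚ.toℕ-fromℕ< (ℤDivMod.n%ℕd<d a N))))))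

    toℕ-≋-injective : ∀ {i j : Fin N} → ℤ.+ toℕ i ≋ ℤ.+ toℕ j → i ≡ j
    toℕ-≋-injective {i} {j} p = Finₚ.toℕ-injective (≋⇒≡ (Finₚ.toℕ<n i) (Finₚ.toℕ<n j) p)

%-cong-+ : ∀ {i i′ j j′} K .{{_ : NonZero K}} → i % K ≡ i′ % K → j % K ≡ j′ % K →
           (i + j) % K ≡ (i′ + j′) % K
%-cong-+ {i} {i′} {j} {j′} K p q = trans (DivMod.%-distribˡ-+ i j K)
  (trans (cong₂ (λ a b → (a + b) % K) p q) (sym (DivMod.%-distribˡ-+ i′ j′ K)))

%-cong-* : ∀ {i i′ j j′} K .{{_ : NonZero K}} → i % K ≡ i′ % K → j % K ≡ j′ % K →
           (i * j) % K ≡ (i′ * j′) % K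
%-cong-* {i} {i′} {j} {j′} K p q = trans (DivMod.%-distribˡ-* i j K)
  (trans (cong₂ (λ a b → (a * b) % K) p q) (sym (DivMod.%-distribˡ-* i′ j′ K)))

module Metacyclic (N k : ℕ) .{{_ : NonZero N}} (u : ℤ)
                  (u^K≋1 : Congruence._≋_ N (u ℤ.^ suc k) (ℤ.+ 1)) where
  open Congruence N

  K : ℕ
  K = suc k

  u^[i*K]≋1 : ∀ i → u ℤ.^ (i * K) ≋ ℤ.+ 1
  u^[i*K]≋1 zero    = ≋-refl
  u^[i*K]≋1 (suc i) = ≋-trans (≋-reflexive (ℤₚ.^-distribˡ-+-* u K (i * K)))
    (≋-trans (≋-* u^K≋1 (u^[i*K]≋1 i)) ≋-refl)

  u^%≋ : ∀ i → u ℤ.^ i ≋ u ℤ.^ (i % K)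
  u^%≋ i = ≋-trans (≋-reflexive (trans (cong (u ℤ.^_) (DivMod.m≡m%n+[m/n]*n i K))
                                       (ℤₚ.^-distribˡ-+-* u (i % K) (i / K * K))))
    (≋-trans (≋-* (≋-refl {u ℤ.^ (i % K)}) (u^[i*K]≋1 (i / K))) (≋-reflexive (ℤₚ.*-identityʳ _)))

  u^-cong : ∀ {i j} → i % K ≡ j % K → u ℤ.^ i ≋ u ℤ.^ j
  u^-cong {i} {j} p = ≋-trans (u^%≋ i) (≋-trans (≋-reflexive (cong (u ℤ.^_) p)) (≋-sym (u^%≋ j)))

  -- Unreduced representatives: the reduction modulo N and K sits in the equality `_≈_`, and the
  -- multiplication is that of the affine maps x ↦ a + uⁱx.
  Pair : Set
  Pair = ℤ × ℕ

  infix 4 _≈_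
  record _≈_ (x y : Pair) : Set where
    constructor _,_
    field
      base     : proj₁ x ≋ proj₁ y
      exponent : proj₂ x % K ≡ proj₂ y % K

  infixl 7 _·_
  _·_ : Pair → Pair → Pair
  (a , i) · (b , j) = a ℤ.+ u ℤ.^ i ℤ.* b , i + j

  -- The exponent k * i stands for -i modulo K = k + 1.
  inverse : Pair → Pair
  inverse (a , i) = ℤ.- (u ℤ.^ (k * i) ℤ.* a) , k * i

  private
    ≈-refl : ∀ {x} → x ≈ x
    ≈-refl = ≋-refl , refl

    ≈-sym : ∀ {x y} → x ≈ y → y ≈ x
    ≈-sym (p , q) = ≋-sym p , sym q

    ≈-trans : ∀ {x y z} → x ≈ y → y ≈ z → x ≈ z
    ≈-trans (p , q) (r , s) = ≋-trans p r , trans q s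

    ·-cong : ∀ {x y z w} → x ≈ y → z ≈ w → x · z ≈ y · w
    ·-cong {a , i} {b , j} (p , q) (r , s) =
      ≋-+ p (≋-* (u^-cong {i} {j} q) r) , %-cong-+ {i} {j} K q s

    ·-assoc : ∀ x y z → (x · y) · z ≈ x · (y · z)
    ·-assoc (a , i) (b , j) (c , l) = ≋-reflexive (trans
        (cong (λ w → a ℤ.+ u ℤ.^ i ℤ.* b ℤ.+ w ℤ.* c) (ℤₚ.^-distribˡ-+-* u i j))
        (lemma a b c (u ℤ.^ i) (u ℤ.^ j))) , cong (_% K) (ℕₚ.+-assoc i j l)
      where
      lemma : ∀ a b c v w → a ℤ.+ v ℤ.* b ℤ.+ v ℤ.* w ℤ.* c ≡ a ℤ.+ v ℤ.* (b ℤ.+ w ℤ.* c)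
      lemma = solve-∀

    ·-identityˡ : ∀ x → (ℤ.+ 0 , 0) · x ≈ x
    ·-identityˡ (a , i) = ≋-reflexive (lemma a) , refl
      where
      lemma : ∀ a → ℤ.+ 0 ℤ.+ ℤ.+ 1 ℤ.* a ≡ a
      lemma = solve-∀

    ·-identityʳ : ∀ x → x · (ℤ.+ 0 , 0) ≈ x
    ·-identityʳ (a , i) = ≋-reflexive (lemma a (u ℤ.^ i)) , cong (_% K) (ℕₚ.+-identityʳ i)
      where
      lemma : ∀ a v → a ℤ.+ v ℤ.* ℤ.+ 0 ≡ a
      lemma = solve-∀

    total-exponent : ∀ i → i + k * i ≡ i * K
    total-exponent i = ℕₚ.*-comm K i

    ·-inverseˡ : ∀ x → inverse x · x ≈ (ℤ.+ 0 , 0)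
    ·-inverseˡ (a , i) = ≋-reflexive (lemma (u ℤ.^ (k * i)) a) ,
      trans (cong (_% K) (trans (ℕₚ.+-comm (k * i) i) (total-exponent i))) (DivMod.m*n%n≡0 i K)
      where
      lemma : ∀ v a → ℤ.- (v ℤ.* a) ℤ.+ v ℤ.* a ≡ ℤ.+ 0
      lemma = solve-∀

    ·-inverseʳ : ∀ x → x · inverse x ≈ (ℤ.+ 0 , 0)
    ·-inverseʳ (a , i) = ≋-trans (≋-reflexive (lemma a (u ℤ.^ i) (u ℤ.^ (k * i))))
        (≋-trans (≋-+ (≋-refl {a}) (≋-neg (≋-* v*w≋1 (≋-refl {a})))) (≋-reflexive (lemma′ a))) ,
      trans (cong (_% K) (total-exponent i)) (DivMod.m*n%n≡0 i K)
      where
      lemma : ∀ a v w → a ℤ.+ v ℤ.* (ℤ.- (w ℤ.* a)) ≡ a ℤ.+ ℤ.- (v ℤ.* w ℤ.* a)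
      lemma = solve-∀
      lemma′ : ∀ a → a ℤ.+ ℤ.- (ℤ.+ 1 ℤ.* a) ≡ ℤ.+ 0
      lemma′ = solve-∀
      v*w≋1 : u ℤ.^ i ℤ.* u ℤ.^ (k * i) ≋ ℤ.+ 1
      v*w≋1 = ≋-trans (≋-reflexive (trans (sym (ℤₚ.^-distribˡ-+-* u i (k * i))) (cong (u ℤ.^_) (total-exponent i))))
                      (u^[i*K]≋1 i)

    inverse-cong : ∀ {x y} → x ≈ y → inverse x ≈ inverse y
    inverse-cong {a , i} {b , j} (p , q) = ≋-neg (≋-* (u^-cong {k * i} {k * j} r) p) , r
      where
      r : (k * i) % K ≡ (k * j) % K
      r = %-cong-* {k} {k} {i} {j} K refl q

  metacyclic : Group 0ℓ 0ℓ
  metacyclic = record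
    { Carrier = Pair ; _≈_ = _≈_ ; _∙_ = _·_ ; ε = ℤ.+ 0 , 0 ; _⁻¹ = inverse
    ; isGroup = record
      { isMonoid = record
        { isSemigroup = record
          { isMagma = record
            { isEquivalence = record { refl = ≈-refl ; sym = ≈-sym ; trans = ≈-trans }
            ; ∙-cong = λ {x} {y} {z} {w} → ·-cong {x} {y} {z} {w} }
          ; assoc = ·-assoc }
        ; identity = ·-identityˡ , ·-identityʳ }
      ; inverse = ·-inverseˡ , ·-inverseʳ
      ; ⁻¹-cong = λ {x} {y} → inverse-cong {x} {y} } }

  opaque
    to : Fin (N * K) → Pair
    to g = let a , i = remQuot {N} K g in ℤ.+ toℕ a , toℕ i

    from : Pair → Fin (N * K)
    from (a , i) = combine (residue a) (i DivMod.mod K)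

    to-from : ∀ x → to (from x) ≈ x
    to-from (a , i) = subst (λ (b , j) → (ℤ.+ toℕ b , toℕ j) ≈ (a , i))
      (sym (Finₚ.remQuot-combine (residue a) (i DivMod.mod K)))
      (residue-≋ a , trans (cong (_% K) (Finₚ.toℕ-fromℕ< (DivMod.m%n<n i K))) (DivMod.m%n%n≡m%n i K))

    to-injective : ∀ {g h} → to g ≈ to h → g ≡ h
    to-injective {g} {h} (p , q) = trans (sym (Finₚ.combine-remQuot {N} K g))
      (trans (cong₂ combine (toℕ-≋-injective p) (Finₚ.toℕ-injective (trans (sym (small g)) (trans q (small h)))))
             (Finₚ.combine-remQuot {N} K h))
      where
      small : ∀ g → toℕ (proj₂ (remQuot {N} K g)) % K ≡ toℕ (proj₂ (remQuot {N} K g))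
      small g = DivMod.m<n⇒m%n≡m (Finₚ.toℕ<n (proj₂ (remQuot {N} K g)))

    Γ : FinGroup (N * K)
    Γ = finGroup metacyclic to (λ {g} {h} → to-injective {g} {h})
      (λ g h → from (to g · to h) , to-from (to g · to h)) (from (ℤ.+ 0 , 0) , to-from (ℤ.+ 0 , 0))
      (λ g → from (inverse (to g)) , to-from (inverse (to g)))

    from-cong : ∀ {x y} → x ≈ y → from x ≡ from y
    from-cong {x} {y} p = to-injective {from x} {from y}
      (≈-trans {to (from x)} {x} (to-from x) (≈-trans {x} {y} p (≈-sym {to (from y)} {y} (to-from y))))

    from-injective : ∀ {x y} → from x ≡ from y → x ≈ y
    from-injective {x} {y} p = ≈-trans {x} {to (from x)} (≈-sym {to (from x)} {x} (to-from x))
      (subst (λ g → to g ≈ y) (sym p) (to-from y))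

    from-· : ∀ x y → FinGroup._∙_ Γ (from x) (from y) ≡ from (x · y)
    from-· x y = from-cong {to (from x) · to (from y)} {x · y}
      (·-cong {to (from x)} {x} {to (from y)} {y} (to-from x) (to-from y))

    from-ε : from (ℤ.+ 0 , 0) ≡ FinGroup.ε Γ
    from-ε = refl

    from-surjective : ∀ g → ∃[ a ] Σ[ i ∈ Fin K ] from (ℤ.+ a , toℕ i) ≡ g
    from-surjective g = toℕ (proj₁ (remQuot {N} K g)) , proj₂ (remQuot {N} K g) ,
      to-injective {from (to g)} {g} (to-from (to g))

-- Dihedral groups of order 4m

module _ {n} (Γ : FinGroup n) where
  open FinGroup Γ

  klein-subgroup : ∀ s z → s ≢ ε → z ≢ ε → s ≢ z → s ∙ s ≡ ε → z ∙ z ≡ ε → s ∙ z ≡ z ∙ s → Subgroup Γ 4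
  klein-subgroup s z s≢ε z≢ε s≢z ss zz comm = record
    { element = element
    ; element-injective = injective _ _
    ; ε-member = zero , refl
    ; ∙-member = mul
    ; ⁻¹-member = λ k → k , inverseˡ-unique _ _ (square k)
    }
    where
    element : Fin 4 → Fin n
    element zero                   = ε
    element (suc zero)             = s
    element (suc (suc zero))       = z
    element (suc (suc (suc zero))) = s ∙ z

    s[sz] : s ∙ (s ∙ z) ≡ z
    s[sz] = trans (sym (assoc s s z)) (trans (cong (_∙ z) ss) (identityˡ z))

    [sz]z : s ∙ z ∙ z ≡ s
    [sz]z = trans (assoc s z z) (trans (cong (s ∙_) zz) (identityʳ s))

    [sz]s : s ∙ z ∙ s ≡ z
    [sz]s = trans (assoc s z s) (trans (cong (s ∙_) (sym comm)) s[sz])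

    z[sz] : z ∙ (s ∙ z) ≡ s
    z[sz] = trans (sym (assoc z s z)) (trans (cong (_∙ z) (sym comm)) [sz]z)

    sz≢ε : s ∙ z ≢ ε
    sz≢ε eq = s≢z (∙-cancelʳ z s z (trans eq (sym zz)))

    sz≢s : s ∙ z ≢ s
    sz≢s eq = z≢ε (identityʳ-unique s z eq)

    sz≢z : s ∙ z ≢ z
    sz≢z eq = s≢ε (identityˡ-unique s z eq)

    injective : ∀ k l → element k ≡ element l → k ≡ l
    injective zero                   zero                   _  = refl
    injective zero                   (suc zero)             eq = contradiction (sym eq) s≢ε
    injective zero                   (suc (suc zero))       eq = contradiction (sym eq) z≢ε
    injective zero                   (suc (suc (suc zero))) eq = contradiction (sym eq) sz≢ε
    injective (suc zero)             zero                   eq = contradiction eq s≢ε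
    injective (suc zero)             (suc zero)             _  = refl
    injective (suc zero)             (suc (suc zero))       eq = contradiction eq s≢z
    injective (suc zero)             (suc (suc (suc zero))) eq = contradiction (sym eq) sz≢s
    injective (suc (suc zero))       zero                   eq = contradiction eq z≢ε
    injective (suc (suc zero))       (suc zero)             eq = contradiction (sym eq) s≢z
    injective (suc (suc zero))       (suc (suc zero))       _  = refl
    injective (suc (suc zero))       (suc (suc (suc zero))) eq = contradiction (sym eq) sz≢z
    injective (suc (suc (suc zero))) zero                   eq = contradiction eq sz≢ε
    injective (suc (suc (suc zero))) (suc zero)             eq = contradiction eq sz≢s
    injective (suc (suc (suc zero))) (suc (suc zero))       eq = contradiction eq sz≢z
    injective (suc (suc (suc zero))) (suc (suc (suc zero))) _  = refl

    square : ∀ k → element k ∙ element k ≡ ε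
    square zero                   = identityˡ ε
    square (suc zero)             = ss
    square (suc (suc zero))       = zz
    square (suc (suc (suc zero))) = trans (sym (assoc (s ∙ z) s z)) (trans (cong (_∙ z) [sz]s) zz)

    mul : ∀ k l → ∃[ m ] element m ≡ element k ∙ element l
    mul zero                     l                        = l , sym (identityˡ _)
    mul k@(suc _)                zero                     = k , sym (identityʳ _)
    mul k@(suc zero)             (suc zero)               = zero , sym (square k)
    mul (suc zero)               (suc (suc zero))         = suc (suc (suc zero)) , refl
    mul (suc zero)               (suc (suc (suc zero)))   = suc (suc zero) , sym s[sz]
    mul (suc (suc zero))         (suc zero)               = suc (suc (suc zero)) , comm
    mul k@(suc (suc zero))       (suc (suc zero))         = zero , sym (square k)
    mul (suc (suc zero))         (suc (suc (suc zero)))   = suc zero , sym z[sz]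
    mul (suc (suc (suc zero)))   (suc zero)               = suc (suc zero) , sym [sz]s
    mul (suc (suc (suc zero)))   (suc (suc zero))         = suc zero , sym [sz]z
    mul k@(suc (suc (suc zero))) (suc (suc (suc zero)))   = zero , sym (square k)

module Dihedral (m′ : ℕ) where
  m N : ℕ
  m = suc m′
  N = 2 * m

  open Congruence N
  open Metacyclic N 1 (ℤ.- ℤ.+ 1) (Congruence.≋-refl _)
  open FinGroup Γ using (_∙_; ε)

  -- `s` and `τ` are adjacent reflections and `z` is the central half-turn, so `s` and `z` span a
  -- Klein four-group. Stabilizers of orders 4 and 2 give the weights 3n/4 + n/2 = 5n/4, the case of
  -- equality in the bound 4(g - 1).
  s z τ : Fin (N * K)
  s = from (ℤ.+ 0 , 1)
  z = from (ℤ.+ m , 0)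
  τ = from (ℤ.+ 1 , 1)

  +N : ℤ.+ N ≡ ℤ.+ 2 ℤ.* ℤ.+ m
  +N = ℤₚ.pos-* 2 m

  z²≡ε : z ∙ z ≡ ε
  z²≡ε = trans (from-· (ℤ.+ m , 0) (ℤ.+ m , 0)) (trans (from-cong
    (mod (ℤ.+ 1) (trans (lemma (ℤ.+ m)) (cong (λ k → ℤ.+ 0 ℤ.+ ℤ.+ 1 ℤ.* k) (sym +N))) , refl)) from-ε)
    where
    lemma : ∀ M → M ℤ.+ ℤ.+ 1 ℤ.* M ≡ ℤ.+ 0 ℤ.+ ℤ.+ 1 ℤ.* (ℤ.+ 2 ℤ.* M)
    lemma = solve-∀

  sz≡zs : s ∙ z ≡ z ∙ s
  sz≡zs = trans (from-· (ℤ.+ 0 , 1) (ℤ.+ m , 0)) (trans (from-cong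
    (mod (ℤ.- ℤ.+ 1) (trans (lemma (ℤ.+ m))
      (cong (λ k → ℤ.+ m ℤ.+ ℤ.+ 1 ℤ.* ℤ.+ 0 ℤ.+ ℤ.- ℤ.+ 1 ℤ.* k) (sym +N))) , refl))
    (sym (from-· (ℤ.+ m , 0) (ℤ.+ 0 , 1))))
    where
    lemma : ∀ M → ℤ.+ 0 ℤ.+ ℤ.- ℤ.+ 1 ℤ.* M ≡
                  M ℤ.+ ℤ.+ 1 ℤ.* ℤ.+ 0 ℤ.+ ℤ.- ℤ.+ 1 ℤ.* (ℤ.+ 2 ℤ.* M)
    lemma = solve-∀

  s≢ε : s ≢ ε
  s≢ε eq with from-injective {ℤ.+ 0 , 1} {ℤ.+ 0 , 0} (trans eq (sym from-ε))
  ... | _ , ()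

  τ≢ε : τ ≢ ε
  τ≢ε eq with from-injective {ℤ.+ 1 , 1} {ℤ.+ 0 , 0} (trans eq (sym from-ε))
  ... | _ , ()

  s≢z : s ≢ z
  s≢z eq with from-injective {ℤ.+ 0 , 1} {ℤ.+ m , 0} eq
  ... | _ , ()

  z≢ε : z ≢ ε
  z≢ε eq with from-injective {ℤ.+ m , 0} {ℤ.+ 0 , 0} (trans eq (sym from-ε))
  ... | p , _ with ≋⇒≡ (ℕₚ.m<m+n m (s≤s z≤n)) (s≤s z≤n) p
  ... | ()

  H : Subgroup Γ 4
  H = klein-subgroup Γ s z s≢ε z≢ε s≢z
    (trans (from-· (ℤ.+ 0 , 1) (ℤ.+ 0 , 1)) (trans (from-cong (≋-refl , refl)) from-ε)) z²≡ε sz≡zs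

  R : Subgroup Γ 2
  R = involution-subgroup Γ τ τ≢ε
    (trans (from-· (ℤ.+ 1 , 1) (ℤ.+ 1 , 1)) (trans (from-cong (≋-refl , refl)) from-ε))

  Reached : Pair → Set
  Reached x = Star (Move H R) ε (from x)

  reached-≈ : ∀ {x y} → x ≈ y → Reached x → Reached y
  reached-≈ p r = subst (Star (Move H R) ε) (from-cong p) r

  reached-s : ∀ x → Reached x → Reached (x · (ℤ.+ 0 , 1))
  reached-s x r = r ◅◅ (inj₁ (suc zero , sym (from-· x (ℤ.+ 0 , 1))) ◅ Star.ε)

  reached-τ : ∀ x → Reached x → Reached (x · (ℤ.+ 1 , 1))
  reached-τ x r = r ◅◅ (inj₂ (suc zero , sym (from-· x (ℤ.+ 1 , 1))) ◅ Star.ε)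

  -- The product of `τ` and `s` is the rotation by 1.
  reached-rotation : ∀ x → Reached (ℤ.+ x , 0)
  reached-rotation zero    = subst (Star (Move H R) ε) (sym from-ε) Star.ε
  reached-rotation (suc x) = reached-≈ (≋-reflexive (lemma (ℤ.+ x)) , refl)
    (reached-s ((ℤ.+ x , 0) · (ℤ.+ 1 , 1)) (reached-τ (ℤ.+ x , 0) (reached-rotation x)))
    where
    lemma : ∀ X → X ℤ.+ ℤ.+ 1 ℤ.* ℤ.+ 1 ℤ.+ ℤ.- ℤ.+ 1 ℤ.* ℤ.+ 0 ≡ ℤ.+ 1 ℤ.+ X
    lemma = solve-∀

  reached : ∀ γ → Star (Move H R) ε γ
  reached γ with from-surjective γ
  ... | a , i , p = subst (Star (Move H R) ε) p (at i)
    where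
    lemma : ∀ X → X ℤ.+ ℤ.+ 1 ℤ.* ℤ.+ 0 ≡ X
    lemma = solve-∀

    at : (i : Fin 2) → Reached (ℤ.+ a , toℕ i)
    at zero       = reached-rotation a
    at (suc zero) = reached-≈ (≋-reflexive (lemma (ℤ.+ a)) , refl)
      (reached-s (ℤ.+ a , 0) (reached-rotation a))

  index-H : Cosets.index H ≡ m
  index-H = ℕₚ.*-cancelʳ-≡ (Cosets.index H) m 4
    (trans (Cosets.lagrange H) (trans (cong (_* 2) (ℕₚ.*-comm 2 m)) (ℕₚ.*-assoc m 2 2)))

  index-R : Cosets.index R ≡ 2 * m
  index-R = ℕₚ.*-cancelʳ-≡ (Cosets.index R) (2 * m) 2 (Cosets.lagrange R)

  order≡ : N * K ≡ 4 * m
  order≡ = trans (ℕₚ.*-comm (2 * m) 2) (sym (ℕₚ.*-assoc 2 2 m))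

  dihedral-harmonic : HarmonicGroupOrder (suc m) (4 * m)
  dihedral-harmonic = subst (HarmonicGroupOrder (suc m)) order≡
    (ModelGraph.harmonicGroupOrder (cosetModel H R reached) (suc m) (begin
      suc (N * K)                             ≡⟨ cong suc order≡ ⟩
      suc (4 * m)                             ≡⟨ sym (ℕₚ.+-comm (4 * m) 1) ⟩
      4 * m + 1                               ≡⟨ cong (_+ 1) (ℕₚ.*-distribʳ-+ m 3 1) ⟩
      3 * m + 1 * m + 1                       ≡⟨ cong (λ k → 3 * m + k + 1) (ℕₚ.*-identityˡ m) ⟩
      3 * m + m + 1                           ≡⟨ ℕₚ.+-assoc (3 * m) m 1 ⟩
      m + 2 * m + (m + 1)                     ≡⟨ cong (_+_ (m + 2 * m)) (ℕₚ.+-comm m 1) ⟩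
      m + 2 * m + suc m                       ≡⟨ cong (_+ suc m) (sym (cong₂ _+_ index-H index-R)) ⟩
      Cosets.index H + Cosets.index R + suc m ∎))
    where open ≡-Reasoning

-- Groups ℤ/N ⋊ ℤ/6 generated by elements of orders 2 and 3

module SixFold (N : ℕ) .{{_ : NonZero N}} (u c : ℤ)
               (u³≋-1 : Congruence._≋_ N (u ℤ.^ 3) (ℤ.- ℤ.+ 1))
               (u⁶≋1 : Congruence._≋_ N (u ℤ.^ 6) (ℤ.+ 1))
               (c+uc≋1 : Congruence._≋_ N (c ℤ.+ u ℤ.* c) (ℤ.+ 1)) where
  open Congruence N
  open Metacyclic N 5 u u⁶≋1
  open FinGroup Γ using (_∙_; ε)

  -- Acting affinely on ℤ/N, `σ̂` is x ↦ u²x and `τ̂` is x ↦ c - x, because u³ ≡ -1. The exponents 2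
  -- and 3 generate ℤ/6, so the task is to reach the translations.
  σ̂ τ̂ : Pair
  σ̂ = ℤ.+ 0 , 2
  τ̂ = c , 3

  σ τ : Fin (N * K)
  σ = from σ̂
  τ = from τ̂

  σ³≡ε : σ ∙ σ ∙ σ ≡ ε
  σ³≡ε = trans (cong (_∙ σ) (from-· σ̂ σ̂)) (trans (from-· (σ̂ · σ̂) σ̂)
    (trans (from-cong (≋-reflexive (lemma (u ℤ.^ 2) (u ℤ.^ 4)) , refl)) from-ε))
    where
    lemma : ∀ v w → ℤ.+ 0 ℤ.+ v ℤ.* ℤ.+ 0 ℤ.+ w ℤ.* ℤ.+ 0 ≡ ℤ.+ 0
    lemma = solve-∀

  τ²≡ε : τ ∙ τ ≡ ε
  τ²≡ε = trans (from-· τ̂ τ̂) (trans (from-cong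
    (≋-trans (≋-+ (≋-refl {c}) (≋-* u³≋-1 (≋-refl {c}))) (≋-reflexive (lemma c)) , refl)) from-ε)
    where
    lemma : ∀ c → c ℤ.+ (ℤ.- ℤ.+ 1) ℤ.* c ≡ ℤ.+ 0
    lemma = solve-∀

  σ≢ε : σ ≢ ε
  σ≢ε eq with from-injective {σ̂} {ℤ.+ 0 , 0} (trans eq (sym from-ε))
  ... | _ , ()

  τ≢ε : τ ≢ ε
  τ≢ε eq with from-injective {τ̂} {ℤ.+ 0 , 0} (trans eq (sym from-ε))
  ... | _ , ()

  Step : Fin (N * K) → Fin (N * K) → Set
  Step γ δ = δ ≡ γ ∙ σ ⊎ δ ≡ γ ∙ τ

  Reached : Pair → Set
  Reached x = Star Step ε (from x)

  reached-≈ : ∀ {x y} → x ≈ y → Reached x → Reached y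
  reached-≈ p r = subst (Star Step ε) (from-cong p) r

  reached-σ : ∀ x → Reached x → Reached (x · σ̂)
  reached-σ x r = r ◅◅ (inj₁ (sym (from-· x σ̂)) ◅ Star.ε)

  reached-τ : ∀ x → Reached x → Reached (x · τ̂)
  reached-τ x r = r ◅◅ (inj₂ (sym (from-· x τ̂)) ◅ Star.ε)

  turn : ∀ a i → Reached (a , i) → Reached (a , i + 2)
  turn a i r = reached-≈ (≋-reflexive (lemma a (u ℤ.^ i)) , refl) (reached-σ (a , i) r)
    where
    lemma : ∀ a v → a ℤ.+ v ℤ.* ℤ.+ 0 ≡ a
    lemma = solve-∀

  flip : ∀ a → Reached (a , 0) → Reached (a ℤ.+ c , 3)
  flip a r = reached-≈ (≋-reflexive (cong (ℤ._+_ a) (ℤₚ.*-identityˡ c)) , refl) (reached-τ (a , 0) r)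

  -- The word τσ²τσ is the translation by c + uc ≡ 1.
  translate : ∀ a → Reached (a , 0) → Reached (a ℤ.+ ℤ.+ 1 , 0)
  translate a r = reached-≈ (≋-trans (≋-reflexive (ℤₚ.+-assoc a c (u ℤ.^ 7 ℤ.* c)))
      (≋-+ (≋-refl {a}) (≋-trans (≋-+ (≋-refl {c}) (≋-* u⁷≋u (≋-refl {c}))) c+uc≋1)) , refl)
    (turn (a ℤ.+ c ℤ.+ u ℤ.^ 7 ℤ.* c) 10
      (reached-τ (a ℤ.+ c , 7) (turn (a ℤ.+ c) 5 (turn (a ℤ.+ c) 3 (flip a r)))))
    where
    u⁷≋u : u ℤ.^ 7 ≋ u
    u⁷≋u = ≋-trans (u^-cong {7} {1} refl) (≋-reflexive (ℤₚ.*-identityʳ u))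

  reached-translation : ∀ x → Reached (ℤ.+ x , 0)
  reached-translation zero    = subst (Star Step ε) (sym from-ε) Star.ε
  reached-translation (suc x) =
    reached-≈ (≋-reflexive (ℤₚ.+-comm (ℤ.+ x) (ℤ.+ 1)) , refl) (translate (ℤ.+ x) (reached-translation x))

  reached-0 : ∀ a → Reached (a , 0)
  reached-0 a = reached-≈ (residue-≋ a , refl) (reached-translation (toℕ (residue a)))

  reached-3 : ∀ a → Reached (a , 3)
  reached-3 a = reached-≈ (≋-reflexive (lemma a c) , refl) (flip (a ℤ.- c) (reached-0 (a ℤ.- c)))
    where
    lemma : ∀ a c → a ℤ.- c ℤ.+ c ≡ a
    lemma = solve-∀

  reached : ∀ a (i : Fin 6) → Reached (a , toℕ i)
  reached a zero                               = reached-0 a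
  reached a (suc zero)                         =
    reached-≈ {a , 7} (≋-refl , refl) (turn a 5 (turn a 3 (reached-3 a)))
  reached a (suc (suc zero))                   = turn a 0 (reached-0 a)
  reached a (suc (suc (suc zero)))             = reached-3 a
  reached a (suc (suc (suc (suc zero))))       = turn a 2 (turn a 0 (reached-0 a))
  reached a (suc (suc (suc (suc (suc zero))))) = turn a 3 (reached-3 a)

  twoThreeGenerated : TwoThreeGenerated (6 * N)
  twoThreeGenerated = subst TwoThreeGenerated (ℕₚ.*-comm N 6) (record
    { Γ = Γ ; σ = σ ; τ = τ ; σ≢ε = σ≢ε ; τ≢ε = τ≢ε ; σ³≡ε = σ³≡ε ; τ²≡ε = τ²≡ε
    ; generated = λ γ → let a , i , p = from-surjective γ in
        subst (Star Step ε) p (reached (ℤ.+ a) i) })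

-- For k = 3j and N = k² + k + 1 the unit u = k + 1 satisfies u² - u + 1 ≡ 0
-- mod N, so it has order 6, and 1 + u is invertible, with inverse c.
module Eisenstein (j : ℕ) where

  N : ℕ
  N = suc (9 * (j * j) + 3 * j)

  open Congruence N

  J u c : ℤ
  J = ℤ.+ j
  u = ℤ.+ 1 ℤ.+ ℤ.+ 3 ℤ.* J
  -- From N = (u + 1)(3J - 1) + 3 one gets (u + 1)(3J - 1) ≡ -3, and N = 3J(3J + 1) + 1 shows that
  -- J(3J + 1) is the inverse of -3. Inverting 3 is the reason for taking k divisible by 3.
  c = (ℤ.+ 3 ℤ.* J ℤ.- ℤ.+ 1) ℤ.* (J ℤ.* (ℤ.+ 3 ℤ.* J ℤ.+ ℤ.+ 1))

  +N : ℤ.+ N ≡ ℤ.+ 1 ℤ.+ (ℤ.+ 9 ℤ.* (J ℤ.* J) ℤ.+ ℤ.+ 3 ℤ.* J)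
  +N = cong (ℤ._+_ (ℤ.+ 1)) (cong₂ ℤ._+_
    (trans (ℤₚ.pos-* 9 (j * j)) (cong (ℤ._*_ (ℤ.+ 9)) (ℤₚ.pos-* j j))) (ℤₚ.pos-* 3 j))

  ≋-by : ∀ {a b} q → a ≡ b ℤ.+ q ℤ.* (ℤ.+ 1 ℤ.+ (ℤ.+ 9 ℤ.* (J ℤ.* J) ℤ.+ ℤ.+ 3 ℤ.* J)) → a ≋ b
  ≋-by {b = b} q eq = mod q (trans eq (cong (λ k → b ℤ.+ q ℤ.* k) (sym +N)))

  u³≋-1 : u ℤ.^ 3 ≋ ℤ.- ℤ.+ 1
  -- u³ + 1 = (u + 1)(u² - u + 1), and the second factor is N itself.
  u³≋-1 = ≋-by (u ℤ.+ ℤ.+ 1) (lemma J)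
    where
    lemma : ∀ J → (ℤ.+ 1 ℤ.+ ℤ.+ 3 ℤ.* J) ℤ.* ((ℤ.+ 1 ℤ.+ ℤ.+ 3 ℤ.* J) ℤ.* ((ℤ.+ 1 ℤ.+ ℤ.+ 3 ℤ.* J) ℤ.* ℤ.+ 1)) ≡
            ℤ.- ℤ.+ 1 ℤ.+ (ℤ.+ 1 ℤ.+ ℤ.+ 3 ℤ.* J ℤ.+ ℤ.+ 1) ℤ.* (ℤ.+ 1 ℤ.+ (ℤ.+ 9 ℤ.* (J ℤ.* J) ℤ.+ ℤ.+ 3 ℤ.* J))
    lemma = solve-∀

  u⁶≋1 : u ℤ.^ 6 ≋ ℤ.+ 1
  u⁶≋1 = ≋-trans (≋-reflexive (ℤₚ.^-distribˡ-+-* u 3 3)) (≋-* u³≋-1 u³≋-1)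

  c+uc≋1 : c ℤ.+ u ℤ.* c ≋ ℤ.+ 1
  c+uc≋1 = ≋-by (J ℤ.* (ℤ.+ 3 ℤ.* J ℤ.+ ℤ.+ 1) ℤ.- ℤ.+ 1) (lemma J)
    where
    lemma : ∀ J → (ℤ.+ 3 ℤ.* J ℤ.- ℤ.+ 1) ℤ.* (J ℤ.* (ℤ.+ 3 ℤ.* J ℤ.+ ℤ.+ 1)) ℤ.+
                  (ℤ.+ 1 ℤ.+ ℤ.+ 3 ℤ.* J) ℤ.* ((ℤ.+ 3 ℤ.* J ℤ.- ℤ.+ 1) ℤ.* (J ℤ.* (ℤ.+ 3 ℤ.* J ℤ.+ ℤ.+ 1))) ≡
            ℤ.+ 1 ℤ.+ (J ℤ.* (ℤ.+ 3 ℤ.* J ℤ.+ ℤ.+ 1) ℤ.- ℤ.+ 1) ℤ.*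
              (ℤ.+ 1 ℤ.+ (ℤ.+ 9 ℤ.* (J ℤ.* J) ℤ.+ ℤ.+ 3 ℤ.* J))
    lemma = solve-∀

  eisenstein-twoThreeGenerated : TwoThreeGenerated (6 * N)
  eisenstein-twoThreeGenerated = SixFold.twoThreeGenerated N u c u³≋-1 u⁶≋1 c+uc≋1

-- Permutations of prime order

iter : ∀ {A : Set} → (A → A) → ℕ → A → A
iter f zero    x = x
iter f (suc k) x = f (iter f k x)

iter-+ : ∀ {A : Set} (f : A → A) k l x → iter f (k + l) x ≡ iter f k (iter f l x)
iter-+ f zero    l x = refl
iter-+ f (suc k) l x = cong f (iter-+ f k l x)

iter-suc : ∀ {A : Set} (f : A → A) k x → iter f (suc k) x ≡ iter f k (f x)
iter-suc f k x = trans (cong (λ j → iter f j x) (ℕₚ.+-comm 1 k)) (iter-+ f k 1 x)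

iter-* : ∀ {A : Set} (f : A → A) k d {x} → iter f d x ≡ x → iter f (k * d) x ≡ x
iter-* f zero    d p = refl
iter-* f (suc k) d {x} p = trans (iter-+ f d (k * d) x) (trans (cong (iter f d) (iter-* f k d p)) p)

iter-cong : ∀ {A B : Set} (f : A → A) (g : B → B) (h : A → B) → (∀ x → h (f x) ≡ g (h x)) →
            ∀ k x → h (iter f k x) ≡ iter g k (h x)
iter-cong f g h comm zero    x = refl
iter-cong f g h comm (suc k) x = trans (comm (iter f k x)) (cong g (iter-cong f g h comm k x))

module _ {q : ℕ} (q-prime : Prime q) where
  private instance
    q≢0 : NonZero q
    q≢0 = Primality.prime⇒nonZero q-prime

  module PrimeOrder {A : Set} (f : A → A) where

    iter-% : ∀ k {x} → iter f q x ≡ x → iter f k x ≡ iter f (k % q) x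
    iter-% k {x} p = trans (cong (λ j → iter f j x) (DivMod.m≡m%n+[m/n]*n k q))
      (trans (iter-+ f (k % q) (k / q * q) x) (cong (iter f (k % q)) (iter-* f (k / q) q p)))

    -- Since d is prime to q, Bézout's identity makes a multiple of d and a multiple of q differ by
    -- 1; both numbers of iterations fix x, hence so does a single one.
    fixed-by-iterate : ∀ d {x} → 0 < d → d < q → iter f q x ≡ x → iter f d x ≡ x → f x ≡ x
    fixed-by-iterate d@(suc _) {x} _ d<q p r with coprime-Bézout (prime⇒coprime q-prime d<q)
    ... | Bézout.+- a b eq = trans (sym (cong f (iter-* f b d r)))
      (trans (cong (λ j → iter f j x) eq) (iter-* f a q p))
    ... | Bézout.-+ a b eq = trans (sym (cong f (iter-* f a q p)))
      (trans (cong (λ j → iter f j x) eq) (iter-* f b d r))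

    iterates-agree⇒fixed : ∀ {x k l} → iter f q x ≡ x → k < l → l < q →
                           iter f k x ≡ iter f l x → f x ≡ x
    iterates-agree⇒fixed {x} {k} {l} p k<l l<q eq = fixed-by-iterate (l ∸ k) (ℕₚ.m<n⇒0<n∸m k<l)
        (ℕₚ.≤-<-trans (ℕₚ.m∸n≤m l k) l<q) p (sym (begin
      x                           ≡⟨ sym p ⟩
      iter f q x                  ≡⟨ cong (λ j → iter f j x) (sym (ℕₚ.m∸n+n≡m k≤q)) ⟩
      iter f (q ∸ k + k) x        ≡⟨ iter-+ f (q ∸ k) k x ⟩
      iter f (q ∸ k) (iter f k x) ≡⟨ cong (iter f (q ∸ k)) eq ⟩
      iter f (q ∸ k) (iter f l x) ≡⟨ sym (iter-+ f (q ∸ k) l x) ⟩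
      iter f (q ∸ k + l) x        ≡⟨ cong (λ j → iter f j x) exchange ⟩
      iter f (l ∸ k + q) x        ≡⟨ iter-+ f (l ∸ k) q x ⟩
      iter f (l ∸ k) (iter f q x) ≡⟨ cong (iter f (l ∸ k)) p ⟩
      iter f (l ∸ k) x            ∎))
      where
      open ≡-Reasoning
      k≤q = ℕₚ.<⇒≤ (ℕₚ.<-trans k<l l<q)
      exchange : q ∸ k + l ≡ l ∸ k + q
      exchange = begin
        q ∸ k + l             ≡⟨ cong (q ∸ k +_) (sym (ℕₚ.m+[n∸m]≡n (ℕₚ.<⇒≤ k<l))) ⟩
        q ∸ k + (k + (l ∸ k)) ≡⟨ sym (ℕₚ.+-assoc (q ∸ k) k (l ∸ k)) ⟩
        q ∸ k + k + (l ∸ k)   ≡⟨ cong (_+ (l ∸ k)) (ℕₚ.m∸n+n≡m k≤q) ⟩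
        q + (l ∸ k)           ≡⟨ ℕₚ.+-comm q (l ∸ k) ⟩
        l ∸ k + q             ∎

    iter-injective : ∀ {x k l} → iter f q x ≡ x → f x ≢ x → k < q → l < q →
                     iter f k x ≡ iter f l x → k ≡ l
    iter-injective {x} {k} {l} p ¬fixed k<q l<q eq with ℕₚ.<-cmp k l
    ... | tri< k<l _ _ = contradiction (iterates-agree⇒fixed p k<l l<q eq) ¬fixed
    ... | tri≈ _ k≡l _ = k≡l
    ... | tri> _ _ l<k = contradiction (iterates-agree⇒fixed p l<k k<q (sym eq)) ¬fixed

  -- The orbits of f other than {x₀} all have q elements.
  unique-fixed-point : ∀ {N} (f : Fin N → Fin N) → (∀ x → iter f q x ≡ x) →
                       ∀ x₀ → f x₀ ≡ x₀ → (∀ x → f x ≡ x → x ≡ x₀) → ∃[ k ] N ≡ 1 + k * q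
  unique-fixed-point {N} f period x₀ fixed₀ only = #classes , (begin
      N                                 ≡⟨ sym (count-all (λ _ → yes tt) (λ _ → tt)) ⟩
      count {N} (λ _ → yes tt)          ≡⟨ length-filter-⊎ fixed? moved? (λ _ → yes tt)
                                             (λ {x} _ → decide x) (λ _ → tt) (λ _ → tt) (λ p ¬p → ¬p p) (allFin N) ⟩
      count fixed? + count moved?       ≡⟨ cong₂ _+_ one-fixed (sym moved-count) ⟩
      1 + #classes * q                  ∎)
    where
    open ≡-Reasoning
    open PrimeOrder f

    fixed? : Decidable (λ x → f x ≡ x)
    fixed? x = f x Finₚ.≟ x

    moved? : Decidable (λ x → ¬ f x ≡ x)
    moved? x = ¬? (fixed? x)

    decide : ∀ x → f x ≡ x ⊎ ¬ f x ≡ x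
    decide x with fixed? x
    ... | yes p = inj₁ p
    ... | no ¬p = inj₂ ¬p

    one-fixed : count fixed? ≡ 1
    one-fixed = ℕₚ.≤-antisym (count≤1 fixed? x₀ (λ {x} → only x))
      (ℕₚ.≤-trans (s≤s z≤n) (Finₚ.toℕ<n (Members.index fixed? fixed₀)))

    SameOrbit : Fin N → Fin N → Set
    SameOrbit x y = Σ[ k ∈ Fin q ] iter f (toℕ k) x ≡ y

    sameOrbit : ∀ k {x y} → iter f k x ≡ y → SameOrbit x y
    sameOrbit k {x} p = k DivMod.mod q , trans
      (cong (λ j → iter f j x) (Finₚ.toℕ-fromℕ< (DivMod.m%n<n k q))) (trans (sym (iter-% k (period x))) p)

    iter-inverse : ∀ (k : Fin q) x → iter f (q ∸ toℕ k) (iter f (toℕ k) x) ≡ x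
    iter-inverse k x = trans (sym (iter-+ f (q ∸ toℕ k) (toℕ k) x))
      (trans (cong (λ j → iter f j x) (ℕₚ.m∸n+n≡m (ℕₚ.<⇒≤ (Finₚ.toℕ<n k)))) (period x))

    orbits : DecSetoid 0ℓ 0ℓ
    orbits = record
      { Carrier = Fin N ; _≈_ = SameOrbit
      ; isDecEquivalence = record
        { isEquivalence = record
          { refl  = sameOrbit 0 refl
          ; sym   = λ { {x} (k , refl) → sameOrbit (q ∸ toℕ k) (iter-inverse k x) }
          ; trans = λ { {x} (k , refl) (l , refl) → sameOrbit (toℕ l + toℕ k) (iter-+ f (toℕ l) (toℕ k) x) } }
        ; _≟_ = λ x y → any? (λ k → iter f (toℕ k) x Finₚ.≟ y) } }

    open Classes orbits (filter moved? (allFin N))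

    ∈-moved : ∀ {x} → ¬ f x ≡ x → x ∈ filter moved? (allFin N)
    ∈-moved {x} ¬p = ∈-filter⁺ moved? (∈-allFin x) ¬p

    moved-∈ : ∀ {x} → x ∈ filter moved? (allFin N) → ¬ f x ≡ x
    moved-∈ x∈ = proj₂ (∈-filter⁻ moved? {xs = allFin N} x∈)

    iter-moved : ∀ (k : Fin q) {x} → ¬ f x ≡ x → ¬ f (iter f (toℕ k) x) ≡ iter f (toℕ k) x
    iter-moved k {x} ¬p eq = ¬p (begin
      f x                                             ≡⟨ cong f (sym (iter-inverse k x)) ⟩
      f (iter f (q ∸ toℕ k) (iter f (toℕ k) x))       ≡⟨ iter-suc f (q ∸ toℕ k) _ ⟩
      iter f (q ∸ toℕ k) (f (iter f (toℕ k) x))       ≡⟨ cong (iter f (q ∸ toℕ k)) eq ⟩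
      iter f (q ∸ toℕ k) (iter f (toℕ k) x)           ≡⟨ iter-inverse k x ⟩
      x                                               ∎)

    moved-count : #classes * q ≡ count moved?
    moved-count = ×-bijection⇒count moved? (λ c k → iter f (toℕ k) (rep c))
      (λ c k → iter-moved k (moved-∈ (rep-∈ c))) injective surjective
      where
      injective : ∀ {c k d l} → iter f (toℕ k) (rep c) ≡ iter f (toℕ l) (rep d) → c ≡ d × k ≡ l
      injective {c} {k} {d} {l} eq = c≡d , k≡l c≡d
        where
        c≡d : c ≡ d
        c≡d = trans (sym (class-surjective c (rep-∈ c))) (trans
          (class-cong (rep-∈ c) (rep-∈ d)
            (DecSetoid.trans orbits {rep c} {iter f (toℕ k) (rep c)} {rep d} (k , refl)
              (DecSetoid.sym orbits {rep d} (l , sym eq))))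
          (class-surjective d (rep-∈ d)))
        k≡l : c ≡ d → k ≡ l
        k≡l refl = Finₚ.toℕ-injective (iter-injective (period (rep c)) (moved-∈ (rep-∈ c))
          (Finₚ.toℕ<n k) (Finₚ.toℕ<n l) eq)

      surjective : ∀ {x} → ¬ f x ≡ x → ∃[ c ] ∃[ k ] iter f (toℕ k) (rep c) ≡ x
      surjective {x} ¬p = class (∈-moved ¬p) ,
        DecSetoid.sym orbits {x} {rep (class (∈-moved ¬p))} (rep-class (∈-moved ¬p))

-- Cauchy's theorem

rotate : ∀ {A : Set} → List A → List A
rotate []       = []
rotate (x ∷ xs) = xs ∷ʳ x

iter-rotate : ∀ {A : Set} (ys zs : List A) → iter rotate (length ys) (ys ++ zs) ≡ zs ++ ys
iter-rotate []       zs = sym (Listₚ.++-identityʳ zs)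
iter-rotate (y ∷ ys) zs = trans (iter-suc rotate (length ys) (y ∷ ys ++ zs))
  (trans (cong (iter rotate (length ys)) (Listₚ.++-assoc ys zs (y ∷ [])))
    (trans (iter-rotate ys (zs ∷ʳ y)) (Listₚ.++-assoc zs (y ∷ []) ys)))

rotate-fixed : ∀ {A : Set} (h : A) {a} t → t ∷ʳ a ≡ h ∷ t → All (_≡ h) t
rotate-fixed h []       eq = []
rotate-fixed h (y ∷ ys) eq with Listₚ.∷-injective eq
... | refl , eq′ = refl ∷ rotate-fixed h ys eq′

module _ {n : ℕ} where

  -- Tuples are numbered because `unique-fixed-point` speaks about permutations of some `Fin N`.
  encode : ∀ {k} → Vec (Fin n) k → Fin (n ℕ.^ k)
  encode Vec.[]       = zero
  encode (x Vec.∷ xs) = combine x (encode xs)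

  decode : ∀ k → Fin (n ℕ.^ k) → Vec (Fin n) k
  decode zero    _ = Vec.[]
  decode (suc k) i = let x , j = remQuot {n} (n ℕ.^ k) i in x Vec.∷ decode k j

  decode-encode : ∀ {k} (xs : Vec (Fin n) k) → decode k (encode xs) ≡ xs
  decode-encode Vec.[]       = refl
  decode-encode {suc k} (x Vec.∷ xs) =
    trans (cong (λ (y , j) → y Vec.∷ decode k j) (Finₚ.remQuot-combine {n} {n ℕ.^ k} x (encode xs)))
          (cong (x Vec.∷_) (decode-encode xs))

  encode-decode : ∀ k i → encode (decode k i) ≡ i
  encode-decode zero    zero = refl
  encode-decode (suc k) i    = let x , j = remQuot {n} (n ℕ.^ k) i in
    trans (cong (combine x) (encode-decode k j)) (Finₚ.combine-remQuot {n} (n ℕ.^ k) i)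

module Powers {n} (Γ : FinGroup n) where
  open FinGroup Γ

  open MonoidMult (Group.monoid group) public
    using () renaming (_×_ to pow; ×-homo-+ to pow-+; ×-assocˡ to pow-*)

  pow-iter : ∀ k c → pow k c ≡ iter (c ∙_) k ε
  pow-iter zero    c = refl
  pow-iter (suc k) c = cong (c ∙_) (pow-iter k c)

module McKay {n} (Γ : FinGroup n) (p-2 : ℕ) where
  open FinGroup Γ
  open Powers Γ

  p : ℕ
  p = suc (suc p-2)

  prod : List (Fin n) → Fin n
  prod = foldr _∙_ ε

  prod-∷ʳ : ∀ xs x → prod (xs ∷ʳ x) ≡ prod xs ∙ x
  prod-∷ʳ []       x = trans (identityʳ x) (sym (identityˡ x))
  prod-∷ʳ (y ∷ xs) x = trans (cong (y ∙_) (prod-∷ʳ xs x)) (sym (assoc y (prod xs) x))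

  prod-constant : ∀ {h} {t} → All (_≡ h) t → prod t ≡ pow (length t) h
  prod-constant []         = refl
  prod-constant (refl ∷ a) = cong (_ ∙_) (prod-constant a)

  -- p-tuples with product ε, the first entry being determined by the others.
  Tuple : Set
  Tuple = Vec (Fin n) (suc p-2)

  first : Tuple → Fin n
  first v = prod (Vec.toList v) ⁻¹

  complete : Tuple → List (Fin n)
  complete v = first v ∷ Vec.toList v

  shift : Tuple → Tuple
  shift v@(x Vec.∷ xs) = xs Vec.∷ʳ first v

  -- A product equal to ε stays ε under rotation, so the entry x dropped by `shift` is precisely the
  -- one determined by those it keeps.
  complete-shift : ∀ v → complete (shift v) ≡ rotate (complete v)
  complete-shift v@(x Vec.∷ xs) = cong₂ _∷_ first≡ (Vecₚ.toList-∷ʳ (first v) xs)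
    where
    P = prod (Vec.toList xs)
    first≡ : prod (Vec.toList (xs Vec.∷ʳ first v)) ⁻¹ ≡ x
    first≡ = begin
      prod (Vec.toList (xs Vec.∷ʳ first v)) ⁻¹ ≡⟨ cong (λ l → prod l ⁻¹) (Vecₚ.toList-∷ʳ (first v) xs) ⟩
      prod (Vec.toList xs ∷ʳ first v) ⁻¹       ≡⟨ cong _⁻¹ (prod-∷ʳ (Vec.toList xs) (first v)) ⟩
      (P ∙ (x ∙ P) ⁻¹) ⁻¹                      ≡⟨ cong (λ y → (P ∙ y) ⁻¹) (⁻¹-anti-homo-∙ x P) ⟩
      (P ∙ (P ⁻¹ ∙ x ⁻¹)) ⁻¹                   ≡⟨ cong _⁻¹ (\\-leftDividesˡ P (x ⁻¹)) ⟩
      (x ⁻¹) ⁻¹                                ≡⟨ ⁻¹-involutive x ⟩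
      x                                        ∎
      where open ≡-Reasoning

  complete-injective : ∀ {v w} → complete v ≡ complete w → v ≡ w
  complete-injective {v} {w} eq = trans (sym (Vecₚ.cast-is-id refl v))
    (Vecₚ.toList-injective refl v w (Listₚ.∷-injectiveʳ eq))

  shift-period : ∀ v → iter shift p v ≡ v
  shift-period v = complete-injective (begin
    complete (iter shift p v)           ≡⟨ iter-cong shift rotate complete complete-shift p v ⟩
    iter rotate p (complete v)          ≡⟨ cong₂ (iter rotate) (sym length≡) (sym (Listₚ.++-identityʳ (complete v))) ⟩
    iter rotate (length (complete v)) (complete v ++ []) ≡⟨ iter-rotate (complete v) [] ⟩
    complete v                          ∎)
    where
    open ≡-Reasoning
    length≡ : length (complete v) ≡ p
    length≡ = cong suc (Vecₚ.length-toList v)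

  shift-fixed : ∀ v → shift v ≡ v → pow p (first v) ≡ ε × All (_≡ first v) (Vec.toList v)
  shift-fixed v eq = trans (cong (λ k → pow (suc k) h) (sym (Vecₚ.length-toList v)))
      (trans (cong (h ∙_) (sym (prod-constant constant))) (inverseˡ (prod (Vec.toList v)))) , constant
    where
    h = first v
    constant : All (_≡ h) (Vec.toList v)
    constant = rotate-fixed h (Vec.toList v) (trans (sym (complete-shift v)) (cong complete eq))

  prod-ones : ∀ k → prod (Vec.toList (Vec.replicate k ε)) ≡ ε
  prod-ones zero    = refl
  prod-ones (suc k) = trans (identityˡ _) (prod-ones k)

  ones : Tuple
  ones = Vec.replicate (suc p-2) ε

  all-ones : ∀ {k} (v : Vec (Fin n) k) → All (_≡ ε) (Vec.toList v) → v ≡ Vec.replicate k ε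
  all-ones Vec.[]       []         = refl
  all-ones (x Vec.∷ xs) (refl ∷ a) = cong (ε Vec.∷_) (all-ones xs a)

  replicate-∷ʳ : ∀ k → Vec.replicate k ε Vec.∷ʳ ε ≡ Vec.replicate (suc k) ε
  replicate-∷ʳ zero    = refl
  replicate-∷ʳ (suc k) = cong (ε Vec.∷_) (replicate-∷ʳ k)

  shift-ones : shift ones ≡ ones
  shift-ones = trans (cong (Vec._∷ʳ_ (Vec.replicate p-2 ε))
      (trans (cong _⁻¹ (prod-ones (suc p-2))) ε⁻¹≈ε)) (replicate-∷ʳ p-2)

  unique-shift-fixed : (∀ c → pow p c ≡ ε → c ≡ ε) → ∀ v → shift v ≡ v → v ≡ ones
  unique-shift-fixed trivial v eq =
    let power , constant = shift-fixed v eq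
    in all-ones v (All.map (λ e → trans e (trivial (first v) power)) constant)

  module _ {M : ℕ} (enc : Tuple → Fin M) (dec : Fin M → Tuple)
           (dec-enc : ∀ v → dec (enc v) ≡ v) (enc-dec : ∀ i → enc (dec i) ≡ i) where

    count-tuples : Prime p → (∀ c → pow p c ≡ ε → c ≡ ε) → ∃[ k ] M ≡ 1 + k * p
    count-tuples p-prime trivial = unique-fixed-point p-prime f f-period (enc ones)
      (trans (cong (λ v → enc (shift v)) (dec-enc ones)) (cong enc shift-ones))
      (λ i eq → trans (sym (enc-dec i)) (cong enc
        (unique-shift-fixed trivial (dec i) (trans (sym (dec-enc (shift (dec i)))) (cong dec eq)))))
      where
      f : Fin M → Fin M
      f i = enc (shift (dec i))

      f-period : ∀ i → iter f p i ≡ i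
      f-period i = begin
        iter f p i                   ≡⟨ cong (iter f p) (sym (enc-dec i)) ⟩
        iter f p (enc (dec i))       ≡⟨ sym (iter-cong shift f enc
                                          (λ v → cong (λ w → enc (shift w)) (sym (dec-enc v))) p (dec i)) ⟩
        enc (iter shift p (dec i))   ≡⟨ cong enc (shift-period (dec i)) ⟩
        enc (dec i)                  ≡⟨ enc-dec i ⟩
        i                            ∎
        where open ≡-Reasoning

  -- McKay's argument: were ε the only solution of cᵖ = ε, the shift would have one fixed point
  -- among the n^(p - 1) tuples, so that this power of n would be 1 modulo p although p divides n.
  cauchy : Prime p → p ∣ n → ∃[ c ] c ≢ ε × pow p c ≡ ε
  cauchy p-prime p∣n with any? (λ c → ¬? (c Finₚ.≟ ε) ×-dec (pow p c Finₚ.≟ ε))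
  ... | yes found = found
  ... | no ¬found = contradiction (subst Prime (Div.∣1⇒≡1 p∣1) p-prime) Primality.¬prime[1]
    where
    trivial : ∀ c → pow p c ≡ ε → c ≡ ε
    trivial c power with c Finₚ.≟ ε
    ... | yes c≡ε = c≡ε
    ... | no c≢ε = contradiction (c , c≢ε , power) ¬found

    p∣1 : p ∣ 1
    p∣1 = let k , eq = count-tuples encode (decode (suc p-2)) decode-encode (encode-decode {n} (suc p-2)) p-prime trivial in
      Div.∣m+n∣m⇒∣n (subst (p ∣_) (trans eq (ℕₚ.+-comm 1 (k * p))) (Div.∣m⇒∣m*n (n ℕ.^ p-2) p∣n)) (Div.n∣m*n k)

-- Powers of commuting elements and of elements of prime order

remQuot-injective : ∀ {m} k {x y : Fin (m * k)} → remQuot {m} k x ≡ remQuot {m} k y → x ≡ y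
remQuot-injective {m} k {x} {y} eq = trans (sym (Finₚ.combine-remQuot {m} k x))
  (trans (cong (λ (i , j) → combine i j) eq) (Finₚ.combine-remQuot {m} k y))

module CommutingPowers {n} (Γ : FinGroup n) where
  open FinGroup Γ
  open Powers Γ

  pow-ε : ∀ k → pow k ε ≡ ε
  pow-ε zero    = refl
  pow-ε (suc k) = trans (identityˡ _) (pow-ε k)

  pow-conjugate : ∀ {g a b} → g ∙ a ≡ b ∙ g → ∀ k → g ∙ pow k a ≡ pow k b ∙ g
  pow-conjugate {g} eq zero = trans (identityʳ g) (sym (identityˡ g))
  pow-conjugate {g} {a} {b} eq (suc k) = begin
    g ∙ (a ∙ pow k a) ≡⟨ sym (assoc g a (pow k a)) ⟩
    g ∙ a ∙ pow k a   ≡⟨ cong (_∙ pow k a) eq ⟩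
    b ∙ g ∙ pow k a   ≡⟨ assoc b g (pow k a) ⟩
    b ∙ (g ∙ pow k a) ≡⟨ cong (b ∙_) (pow-conjugate eq k) ⟩
    b ∙ (pow k b ∙ g) ≡⟨ sym (assoc b (pow k b) g) ⟩
    b ∙ pow k b ∙ g   ∎
    where open ≡-Reasoning

  pow-commute : ∀ {a b} → a ∙ b ≡ b ∙ a → ∀ i j → pow i a ∙ pow j b ≡ pow j b ∙ pow i a
  pow-commute eq i j = pow-conjugate (sym (pow-conjugate (sym eq) i)) j

  pow-∙ : ∀ {a b} → a ∙ b ≡ b ∙ a → ∀ k → pow k (a ∙ b) ≡ pow k a ∙ pow k b
  pow-∙ eq zero = sym (identityˡ ε)
  pow-∙ {a} {b} eq (suc k) = begin
    a ∙ b ∙ pow k (a ∙ b)         ≡⟨ cong (a ∙ b ∙_) (pow-∙ eq k) ⟩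
    a ∙ b ∙ (pow k a ∙ pow k b)   ≡⟨ assoc a b _ ⟩
    a ∙ (b ∙ (pow k a ∙ pow k b)) ≡⟨ cong (a ∙_) (sym (assoc b (pow k a) (pow k b))) ⟩
    a ∙ (b ∙ pow k a ∙ pow k b)   ≡⟨ cong (λ x → a ∙ (x ∙ pow k b)) (pow-conjugate (sym eq) k) ⟩
    a ∙ (pow k a ∙ b ∙ pow k b)   ≡⟨ cong (a ∙_) (assoc (pow k a) b (pow k b)) ⟩
    a ∙ (pow k a ∙ (b ∙ pow k b)) ≡⟨ sym (assoc a (pow k a) _) ⟩
    a ∙ pow k a ∙ (b ∙ pow k b)   ∎
    where open ≡-Reasoning

module PrimePowers {n} (Γ : FinGroup n) {q} (q-prime : Prime q) {c} (c≢ε : c ≢ FinGroup.ε Γ)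
                   (c^q≡ε : Powers.pow Γ q c ≡ FinGroup.ε Γ) where
  open FinGroup Γ
  open Powers Γ
  open CommutingPowers Γ

  private instance
    q≢0 : NonZero q
    q≢0 = Primality.prime⇒nonZero q-prime

  C : ℕ → Fin n
  C k = pow k c

  C-injective : ∀ {k l} → k < q → l < q → C k ≡ C l → k ≡ l
  C-injective {k} {l} k<q l<q eq = PrimeOrder.iter-injective q-prime (c ∙_)
    (trans (sym (pow-iter q c)) c^q≡ε) (λ e → c≢ε (trans (sym (identityʳ c)) e)) k<q l<q
    (trans (sym (pow-iter k c)) (trans eq (pow-iter l c)))

  C-multiple : ∀ k → C (k * q) ≡ ε
  C-multiple k = trans (sym (pow-* c k q)) (trans (cong (pow k) c^q≡ε) (pow-ε k))

  C-% : ∀ k → C k ≡ C (k % q)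
  C-% k = begin
    C k                         ≡⟨ cong C (DivMod.m≡m%n+[m/n]*n k q) ⟩
    C (k % q + k / q * q)       ≡⟨ pow-+ c (k % q) (k / q * q) ⟩
    C (k % q) ∙ C (k / q * q)   ≡⟨ cong (C (k % q) ∙_) (C-multiple (k / q)) ⟩
    C (k % q) ∙ ε               ≡⟨ identityʳ _ ⟩
    C (k % q)                   ∎
    where open ≡-Reasoning

  C-complementˡ : ∀ {i} → i ≤ q → C (q ∸ i) ∙ C i ≡ ε
  C-complementˡ {i} i≤q = trans (sym (pow-+ c (q ∸ i) i)) (trans (cong C (ℕₚ.m∸n+n≡m i≤q)) c^q≡ε)

  C-complementʳ : ∀ {i} → i ≤ q → C i ∙ C (q ∸ i) ≡ ε
  C-complementʳ {i} i≤q = trans (sym (pow-+ c i (q ∸ i))) (trans (cong C (ℕₚ.m+[n∸m]≡n i≤q)) c^q≡ε)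

  C-difference : ∀ {i j} → i < q → j < q → C (i + (q ∸ j)) ≡ ε → i ≡ j
  C-difference {i} {j} i<q j<q eq = C-injective i<q j<q (∙-cancelʳ (C (q ∸ j)) (C i) (C j)
    (trans (sym (pow-+ c i (q ∸ j))) (trans eq (sym (C-complementʳ (ℕₚ.<⇒≤ j<q))))))

  -- D is invertible modulo q. One form of Bézout's identity yields c⁻¹ in place of c, which the
  -- further exponent q - 1 turns into c.
  C-generates : ∀ D → C D ≢ ε → ∃[ x ] pow x (C D) ≡ c
  C-generates D D≢ = subst (λ a → ∃[ x ] pow x a ≡ c) (sym (C-% D)) (reduced (D % q) (λ e → D≢ (trans (C-% D) e))
      (DivMod.m%n<n D q))
    where
    reduced : ∀ d → C d ≢ ε → d < q → ∃[ x ] pow x (C d) ≡ c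
    reduced zero      d≢ _   = contradiction refl d≢
    reduced d@(suc _) d≢ d<q with coprime-Bézout (prime⇒coprime q-prime d<q)
    ... | Bézout.-+ a b eq = b , trans (pow-* c b d) (trans (cong C (sym eq))
      (trans (cong (c ∙_) (C-multiple a)) (identityʳ c)))
    ... | Bézout.+- a b eq = (q ∸ 1) * b , trans (sym (pow-* (C d) (q ∸ 1) b))
      (trans (inverseʳ-unique w (pow (q ∸ 1) w) w^q) (sym (inverseˡ-unique c w cw≡ε)))
      where
      w = pow b (C d)
      cw≡ε : c ∙ w ≡ ε
      cw≡ε = trans (cong (c ∙_) (pow-* c b d)) (trans (cong C eq) (C-multiple a))
      w^q : w ∙ pow (q ∸ 1) w ≡ ε
      w^q = begin
        pow (suc (q ∸ 1)) w   ≡⟨ cong (λ k → pow k w) (ℕₚ.suc-pred q) ⟩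
        pow q w               ≡⟨ cong (pow q) (pow-* c b d) ⟩
        pow q (C (b * d))     ≡⟨ pow-* c q (b * d) ⟩
        C (q * (b * d))       ≡⟨ cong C (ℕₚ.*-comm q (b * d)) ⟩
        C (b * d * q)         ≡⟨ C-multiple (b * d) ⟩
        ε                     ∎
        where open ≡-Reasoning

  -- Among the q² products cⁱ g cʲ two must coincide.
  normal : n < q * q → ∀ g → ∃[ t ] g ∙ c ≡ C t ∙ g
  normal n<q² g with Finₚ.pigeonhole n<q² (λ x → let i , j = remQuot {q} q x in C (toℕ i) ∙ g ∙ C (toℕ j))
  ... | x , y , x<y , eq = conclude (C D Finₚ.≟ ε)
    where
    i = toℕ (proj₁ (remQuot {q} q x))
    j = toℕ (proj₂ (remQuot {q} q x))
    k = toℕ (proj₁ (remQuot {q} q y))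
    l = toℕ (proj₂ (remQuot {q} q y))
    i<q = Finₚ.toℕ<n (proj₁ (remQuot {q} q x))
    j<q = Finₚ.toℕ<n (proj₂ (remQuot {q} q x))
    k<q = Finₚ.toℕ<n (proj₁ (remQuot {q} q y))
    l<q = Finₚ.toℕ<n (proj₂ (remQuot {q} q y))
    -- `D` and `E` stand for j - l and k - i modulo q.
    D = j + (q ∸ l)
    E = (q ∸ i) + k

    key : g ∙ C D ≡ C E ∙ g
    key = begin
      g ∙ C D                                     ≡⟨ cong (g ∙_) (pow-+ c j (q ∸ l)) ⟩
      g ∙ (C j ∙ C (q ∸ l))                       ≡⟨ sym (identityˡ _) ⟩
      ε ∙ (g ∙ (C j ∙ C (q ∸ l)))                 ≡⟨ cong (_∙ (g ∙ (C j ∙ C (q ∸ l)))) (sym (C-complementˡ (ℕₚ.<⇒≤ i<q))) ⟩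
      C (q ∸ i) ∙ C i ∙ (g ∙ (C j ∙ C (q ∸ l)))   ≡⟨ assoc (C (q ∸ i)) (C i) _ ⟩
      C (q ∸ i) ∙ (C i ∙ (g ∙ (C j ∙ C (q ∸ l)))) ≡⟨ cong (C (q ∸ i) ∙_) (regroup (C i) (C j)) ⟩
      C (q ∸ i) ∙ (C i ∙ g ∙ C j ∙ C (q ∸ l))     ≡⟨ cong (λ a → C (q ∸ i) ∙ (a ∙ C (q ∸ l))) eq ⟩
      C (q ∸ i) ∙ (C k ∙ g ∙ C l ∙ C (q ∸ l))     ≡⟨ cong (C (q ∸ i) ∙_) (sym (regroup (C k) (C l))) ⟩
      C (q ∸ i) ∙ (C k ∙ (g ∙ (C l ∙ C (q ∸ l)))) ≡⟨ cong (λ a → C (q ∸ i) ∙ (C k ∙ (g ∙ a))) (C-complementʳ (ℕₚ.<⇒≤ l<q)) ⟩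
      C (q ∸ i) ∙ (C k ∙ (g ∙ ε))                 ≡⟨ cong (λ a → C (q ∸ i) ∙ (C k ∙ a)) (identityʳ g) ⟩
      C (q ∸ i) ∙ (C k ∙ g)                       ≡⟨ sym (assoc (C (q ∸ i)) (C k) g) ⟩
      C (q ∸ i) ∙ C k ∙ g                         ≡⟨ cong (_∙ g) (sym (pow-+ c (q ∸ i) k)) ⟩
      C E ∙ g                                     ∎
      where
      open ≡-Reasoning
      regroup : ∀ a b → a ∙ (g ∙ (b ∙ C (q ∸ l))) ≡ a ∙ g ∙ b ∙ C (q ∸ l)
      regroup a b = trans (sym (assoc a g _)) (sym (assoc (a ∙ g) b (C (q ∸ l))))

    -- If `C D` is nontrivial, c is a power of it and `key` passes to that power. Otherwise `C E` is
    -- trivial as well, and the two colliding pairs of exponents are equal.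
    conclude : Dec (C D ≡ ε) → ∃[ t ] g ∙ c ≡ C t ∙ g
    conclude (no D≢) with C-generates D D≢
    ... | a , p = a * E , trans (cong (g ∙_) (sym p)) (trans (pow-conjugate key a) (cong (_∙ g) (pow-* c a E)))
    conclude (yes D≡) = contradiction x<y (ℕₚ.<-irrefl (cong toℕ (remQuot-injective {q} q (cong₂ _,_
        (Finₚ.toℕ-injective i≡k) (Finₚ.toℕ-injective (C-difference j<q l<q D≡))))))
      where
      E≡ : C E ≡ ε
      E≡ = identityˡ-unique (C E) g (trans (sym key) (trans (cong (g ∙_) D≡) (identityʳ g)))
      i≡k : i ≡ k
      i≡k = sym (C-difference k<q i<q (trans (cong C (ℕₚ.+-comm k (q ∸ i))) E≡))

-- No (2,3)-generated group of order 6p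

prime[3] : Prime 3
prime[3] = from-yes (prime? 3)

-- The order n, later 6p, enters through inequalities: n < p² for the normality of ⟨c⟩, n < 9p for
-- the collision that puts w into ⟨σ⟩, and 6 < n for the final contradiction.
module NoTwoThree {p n : ℕ} (p-prime : Prime p) (p%3≡2 : p % 3 ≡ 2) (3<p : 3 < p)
                  (n<p² : n < p * p) (n<9p : n < 3 * (3 * p)) (6<n : 6 < n)
                  (X : TwoThreeGenerated n) (c : Fin n) (c≢ε : c ≢ TwoThreeGenerated.ε X)
                  (c^p≡ε : Powers.pow (TwoThreeGenerated.Γ X) p c ≡ TwoThreeGenerated.ε X) where
  open TwoThreeGenerated X
  open Powers Γ
  open CommutingPowers Γ

  private instance
    p≢0 : NonZero p
    p≢0 = Primality.prime⇒nonZero p-prime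

  σ^3≡ε : pow 3 σ ≡ ε
  σ^3≡ε = trans (cong (λ a → σ ∙ (σ ∙ a)) (identityʳ σ)) (trans (sym (assoc σ σ σ)) σ³≡ε)

  module P = PrimePowers Γ p-prime c≢ε c^p≡ε
  module S = PrimePowers Γ prime[3] σ≢ε σ^3≡ε
  open P using (C)

  -- Conjugation by σ permutes ⟨c⟩ ≅ ℤ/p; its orbits have one or three elements
  -- and p ≡ 2 mod 3, so it fixes more than the identity.
  σc≡cσ : σ ∙ c ≡ c ∙ σ
  σc≡cσ = conclude (any? (λ i → ¬? (i Finₚ.≟ o) ×-dec (f i Finₚ.≟ i)))
    where
    t = proj₁ (P.normal n<p² σ)

    σc : σ ∙ c ≡ C t ∙ σ
    σc = proj₂ (P.normal n<p² σ)

    0<p : 0 < p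
    0<p = ℕₚ.≤-trans (s≤s z≤n) 3<p

    o : Fin p
    o = fromℕ< 0<p

    toℕ-o : toℕ o ≡ 0
    toℕ-o = Finₚ.toℕ-fromℕ< 0<p

    f : Fin p → Fin p
    f i = (toℕ i * t) DivMod.mod p

    conjugate : ∀ i → C (toℕ (f i)) ∙ σ ≡ σ ∙ C (toℕ i)
    conjugate i = begin
      C (toℕ (f i)) ∙ σ     ≡⟨ cong (λ k → C k ∙ σ) (Finₚ.toℕ-fromℕ< (DivMod.m%n<n (toℕ i * t) p)) ⟩
      C (toℕ i * t % p) ∙ σ ≡⟨ cong (_∙ σ) (sym (P.C-% (toℕ i * t))) ⟩
      C (toℕ i * t) ∙ σ     ≡⟨ cong (_∙ σ) (sym (pow-* c (toℕ i) t)) ⟩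
      pow (toℕ i) (C t) ∙ σ ≡⟨ sym (pow-conjugate σc (toℕ i)) ⟩
      σ ∙ C (toℕ i)         ∎
      where open ≡-Reasoning

    -- On exponents f is conjugation by σ, so its cube is conjugation by σ³ = ε. The identity is
    -- proved with a right factor `pow 3 σ`, which is then cancelled.
    f³ : ∀ i → iter f 3 i ≡ i
    f³ i = Finₚ.toℕ-injective (P.C-injective (Finₚ.toℕ<n (iter f 3 i)) (Finₚ.toℕ<n i) (∙-cancelʳ (pow 3 σ) _ _ (begin
      C (toℕ (f (f (f i)))) ∙ (σ ∙ (σ ∙ (σ ∙ ε))) ≡⟨ move (f (f i)) (σ ∙ (σ ∙ ε)) ⟩
      σ ∙ (C (toℕ (f (f i))) ∙ (σ ∙ (σ ∙ ε)))     ≡⟨ cong (σ ∙_) (move (f i) (σ ∙ ε)) ⟩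
      σ ∙ (σ ∙ (C (toℕ (f i)) ∙ (σ ∙ ε)))         ≡⟨ cong (λ a → σ ∙ (σ ∙ a)) (move i ε) ⟩
      σ ∙ (σ ∙ (σ ∙ (C (toℕ i) ∙ ε)))             ≡⟨ cong (λ a → σ ∙ (σ ∙ (σ ∙ a))) (sym (identity-swap (C (toℕ i)))) ⟩
      σ ∙ (σ ∙ (σ ∙ (ε ∙ C (toℕ i))))             ≡⟨ regroup (C (toℕ i)) ⟩
      pow 3 σ ∙ C (toℕ i)                         ≡⟨ cong (_∙ C (toℕ i)) σ^3≡ε ⟩
      ε ∙ C (toℕ i)                               ≡⟨ identity-swap (C (toℕ i)) ⟩
      C (toℕ i) ∙ ε                               ≡⟨ cong (C (toℕ i) ∙_) (sym σ^3≡ε) ⟩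
      C (toℕ i) ∙ pow 3 σ                         ∎)))
      where
      open ≡-Reasoning
      move : ∀ j a → C (toℕ (f j)) ∙ (σ ∙ a) ≡ σ ∙ (C (toℕ j) ∙ a)
      move j a = trans (sym (assoc _ σ a)) (trans (cong (_∙ a) (conjugate j)) (assoc σ _ a))
      identity-swap : ∀ a → ε ∙ a ≡ a ∙ ε
      identity-swap a = trans (identityˡ a) (sym (identityʳ a))
      regroup : ∀ a → σ ∙ (σ ∙ (σ ∙ (ε ∙ a))) ≡ pow 3 σ ∙ a
      regroup a = sym (trans (assoc σ _ a) (cong (σ ∙_) (trans (assoc σ _ a) (cong (σ ∙_) (assoc σ ε a)))))

    fo≡o : f o ≡ o
    fo≡o = Finₚ.toℕ-injective (begin
      toℕ (f o)        ≡⟨ Finₚ.toℕ-fromℕ< (DivMod.m%n<n (toℕ o * t) p) ⟩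
      toℕ o * t % p    ≡⟨ cong (λ k → k * t % p) toℕ-o ⟩
      0 % p            ≡⟨ DivMod.m<n⇒m%n≡m 0<p ⟩
      0                ≡⟨ sym toℕ-o ⟩
      toℕ o            ∎)
      where open ≡-Reasoning

    conclude : Dec (∃[ i ] i ≢ o × f i ≡ i) → σ ∙ c ≡ c ∙ σ
    conclude (yes (i , i≢0 , fi≡i)) = let
        a , C^a≡c = P.C-generates (toℕ i)
          (λ e → i≢0 (Finₚ.toℕ-injective (trans (P.C-injective (Finₚ.toℕ<n i) 0<p e) (sym toℕ-o))))
      in subst (λ d → σ ∙ d ≡ d ∙ σ) C^a≡c
      (pow-conjugate (trans (sym (conjugate i)) (cong (λ k → C (toℕ k) ∙ σ) fi≡i)) a)
    conclude (no ¬found) = let k , p≡1+k*3 = unique-fixed-point prime[3] f f³ o fo≡o only-o in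
      contradiction (trans (sym p%3≡2) (trans (cong (_% 3) p≡1+k*3) (DivMod.[m+kn]%n≡m%n 1 k 3))) λ ()
      where
      only-o : ∀ i → f i ≡ i → i ≡ o
      only-o i fi≡i with i Finₚ.≟ o
      ... | yes i≡0 = i≡0
      ... | no i≢0  = contradiction (i , i≢0 , fi≡i) ¬found

  w : Fin n
  w = τ ∙ σ ∙ τ

  ττ : ∀ a → τ ∙ (τ ∙ a) ≡ a
  ττ a = trans (sym (assoc τ τ a)) (trans (cong (_∙ a) τ²≡ε) (identityˡ a))

  τw≡στ : τ ∙ w ≡ σ ∙ τ
  τw≡στ = trans (cong (τ ∙_) (assoc τ σ τ)) (ττ (σ ∙ τ))

  wτ≡τσ : w ∙ τ ≡ τ ∙ σ
  wτ≡τσ = trans (assoc (τ ∙ σ) τ τ) (trans (cong (τ ∙ σ ∙_) τ²≡ε) (identityʳ (τ ∙ σ)))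

  w≢ε : w ≢ ε
  w≢ε eq = σ≢ε (∙-cancelʳ τ σ ε (trans (sym τw≡στ)
    (trans (cong (τ ∙_) eq) (trans (identityʳ τ) (sym (identityˡ τ))))))

  w³≡ε : pow 3 w ≡ ε
  w³≡ε = ∙-cancelˡ τ (pow 3 w) ε (begin
    τ ∙ pow 3 w ≡⟨ pow-conjugate τw≡στ 3 ⟩
    pow 3 σ ∙ τ ≡⟨ cong (_∙ τ) σ^3≡ε ⟩
    ε ∙ τ       ≡⟨ trans (identityˡ τ) (sym (identityʳ τ)) ⟩
    τ ∙ ε       ∎)
    where open ≡-Reasoning

  -- τ normalizes ⟨c⟩ and σ centralizes it, so the conjugate w of σ centralizes it too.
  wc≡cw : w ∙ c ≡ c ∙ w
  wc≡cw = begin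
    τ ∙ σ ∙ τ ∙ c       ≡⟨ assoc (τ ∙ σ) τ c ⟩
    τ ∙ σ ∙ (τ ∙ c)     ≡⟨ cong (τ ∙ σ ∙_) τc ⟩
    τ ∙ σ ∙ (C t ∙ τ)   ≡⟨ assoc τ σ _ ⟩
    τ ∙ (σ ∙ (C t ∙ τ)) ≡⟨ cong (τ ∙_) (sym (assoc σ (C t) τ)) ⟩
    τ ∙ (σ ∙ C t ∙ τ)   ≡⟨ cong (λ a → τ ∙ (a ∙ τ)) (pow-conjugate σc≡cσ t) ⟩
    τ ∙ (C t ∙ σ ∙ τ)   ≡⟨ cong (τ ∙_) (assoc (C t) σ τ) ⟩
    τ ∙ (C t ∙ (σ ∙ τ)) ≡⟨ sym (assoc τ (C t) (σ ∙ τ)) ⟩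
    τ ∙ C t ∙ (σ ∙ τ)   ≡⟨ cong (_∙ (σ ∙ τ)) τCt≡cτ ⟩
    c ∙ τ ∙ (σ ∙ τ)     ≡⟨ assoc c τ (σ ∙ τ) ⟩
    c ∙ (τ ∙ (σ ∙ τ))   ≡⟨ cong (c ∙_) (sym (assoc τ σ τ)) ⟩
    c ∙ w               ∎
    where
    open ≡-Reasoning
    t = proj₁ (P.normal n<p² τ)
    τc : τ ∙ c ≡ C t ∙ τ
    τc = proj₂ (P.normal n<p² τ)
    τCt≡cτ : τ ∙ C t ≡ c ∙ τ
    τCt≡cτ = ∙-cancelʳ τ _ _ (begin
      τ ∙ C t ∙ τ   ≡⟨ assoc τ (C t) τ ⟩
      τ ∙ (C t ∙ τ) ≡⟨ cong (τ ∙_) (sym τc) ⟩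
      τ ∙ (τ ∙ c)   ≡⟨ ττ c ⟩
      c             ≡⟨ sym (identityʳ c) ⟩
      c ∙ ε         ≡⟨ cong (c ∙_) (sym τ²≡ε) ⟩
      c ∙ (τ ∙ τ)   ≡⟨ sym (assoc c τ τ) ⟩
      c ∙ τ ∙ τ     ∎)

  module W = PrimePowers Γ prime[3] w≢ε w³≡ε

  -- As p > 3, cubing is injective on ⟨c⟩. This removes the ⟨c⟩-component from elements whose cube
  -- is trivial.
  cube-trivial : ∀ k → C (3 * k) ≡ ε → C k ≡ ε
  cube-trivial k eq = [ (λ p∣3 → contradiction (Div.∣⇒≤ p∣3) (ℕₚ.<⇒≱ 3<p))
                      , (λ { (divides j k≡) → trans (cong C k≡) (P.C-multiple j) }) ]′
                      (Primality.euclidsLemma 3 k p-prime p∣3k)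
    where
    p∣3k : p ∣ 3 * k
    p∣3k = Div.m%n≡0⇒n∣m (3 * k) p (P.C-injective (DivMod.m%n<n (3 * k) p) (ℕₚ.≤-trans (s≤s z≤n) 3<p)
      (trans (sym (P.C-% (3 * k))) eq))

  -- Among the 9p products σⁱ wʲ cᵏ two must coincide, which puts w in ⟨σ⟩⟨c⟩.
  w∈⟨σ⟩ : ∃[ e ] w ≡ S.C e
  w∈⟨σ⟩ = conclude (W.C D Finₚ.≟ ε)
    where
    product-of : Fin (3 * (3 * p)) → Fin n
    product-of x = let i , y = remQuot {3} (3 * p) x ; j , k = remQuot {3} p y in
      S.C (toℕ i) ∙ W.C (toℕ j) ∙ C (toℕ k)

    collision = Finₚ.pigeonhole n<9p product-of

    x = proj₁ collision
    y = proj₁ (proj₂ collision)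

    x<y : toℕ x < toℕ y
    x<y = proj₁ (proj₂ (proj₂ collision))

    eq : product-of x ≡ product-of y
    eq = proj₂ (proj₂ (proj₂ collision))

    ijk = λ (x : Fin (3 * (3 * p))) → let i , y = remQuot {3} (3 * p) x in i , remQuot {3} p y
    i = toℕ (proj₁ (ijk x))
    j = toℕ (proj₁ (proj₂ (ijk x)))
    k = toℕ (proj₂ (proj₂ (ijk x)))
    i′ = toℕ (proj₁ (ijk y))
    j′ = toℕ (proj₁ (proj₂ (ijk y)))
    k′ = toℕ (proj₂ (proj₂ (ijk y)))
    i<3 = Finₚ.toℕ<n (proj₁ (ijk x))
    j<3 = Finₚ.toℕ<n (proj₁ (proj₂ (ijk x)))
    k<p = Finₚ.toℕ<n (proj₂ (proj₂ (ijk x)))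
    i′<3 = Finₚ.toℕ<n (proj₁ (ijk y))
    j′<3 = Finₚ.toℕ<n (proj₁ (proj₂ (ijk y)))
    k′<p = Finₚ.toℕ<n (proj₂ (proj₂ (ijk y)))
    -- `A`, `B` and `D` stand for i - i′ modulo 3, k′ - k modulo p and j′ - j modulo 3.
    A = (3 ∸ i′) + i
    B = k′ + (p ∸ k)
    D = j′ + (3 ∸ j)

    open ≡-Reasoning

    S-C : ∀ a b → S.C a ∙ C b ≡ C b ∙ S.C a
    S-C = pow-commute σc≡cσ

    W-C : ∀ a b → W.C a ∙ C b ≡ C b ∙ W.C a
    W-C = pow-commute wc≡cw

    swap : ∀ a b d → W.C a ∙ C b ∙ W.C d ≡ W.C (a + d) ∙ C b
    swap a b d = begin
      W.C a ∙ C b ∙ W.C d   ≡⟨ assoc (W.C a) (C b) (W.C d) ⟩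
      W.C a ∙ (C b ∙ W.C d) ≡⟨ cong (W.C a ∙_) (sym (W-C d b)) ⟩
      W.C a ∙ (W.C d ∙ C b) ≡⟨ sym (assoc (W.C a) (W.C d) (C b)) ⟩
      W.C a ∙ W.C d ∙ C b   ≡⟨ cong (_∙ C b) (sym (pow-+ w a d)) ⟩
      W.C (a + d) ∙ C b     ∎

    -- σ⁻ⁱ′ (σⁱ wʲ cᵏ) c⁻ᵏ w⁻ʲ, computed for both products.
    left : S.C (3 ∸ i′) ∙ (S.C i ∙ W.C j ∙ C k) ∙ C (p ∸ k) ∙ W.C (3 ∸ j) ≡ S.C A
    left = begin
      S.C (3 ∸ i′) ∙ (S.C i ∙ W.C j ∙ C k) ∙ C (p ∸ k) ∙ W.C (3 ∸ j)
        ≡⟨ cong (_∙ W.C (3 ∸ j)) (assoc (S.C (3 ∸ i′)) _ (C (p ∸ k))) ⟩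
      S.C (3 ∸ i′) ∙ (S.C i ∙ W.C j ∙ C k ∙ C (p ∸ k)) ∙ W.C (3 ∸ j)
        ≡⟨ cong (λ a → S.C (3 ∸ i′) ∙ a ∙ W.C (3 ∸ j)) (trans (assoc (S.C i ∙ W.C j) (C k) (C (p ∸ k)))
             (trans (cong (S.C i ∙ W.C j ∙_) (P.C-complementʳ (ℕₚ.<⇒≤ k<p))) (identityʳ _))) ⟩
      S.C (3 ∸ i′) ∙ (S.C i ∙ W.C j) ∙ W.C (3 ∸ j)
        ≡⟨ assoc (S.C (3 ∸ i′)) _ (W.C (3 ∸ j)) ⟩
      S.C (3 ∸ i′) ∙ (S.C i ∙ W.C j ∙ W.C (3 ∸ j))
        ≡⟨ cong (S.C (3 ∸ i′) ∙_) (trans (assoc (S.C i) (W.C j) (W.C (3 ∸ j)))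
             (trans (cong (S.C i ∙_) (W.C-complementʳ (ℕₚ.<⇒≤ j<3))) (identityʳ _))) ⟩
      S.C (3 ∸ i′) ∙ S.C i
        ≡⟨ sym (pow-+ σ (3 ∸ i′) i) ⟩
      S.C A ∎

    right : S.C (3 ∸ i′) ∙ (S.C i′ ∙ W.C j′ ∙ C k′) ∙ C (p ∸ k) ∙ W.C (3 ∸ j) ≡ W.C D ∙ C B
    right = begin
      S.C (3 ∸ i′) ∙ (S.C i′ ∙ W.C j′ ∙ C k′) ∙ C (p ∸ k) ∙ W.C (3 ∸ j)
        ≡⟨ cong (λ a → a ∙ C (p ∸ k) ∙ W.C (3 ∸ j)) (trans (cong (S.C (3 ∸ i′) ∙_) (assoc (S.C i′) (W.C j′) (C k′)))
             (trans (sym (assoc (S.C (3 ∸ i′)) (S.C i′) _))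
               (trans (cong (_∙ (W.C j′ ∙ C k′)) (S.C-complementˡ (ℕₚ.<⇒≤ i′<3))) (identityˡ _)))) ⟩
      W.C j′ ∙ C k′ ∙ C (p ∸ k) ∙ W.C (3 ∸ j)
        ≡⟨ cong (_∙ W.C (3 ∸ j)) (trans (assoc (W.C j′) (C k′) (C (p ∸ k))) (cong (W.C j′ ∙_) (sym (pow-+ c k′ (p ∸ k))))) ⟩
      W.C j′ ∙ C B ∙ W.C (3 ∸ j)
        ≡⟨ swap j′ B (3 ∸ j) ⟩
      W.C D ∙ C B ∎

    key : S.C A ≡ W.C D ∙ C B
    key = trans (sym left)
      (trans (cong (λ a → S.C (3 ∸ i′) ∙ a ∙ C (p ∸ k) ∙ W.C (3 ∸ j)) eq) right)

    cube-S : ∀ a → pow 3 (S.C a) ≡ ε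
    cube-S a = trans (pow-* σ 3 a) (trans (cong S.C (ℕₚ.*-comm 3 a)) (S.C-multiple a))

    -- If the exponents of w agree, `key` equates a power of σ with a power of c; its cube is
    -- trivial, so both are trivial and the two triples coincide. Otherwise w is a power of `W.C D`,
    -- hence a power of σ times one of c, and w³ = ε removes the latter.
    conclude : Dec (W.C D ≡ ε) → ∃[ e ] w ≡ S.C e
    conclude (yes D≡) = contradiction x<y (ℕₚ.<-irrefl (cong toℕ (remQuot-injective {3} (3 * p)
      (cong₂ _,_ (Finₚ.toℕ-injective i≡i′) (remQuot-injective {3} p
        (cong₂ _,_ (Finₚ.toℕ-injective (sym (W.C-difference j′<3 j<3 D≡)))
                   (Finₚ.toℕ-injective (sym (P.C-difference k′<p k<p B≡)))))))))
      where
      S≡C : S.C A ≡ C B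
      S≡C = trans key (trans (cong (_∙ C B) D≡) (identityˡ (C B)))
      B≡ : C B ≡ ε
      B≡ = cube-trivial B (trans (sym (pow-* c 3 B)) (trans (cong (pow 3) (sym S≡C)) (cube-S A)))
      i≡i′ : i ≡ i′
      i≡i′ = S.C-difference i<3 i′<3 (trans (cong S.C (ℕₚ.+-comm i (3 ∸ i′))) (trans S≡C B≡))
    conclude (no D≢) = a * A , (begin
        w                       ≡⟨ w≡ ⟩
        S.C (a * A) ∙ C (a * F) ≡⟨ cong (S.C (a * A) ∙_) (cube-trivial (a * F) cubed) ⟩
        S.C (a * A) ∙ ε         ≡⟨ identityʳ _ ⟩
        S.C (a * A)             ∎)
      where
      a = proj₁ (W.C-generates D D≢)

      W^a≡w : pow a (W.C D) ≡ w
      W^a≡w = proj₂ (W.C-generates D D≢)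

      -- `F` stands for -B modulo p.
      F = (p ∸ 1) * B

      C-inverse : C B ∙ C F ≡ ε
      C-inverse = trans (sym (pow-+ c B F)) (trans (cong C (trans (cong (_* B) (ℕₚ.suc-pred p)) (ℕₚ.*-comm p B))) (P.C-multiple B))

      W≡ : W.C D ≡ S.C A ∙ C F
      W≡ = sym (trans (cong (_∙ C F) key) (trans (assoc (W.C D) (C B) (C F))
        (trans (cong (W.C D ∙_) C-inverse) (identityʳ _))))

      w≡ : w ≡ S.C (a * A) ∙ C (a * F)
      w≡ = trans (sym W^a≡w) (trans (cong (pow a) W≡) (trans (pow-∙ (S-C A F) a)
        (cong₂ _∙_ (pow-* σ a A) (pow-* c a F))))

      cubed : C (3 * (a * F)) ≡ ε
      cubed = begin
        C (3 * (a * F))                           ≡⟨ sym (pow-* c 3 (a * F)) ⟩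
        pow 3 (C (a * F))                         ≡⟨ sym (identityˡ _) ⟩
        ε ∙ pow 3 (C (a * F))                     ≡⟨ cong (_∙ pow 3 (C (a * F))) (sym (cube-S (a * A))) ⟩
        pow 3 (S.C (a * A)) ∙ pow 3 (C (a * F))   ≡⟨ sym (pow-∙ (S-C (a * A) (a * F)) 3) ⟩
        pow 3 (S.C (a * A) ∙ C (a * F))           ≡⟨ cong (pow 3) (sym w≡) ⟩
        pow 3 w                                   ≡⟨ w³≡ε ⟩
        ε                                         ∎

  Normal : Fin n → Set
  Normal γ = ∃[ i ] (γ ≡ S.C i ⊎ γ ≡ S.C i ∙ τ)

  -- Only the step from σⁱτ by σ reorders factors: τσ = wτ, and w is a power of σ.
  normal-step : ∀ {γ δ} → Step γ δ → Normal γ → Normal δ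
  normal-step (inj₁ refl) (i , inj₁ refl) = i + 1 , inj₁
    (trans (cong (S.C i ∙_) (sym (identityʳ σ))) (sym (pow-+ σ i 1)))
  normal-step (inj₂ refl) (i , inj₁ refl) = i , inj₂ refl
  normal-step (inj₂ refl) (i , inj₂ refl) = i , inj₁
    (trans (assoc (S.C i) τ τ) (trans (cong (S.C i ∙_) τ²≡ε) (identityʳ (S.C i))))
  normal-step (inj₁ refl) (i , inj₂ refl) = i + e , inj₂ (begin
    S.C i ∙ τ ∙ σ       ≡⟨ assoc (S.C i) τ σ ⟩
    S.C i ∙ (τ ∙ σ)     ≡⟨ cong (S.C i ∙_) (sym wτ≡τσ) ⟩
    S.C i ∙ (w ∙ τ)     ≡⟨ cong (λ a → S.C i ∙ (a ∙ τ)) (proj₂ w∈⟨σ⟩) ⟩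
    S.C i ∙ (S.C e ∙ τ) ≡⟨ sym (assoc (S.C i) (S.C e) τ) ⟩
    S.C i ∙ S.C e ∙ τ   ≡⟨ cong (_∙ τ) (sym (pow-+ σ i e)) ⟩
    S.C (i + e) ∙ τ     ∎)
    where
    open ≡-Reasoning
    e = proj₁ w∈⟨σ⟩

  normal-form : ∀ γ → Normal γ
  normal-form γ = Star-invariant normal-step (generated γ) (0 , inj₁ refl)

  code : ∀ {γ} → Normal γ → Fin 3 × Fin 2
  code (i , inj₁ _) = i DivMod.mod 3 , zero
  code (i , inj₂ _) = i DivMod.mod 3 , suc zero

  S-mod : ∀ i → S.C i ≡ S.C (toℕ (i DivMod.mod 3))
  S-mod i = trans (S.C-% i) (cong S.C (sym (Finₚ.toℕ-fromℕ< (DivMod.m%n<n i 3))))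

  code-injective : ∀ {γ δ} (x : Normal γ) (y : Normal δ) → code x ≡ code y → γ ≡ δ
  code-injective (i , inj₁ refl) (j , inj₁ refl) eq =
    trans (S-mod i) (trans (cong (S.C ∘ toℕ ∘ proj₁) eq) (sym (S-mod j)))
  code-injective (i , inj₂ refl) (j , inj₂ refl) eq = cong (_∙ τ)
    (trans (S-mod i) (trans (cong (S.C ∘ toℕ ∘ proj₁) eq) (sym (S-mod j))))
  code-injective (i , inj₁ refl) (j , inj₂ refl) ()
  code-injective (i , inj₂ refl) (j , inj₁ refl) ()

  impossible : ⊥
  impossible = ℕₚ.<⇒≱ 6<n (Finₚ.injective⇒≤ {n = 6}
    {f = λ γ → let i , j = code (normal-form γ) in combine i j}
    (λ {γ} {δ} eq → code-injective (normal-form γ) (normal-form δ)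
      (let p , q = Finₚ.combine-injective {3} {2} _ _ _ _ eq in cong₂ _,_ p q)))

¬twoThreeGenerated : ∀ {p} → Prime p → 6 < p → p % 3 ≡ 2 → ¬ TwoThreeGenerated (6 * p)
¬twoThreeGenerated {p@(suc (suc p-2))} p-prime 6<p p%3≡2 X =
  let c , c≢ε , c^p≡ε = McKay.cauchy (TwoThreeGenerated.Γ X) p-2 p-prime (Div.n∣m*n 6) in
  NoTwoThree.impossible p-prime p%3≡2 (ℕₚ.≤-trans (s≤s (ℕₚ.m≤m+n 3 3)) 6<p)
    (ℕₚ.*-monoˡ-< p 6<p) (subst (6 * p <_) (ℕₚ.*-assoc 3 3 p) (ℕₚ.*-monoˡ-< p (s≤s (ℕₚ.m≤m+n 6 2))))
    (ℕₚ.<-≤-trans 6<p (ℕₚ.m≤n*m p 6)) X c c≢ε c^p≡ε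

-- Infinitely many primes are congruent to 2 modulo 3

-- A factor ≡ 0 would make the product ≡ 0 modulo 3, and a factor ≡ 1 leaves the residue of the
-- remaining product unchanged.
prime-factor≡2 : ∀ {ps} → All Prime ps → product ps % 3 ≡ 2 → ∃[ p ] p ∈ ps × Prime p × p % 3 ≡ 2
prime-factor≡2 {x ∷ ps} (x-prime ∷ primes) eq = by-residue (x % 3) refl (DivMod.m%n<n x 3)
  where
  reduce : ∀ r → x % 3 ≡ r → (r * (product ps % 3)) % 3 ≡ 2
  reduce r refl = trans (sym (DivMod.%-distribˡ-* x (product ps) 3)) eq

  by-residue : ∀ r → x % 3 ≡ r → r < 3 → ∃[ p ] p ∈ x ∷ ps × Prime p × p % 3 ≡ 2
  by-residue 0 x≡0 _ = contradiction (reduce 0 x≡0) λ ()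
  by-residue 1 x≡1 _ =
    let p , p∈ , p-prime , p≡2 = prime-factor≡2 primes (trans (sym (DivMod.m%n%n≡m%n (product ps) 3))
          (trans (cong (_% 3) (sym (ℕₚ.*-identityˡ (product ps % 3)))) (reduce 1 x≡1)))
    in p , there p∈ , p-prime , p≡2
  by-residue 2 x≡2 _ = x , here refl , x-prime , x≡2
  by-residue (suc (suc (suc _))) _ (s≤s (s≤s (s≤s ())))

∈⇒∣product : ∀ {p ps} → p ∈ ps → p ∣ product ps
∈⇒∣product {ps = _ ∷ ps} (here refl) = Div.m∣m*n (product ps)
∈⇒∣product {ps = x ∷ ps} (there p∈)  = Div.∣n⇒∣m*n x (∈⇒∣product p∈)

∣! : ∀ {p N} → 0 < p → p ≤ N → p ∣ N ℕ.!
∣! {suc p} _ p≤N = Div.∣-trans (Div.m∣m*n (p ℕ.!)) (Div.m≤n⇒m!∣n! p≤N)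

-- A prime factor of 3 · N! - 1 congruent to 2 modulo 3 exceeds N.
primes≡2-unbounded : ∀ N → ∃[ p ] Prime p × N < p × p % 3 ≡ 2
primes≡2-unbounded N = let p , p∈ , p-prime , p≡2 = prime-factor in
  p , p-prime , ℕₚ.≰⇒> (too-small p-prime (subst (p ∣_) (sym isFactorisation) (∈⇒∣product p∈))) , p≡2
  where
  f = ℕ.pred (N ℕ.!)

  N! : suc f ≡ N ℕ.!
  N! = ℕₚ.suc-pred (N ℕ.!) {{N ℕₚ.!≢0}}

  -- As suc f = N!, this number is 3 · N! - 1, written so that its residue 2 modulo 3 is apparent.
  open PrimeFactorisation (factorise (2 + f * 3))

  prime-factor : ∃[ p ] p ∈ factors × Prime p × p % 3 ≡ 2
  prime-factor = prime-factor≡2 factorsPrime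
    (trans (cong (_% 3) (sym isFactorisation)) (DivMod.[m+kn]%n≡m%n 2 f 3))

  too-small : ∀ {p} → Prime p → p ∣ 2 + f * 3 → ¬ (p ≤ N)
  too-small {p} p-prime p∣ p≤N = Primality.¬prime[1] (subst Prime (Div.∣1⇒≡1 p∣1) p-prime)
    where
    p∣3N! : p ∣ 2 + f * 3 + 1
    p∣3N! = subst (p ∣_) (trans (cong (_* 3) (sym N!)) (ℕₚ.+-comm 1 (2 + f * 3)))
      (Div.∣m⇒∣m*n 3 (∣! (ℕ.>-nonZero⁻¹ p {{Primality.prime⇒nonZero p-prime}}) p≤N))

    p∣1 : p ∣ 1
    p∣1 = Div.∣m+n∣m⇒∣n p∣3N! p∣

-- The maximal order

-- The decision is a parameter, so that its value is settled by a proof or a refutation of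
-- `TwoThreeGenerated` and not by evaluating the search.
maximum : ∀ h → Dec (TwoThreeGenerated (6 * h)) → ℕ
maximum h (yes _) = 6 * h
maximum h (no _)  = 4 * h

maximum-yes : ∀ h d → TwoThreeGenerated (6 * h) → maximum h d ≡ 6 * h
maximum-yes h (yes _) X = refl
maximum-yes h (no ¬X) X = contradiction X ¬X

maximum-no : ∀ h d → ¬ TwoThreeGenerated (6 * h) → maximum h d ≡ 4 * h
maximum-no h (yes X) ¬X = contradiction X ¬X
maximum-no h (no _)  ¬X = refl

4h≤6h : ∀ h → 4 * h ≤ 6 * h
4h≤6h h = ℕₚ.*-monoˡ-≤ h (ℕₚ.m≤m+n 4 2)

maximum-isMax : ∀ h → 1 ≤ h → (d : Dec (TwoThreeGenerated (6 * h))) →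
                IsMaxHarmonicGroupOrder (suc h) (maximum h d)
maximum-isMax h 1≤h (yes X) = twoThreeGenerated⇒harmonic X , λ n order-n →
  [ (λ le → ℕₚ.≤-trans le (4h≤6h h)) , (λ (eq , _) → ℕₚ.≤-reflexive eq) ]′ (harmonic-bound 1≤h order-n)
maximum-isMax (suc h) 1≤h (no ¬X) = Dihedral.dihedral-harmonic h , λ n order-n →
  [ id , (λ (eq , Y) → contradiction (subst TwoThreeGenerated eq Y) ¬X) ]′ (harmonic-bound 1≤h order-n)

maximum-cases : ∀ h d → maximum h d ≡ 4 * h ⊎ maximum h d ≡ 6 * h
maximum-cases h (yes _) = inj₂ refl
maximum-cases h (no _)  = inj₁ refl

maximum-bounds : ∀ h d → 4 * h ≤ maximum h d × maximum h d ≤ 6 * h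
maximum-bounds h (yes _) = 4h≤6h h , ℕₚ.≤-refl
maximum-bounds h (no _)  = ℕₚ.≤-refl , 4h≤6h h

theorem1p1 : Σ[ M ∈ (ℕ → ℕ) ]
    (∀ g → 2 ≤ g → IsMaxHarmonicGroupOrder g (M g)) ×
    (∀ g → 2 ≤ g → 4 * (g ∸ 1) ≤ M g × M g ≤ 6 * (g ∸ 1)) ×
    (∀ g → 2 ≤ g → M g ≡ 4 * (g ∸ 1) ⊎ M g ≡ 6 * (g ∸ 1)) ×
    InfinitelyMany (λ g → 2 ≤ g × M g ≡ 4 * (g ∸ 1)) ×
    InfinitelyMany (λ g → 2 ≤ g × M g ≡ 6 * (g ∸ 1))
theorem1p1 = M , isMax , (λ g _ → maximum-bounds (g ∸ 1) (decide (g ∸ 1))) ,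
    (λ g _ → maximum-cases (g ∸ 1) (decide (g ∸ 1))) , often-4 , often-6
  where
  decide : ∀ h → Dec (TwoThreeGenerated (6 * h))
  decide h = twoThreeGenerated? (6 * h)

  M : ℕ → ℕ
  M g = maximum (g ∸ 1) (decide (g ∸ 1))

  isMax : ∀ g → 2 ≤ g → IsMaxHarmonicGroupOrder g (M g)
  isMax (suc h) (s≤s 1≤h) = maximum-isMax h 1≤h (decide h)

  often-4 : InfinitelyMany (λ g → 2 ≤ g × M g ≡ 4 * (g ∸ 1))
  often-4 N = let p , p-prime , N+6<p , p≡2 = primes≡2-unbounded (N + 6) in
    suc p , ℕₚ.m≤n⇒m≤1+n (ℕₚ.≤-trans (ℕₚ.m≤m+n N 6) (ℕₚ.<⇒≤ N+6<p)) ,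
    s≤s (ℕₚ.≤-trans (s≤s z≤n) N+6<p) ,
    maximum-no p (decide p) (¬twoThreeGenerated p-prime (ℕₚ.≤-<-trans (ℕₚ.m≤n+m 6 N) N+6<p) p≡2)

  often-6 : InfinitelyMany (λ g → 2 ≤ g × M g ≡ 6 * (g ∸ 1))
  often-6 j = suc N , ℕₚ.m≤n⇒m≤1+n (ℕₚ.m≤n⇒m≤1+n j≤) , s≤s (s≤s z≤n) ,
    maximum-yes N (decide N) (Eisenstein.eisenstein-twoThreeGenerated j)
    where
    N = Eisenstein.N j

    j≤ : j ≤ 9 * (j * j) + 3 * j
    j≤ = ℕₚ.≤-trans (ℕₚ.m≤m+n j (2 * j)) (ℕₚ.m≤n+m (3 * j) (9 * (j * j)))
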